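{- Fix an integer $k\ge 2$ and a real number $E\ge 1$. Then, for $\mathbf{n}=(n_1,\dots,n_k)$ ranging over $\mathcal{C}^k_E$, $$|Q(k,\mathbf{n})|=\frac{n_1\cdots n_k}{\zeta(k)}+\mathcal{O}(f_k(\mathbf{n})),$$ where $\zeta$ is the Riemann zeta function.
   Context: For $\mathbf{n}=(n_1,\dots,n_k)\in\mathbb{R}^k$ with all $n_i\ge 1$, $Q(k,\mathbf{n})$ is the set of all relatively prime $k$-tuples $(a_1,\dots,a_k)$ of positive integers (i.e. $\gcd(a_1,\dots,a_k)=1$) with $a_i\le n_i$ for each $i$. The set $\mathcal{C}^k_E$ consists of all $\mathbf{n}\in\mathbb{R}^k$ with every $n_i\ge 1$ and $\max\{n_1,\dots,n_k\}/\min\{n_1,\dots,n_k\}\le E$. Let $\gamma(\mathbf{n})=(n_1\cdots n_k)^{1/k}$, and define $f_k(\mathbf{n})=\gamma(\mathbf{n})\ln(\gamma(\mathbf{n}))$ if $k=2$ and $f_k(\mathbf{n})=\gamma(\mathbf{n})^{k-1}$ if $k>2$. For real functions $F,F_1,g$ on $\mathcal{C}^k_E$ with $g>0$ outside some compact set, $F=F_1+\mathcal{O}(g)$ means that there are a constant $M$ and a compact set $C\subseteq\mathcal{C}^k_E$ with $|F(\mathbf{n})-F_1(\mathbf{n})|\le M g(\mathbf{n})$ for all $\mathbf{n}\in \mathcal{C}^k_E\setminus C$. (The constant may depend on $k$ and $E$.) -}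

module Defs where

open import Data.Nat as ℕ using (ℕ; zero; suc; NonZero; NonTrivial)
import Data.Nat.Properties as ℕP
import Data.Integer.Base as ℤ
import Data.Integer.Properties as ℤP
open import Data.Rational as ℚ using (ℚ; 0ℚ; 1ℚ; ½) hiding (module ℚ)
import Data.Rational.Properties as ℚP
import Data.Nat.Coprimality as Coprimality
open import Data.Product using (Σ; _×_; _,_; proj₁; proj₂; Σ-syntax)
open import Data.Sum using (inj₁; inj₂)
open import Level using (0ℓ)
open import Data.List as List using (List; []; _∷_; length)
open import Data.List.Membership.Propositional using (_∈_)
open import Data.List.Membership.Propositional.Properties using (∈-cartesianProductWith⁺; ∈-upTo⁺)
import Data.List.Relation.Unary.All as ListAll
open import Data.List.Relation.Unary.Any using (Any; here; there)
open import Data.List.Relation.Unary.Unique.Propositional using (Unique; []; _∷_)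
import Data.List.Relation.Unary.Unique.Propositional.Properties as Unique
open import Data.Nat.GCD using (gcd)
open import Data.Vec as Vec using (Vec; []; _∷_)
import Data.Vec.Properties as VecP
open import Data.Vec.Relation.Binary.Pointwise.Inductive using (Pointwise; []; _∷_)
open import Data.Vec.Relation.Unary.All using (All; []; _∷_)
open import Function.Bundles using (_⇔_; mk⇔)
open import Relation.Nullary.Decidable using (¬¬-excluded-middle)
open import Relation.Unary using (Pred)
open import Relation.Binary.PropositionalEquality
  using (_≡_; refl; sym; trans; cong; cong₂; subst; subst₂)
open import Relation.Nullary using (¬_; Dec; yes; no; contradiction)
open import Relation.Nullary.Decidable using (dec⇒maybe)
open import Tactic.RingSolver using (solve-∀)
open import Tactic.RingSolver.Core.AlmostCommutativeRing
  using (AlmostCommutativeRing; fromCommutativeRing)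

module Rational where

  open ℚ using (_+_; _*_; _-_; -_; _≤_; _<_; _⊔_; _⊓_; ∣_∣)
  open import Algebra.Definitions.RawSemiring ℚ.+-*-rawSemiring public using (_^_)

  ℚ-ring : AlmostCommutativeRing 0ℓ 0ℓ
  ℚ-ring = fromCommutativeRing ℚP.+-*-commutativeRing (λ q → dec⇒maybe (0ℚ ℚP.≟ q))

  fromℕ : ℕ → ℚ
  fromℕ zero    = 0ℚ
  fromℕ (suc n) = 1ℚ + fromℕ n

  recip : (q : ℚ) → 0ℚ < q → ℚ
  recip q 0<q = (ℚ.1/ q) {{ℚP.pos⇒nonZero q {{ℚ.positive 0<q}}}}

  ≤-by : ∀ {a b} c → 0ℚ ≤ c → b ≡ a + c → a ≤ b
  ≤-by {a} {b} c 0≤c b≡a+c = begin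
    a       ≡⟨ ℚP.+-identityʳ a ⟨
    a + 0ℚ  ≤⟨ ℚP.+-monoʳ-≤ a 0≤c ⟩
    a + c   ≡⟨ b≡a+c ⟨
    b       ∎ where open ℚP.≤-Reasoning

  0≤1 : 0ℚ ≤ 1ℚ
  0≤1 = ℚP.nonNegative⁻¹ 1ℚ

  0<1 : 0ℚ < 1ℚ
  0<1 = ℚP.positive⁻¹ 1ℚ

  0<½ : 0ℚ < ½
  0<½ = ℚP.positive⁻¹ ½

  <⇒≤ : ∀ {a b} → a < b → a ≤ b
  <⇒≤ = ℚP.<⇒≤

  0≤+ : ∀ {a b} → 0ℚ ≤ a → 0ℚ ≤ b → 0ℚ ≤ a + b
  0≤+ = ℚP.+-mono-≤

  0<+ : ∀ {a b} → 0ℚ < a → 0ℚ ≤ b → 0ℚ < a + b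
  0<+ = ℚP.+-mono-<-≤

  0≤* : ∀ {a b} → 0ℚ ≤ a → 0ℚ ≤ b → 0ℚ ≤ a * b
  0≤* {a} {b} p q = ℚP.nonNegative⁻¹ (a * b)
    {{ℚP.nonNeg*nonNeg⇒nonNeg a {{ℚ.nonNegative p}} b {{ℚ.nonNegative q}}}}

  0<* : ∀ {a b} → 0ℚ < a → 0ℚ < b → 0ℚ < a * b
  0<* {a} {b} p q = ℚP.positive⁻¹ (a * b)
    {{ℚP.pos*pos⇒pos a {{ℚ.positive p}} b {{ℚ.positive q}}}}

  *-monoˡ : ∀ {c a b} → 0ℚ ≤ c → a ≤ b → c * a ≤ c * b
  *-monoˡ {c} 0≤c = ℚP.*-monoˡ-≤-nonNeg c {{ℚ.nonNegative 0≤c}}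

  *-mono : ∀ {a b c d} → 0ℚ ≤ a → a ≤ b → 0ℚ ≤ c → c ≤ d → a * c ≤ b * d
  *-mono {a} {b} {c} {d} 0≤a a≤b 0≤c c≤d =
    ℚP.≤-trans (*-monoˡ 0≤a c≤d)
      (ℚP.*-monoʳ-≤-nonNeg d {{ℚ.nonNegative (ℚP.≤-trans 0≤c c≤d)}} a≤b)

  0<⊓ : ∀ {a b} → 0ℚ < a → 0ℚ < b → 0ℚ < a ⊓ b
  0<⊓ {a} {b} p q with ℚP.≤-total a b
  ... | inj₁ a≤b = subst (0ℚ <_) (sym (ℚP.p≤q⇒p⊓q≡p a≤b)) p
  ... | inj₂ b≤a = subst (0ℚ <_) (sym (ℚP.p≥q⇒p⊓q≡q b≤a)) q

  half-split : ∀ a → ½ * a + ½ * a ≡ a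
  half-split = solve-∀ ℚ-ring

  p≤∣p∣ : ∀ p → p ≤ ∣ p ∣
  p≤∣p∣ p with ℚP.≤-total 0ℚ p
  ... | inj₁ 0≤p = ℚP.≤-reflexive (sym (ℚP.0≤p⇒∣p∣≡p 0≤p))
  ... | inj₂ p≤0 = ℚP.≤-trans p≤0 (ℚP.0≤∣p∣ p)

  ∣∣≤ : ∀ {p e} → p ≤ e → - p ≤ e → ∣ p ∣ ≤ e
  ∣∣≤ {p} {e} u v with ℚP.∣p∣≡p∨∣p∣≡-p p
  ... | inj₁ eq = subst (_≤ e) (sym eq) u
  ... | inj₂ eq = subst (_≤ e) (sym eq) v

  moveʳ : ∀ p q → p ≡ q + (p - q)
  moveʳ = solve-∀ ℚ-ring
  swap- : ∀ p q → - (p - q) ≡ q - p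
  swap- = solve-∀ ℚ-ring
  cancelˡ : ∀ q e → (q + e) - q ≡ e
  cancelˡ = solve-∀ ℚ-ring

  diff≤ : ∀ {p q e} → p ≤ q + e → p - q ≤ e
  diff≤ {p} {q} {e} h = subst (p - q ≤_) (cancelˡ q e) (ℚP.+-monoˡ-≤ (- q) h)

  ∣-∣≤ : ∀ {p q e} → p ≤ q + e → q ≤ p + e → ∣ p - q ∣ ≤ e
  ∣-∣≤ {p} {q} {e} h h′ = ∣∣≤ (diff≤ h) (subst (_≤ e) (sym (swap- p q)) (diff≤ h′))

  ∣-∣≤⇒ : ∀ {p q e} → ∣ p - q ∣ ≤ e → p ≤ q + e
  ∣-∣≤⇒ {p} {q} {e} h = subst (_≤ q + e) (sym (moveʳ p q))
    (ℚP.+-monoʳ-≤ q (ℚP.≤-trans (p≤∣p∣ (p - q)) h))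

  ∣-∣-sym : ∀ p q → ∣ p - q ∣ ≡ ∣ q - p ∣
  ∣-∣-sym p q = trans (sym (ℚP.∣-p∣≡∣p∣ (p - q))) (cong ∣_∣ (swap- p q))

  ∣+∣≤ : ∀ {p q a b} → ∣ p ∣ ≤ a → ∣ q ∣ ≤ b → ∣ p + q ∣ ≤ a + b
  ∣+∣≤ {p} {q} u v = ℚP.≤-trans (ℚP.∣p+q∣≤∣p∣+∣q∣ p q) (ℚP.+-mono-≤ u v)

  ∣*∣≤ : ∀ {p q a b} → ∣ p ∣ ≤ a → ∣ q ∣ ≤ b → ∣ p * q ∣ ≤ a * b
  ∣*∣≤ {p} {q} {a} {b} u v = subst (_≤ a * b) (sym (ℚP.∣p*q∣≡∣p∣*∣q∣ p q))
    (*-mono (ℚP.0≤∣p∣ p) u (ℚP.0≤∣p∣ q) v)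

  *-recip : ∀ {q} 0<q → q * recip q 0<q ≡ 1ℚ
  *-recip {q} 0<q = ℚP.*-inverseʳ q {{ℚP.pos⇒nonZero q {{ℚ.positive 0<q}}}}

  0<recip : ∀ {q} 0<q → 0ℚ < recip q 0<q
  0<recip {q} 0<q = ℚP.positive⁻¹ _ {{ℚP.1/pos⇒pos q {{ℚ.positive 0<q}}}}

  assoc-swap : ∀ a b c → a * (b * c) ≡ b * (a * c)
  assoc-swap = solve-∀ ℚ-ring

  *-recip-* : ∀ {q} 0<q e → q * (e * recip q 0<q) ≡ e
  *-recip-* {q} 0<q e =
    trans (assoc-swap q e _) (trans (cong (e *_) (*-recip 0<q)) (ℚP.*-identityʳ e))

  recip-diff : ∀ {a b} (0<a : 0ℚ < a) (0<b : 0ℚ < b) →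
               recip a 0<a - recip b 0<b ≡ (b - a) * (recip a 0<a * recip b 0<b)
  recip-diff {a} {b} 0<a 0<b = sym (trans (step a b r s)
    (trans (cong₂ (λ u v → u * r - v * s) (*-recip 0<b) (*-recip 0<a))
           (cong₂ _-_ (ℚP.*-identityˡ r) (ℚP.*-identityˡ s))))
    where
    r = recip a 0<a
    s = recip b 0<b
    step : ∀ a b r s → (b - a) * (r * s) ≡ (b * s) * r - (a * r) * s
    step = solve-∀ ℚ-ring

  recip-anti : ∀ {a b} (0<a : 0ℚ < a) (0<b : 0ℚ < b) → a ≤ b → recip b 0<b ≤ recip a 0<a
  recip-anti {a} {b} 0<a 0<b a≤b = ≤-by ((b - a) * (recip a 0<a * recip b 0<b))
    (0≤* 0≤b-a (<⇒≤ (0<* (0<recip 0<a) (0<recip 0<b))))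
    (trans (moveʳ (recip a 0<a) (recip b 0<b)) (cong (recip b 0<b ℚ.+_) (recip-diff 0<a 0<b)))
    where
    0≤b-a : 0ℚ ≤ b - a
    0≤b-a = subst (_≤ b - a) (ℚP.+-inverseʳ a) (ℚP.+-monoˡ-≤ (- a) a≤b)

  asFraction : ∀ n → fromℕ n ≡ ℚ.mkℚ (ℤ.+ n) 0 (Coprimality.sym (Coprimality.1-coprimeTo n))
  asFraction zero    = refl
  asFraction (suc n) = trans (cong (1ℚ +_) (asFraction n))
    (trans (cong (ℚ._/ 1) (cong (ℤ._+_ (ℤ.+ 1)) (ℤP.*-identityʳ (ℤ.+ n))))
           (ℚP.normalize-coprime (Coprimality.sym (Coprimality.1-coprimeTo (suc n)))))

  0≤fromℕ : ∀ n → 0ℚ ≤ fromℕ n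
  0≤fromℕ zero    = ℚP.≤-refl
  0≤fromℕ (suc n) = 0≤+ 0≤1 (0≤fromℕ n)

  0<fromℕ : ∀ n → 0ℚ < fromℕ (suc n)
  0<fromℕ n = 0<+ 0<1 (0≤fromℕ n)

  fromℕ-mono : ∀ {m n} → m ℕ.≤ n → fromℕ m ≤ fromℕ n
  fromℕ-mono {n = n} ℕ.z≤n = 0≤fromℕ n
  fromℕ-mono {suc m} {suc n} (ℕ.s≤s p) = ℚP.+-monoʳ-≤ 1ℚ (fromℕ-mono p)

  n<1+n : ∀ n → fromℕ n < fromℕ (suc n)
  n<1+n n = subst (_< 1ℚ + fromℕ n) (ℚP.+-identityˡ (fromℕ n)) (ℚP.+-monoˡ-< (fromℕ n) 0<1)

  fromℕ-+ : ∀ m n → fromℕ (m ℕ.+ n) ≡ fromℕ m + fromℕ n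
  fromℕ-+ zero    n = sym (ℚP.+-identityˡ (fromℕ n))
  fromℕ-+ (suc m) n = trans (cong (1ℚ +_) (fromℕ-+ m n)) (sym (ℚP.+-assoc 1ℚ (fromℕ m) (fromℕ n)))

  q≤num : ∀ q → 0ℚ ≤ q → q ≤ fromℕ ℤ.∣ ℚ.↥ q ∣
  q≤num q@(ℚ.mkℚ (ℤ.+ n) d c) _ = subst (q ≤_) (sym (asFraction n))
    (ℚ.*≤* (subst₂ ℤ._≤_ (ℤP.pos-* n 1) (ℤP.pos-* n (suc d))
              (ℤ.+≤+ (ℕP.*-monoʳ-≤ n (ℕ.s≤s ℕ.z≤n)))))
  q≤num q@(ℚ.mkℚ (ℤ.-[1+ n ]) d c) 0≤q = contradiction (ℚ.nonNegative 0≤q) λ ()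

  -- 1 / (n + 1)
  unit : ℕ → ℚ
  unit n = recip (fromℕ (suc n)) (0<fromℕ n)

  0<unit : ∀ n → 0ℚ < unit n
  0<unit n = 0<recip (0<fromℕ n)

  unit-anti : ∀ {m n} → m ℕ.≤ n → unit n ≤ unit m
  unit-anti {m} {n} p = recip-anti (0<fromℕ m) (0<fromℕ n) (fromℕ-mono (ℕ.s≤s p))

  recip-recip : ∀ {q} (0<q : 0ℚ < q) → recip (recip q 0<q) (0<recip 0<q) ≡ q
  recip-recip {q} 0<q = trans (sym (*-recip-* 0<q r′)) (trans (cong (q *_)
      (trans (ℚP.*-comm r′ r) (*-recip (0<recip 0<q)))) (ℚP.*-identityʳ q))
    where r = recip q 0<q
          r′ = recip r (0<recip 0<q)

  unit-small : ∀ e → 0ℚ < e → Σ[ N ∈ ℕ ] (∀ n → N ℕ.≤ n → unit n ≤ e)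
  unit-small e 0<e = N , λ n N≤n → ℚP.≤-trans (unit-anti N≤n)
    (subst (unit N ≤_) (recip-recip 0<e)
      (recip-anti (0<recip 0<e) (0<fromℕ N)
        (ℚP.≤-trans (q≤num r (<⇒≤ (0<recip 0<e))) (fromℕ-mono (ℕP.n≤1+n N)))))
    where r = recip e 0<e
          N = ℤ.∣ ℚ.↥ r ∣

  0≤^ : ∀ {a} k → 0ℚ ≤ a → 0ℚ ≤ a ^ k
  0≤^ zero    _ = 0≤1
  0≤^ (suc k) p = 0≤* p (0≤^ k p)

  0<^ : ∀ {a} k → 0ℚ < a → 0ℚ < a ^ k
  0<^ zero    _ = 0<1
  0<^ (suc k) p = 0<* p (0<^ k p)

  ^-mono : ∀ {a b} k → 0ℚ ≤ a → a ≤ b → a ^ k ≤ b ^ k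
  ^-mono zero    _ _ = ℚP.≤-refl
  ^-mono (suc k) p q = *-mono p q (0≤^ k p) (^-mono k p q)

  ^-mono-< : ∀ {a b} k → 0ℚ ≤ a → a < b → a ^ suc k < b ^ suc k
  ^-mono-< {a} {b} k 0≤a a<b = ℚP.≤-<-trans (*-monoˡ 0≤a (^-mono k 0≤a (<⇒≤ a<b)))
    (ℚP.*-monoˡ-<-pos (b ^ k) {{ℚ.positive (0<^ k (ℚP.≤-<-trans 0≤a a<b))}} a<b)

  ^-cancel : ∀ {a b} k → 0ℚ ≤ b → a ^ suc k ≤ b ^ suc k → a ≤ b
  ^-cancel {a} {b} k 0≤b h with a ℚP.≤? b
  ... | yes a≤b = a≤b
  ... | no  a≰b = contradiction (ℚP.<-≤-trans (^-mono-< k 0≤b (ℚP.≰⇒> a≰b)) h) (ℚP.<-irrefl refl)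

  ^-super : ∀ {a b} k → 0ℚ ≤ a → 0ℚ ≤ b → a ^ suc k + b ^ suc k ≤ (a + b) ^ suc k
  ^-super {a} {b} zero _ _ = ℚP.≤-reflexive (sym (ℚP.*-distribʳ-+ 1ℚ a b))
  ^-super {a} {b} (suc k) 0≤a 0≤b = ℚP.≤-trans
    (≤-by (a * b ^ suc k + b * a ^ suc k)
      (0≤+ (0≤* 0≤a (0≤^ (suc k) 0≤b)) (0≤* 0≤b (0≤^ (suc k) 0≤a)))
      (expand a b (a ^ suc k) (b ^ suc k)))
    (*-monoˡ (0≤+ 0≤a 0≤b) (^-super k 0≤a 0≤b))
    where
    expand : ∀ a b x y → (a + b) * (x + y) ≡ (a * x + b * y) + (a * y + b * x)
    expand = solve-∀ ℚ-ring

  ^≤1 : ∀ {a} k → 0ℚ ≤ a → a ≤ 1ℚ → a ^ k ≤ 1ℚ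
  ^≤1 zero    _ _ = ℚP.≤-refl
  ^≤1 (suc k) p q = *-mono p q (0≤^ k p) (^≤1 k p q)

  ^≤ : ∀ {a} k → 0ℚ ≤ a → a ≤ 1ℚ → a ^ suc k ≤ a
  ^≤ {a} k p q = subst (a ^ suc k ≤_) (ℚP.*-identityʳ a) (*-monoˡ p (^≤1 k p q))

  1≤^ : ∀ {a} k → 1ℚ ≤ a → 1ℚ ≤ a ^ k
  1≤^ zero    _ = ℚP.≤-refl
  1≤^ (suc k) p = *-mono 0≤1 p 0≤1 (1≤^ k p)

  ≤^ : ∀ {a} k → 1ℚ ≤ a → a ≤ a ^ suc k
  ≤^ {a} k p = subst (_≤ a ^ suc k) (ℚP.*-identityʳ a)
    (*-monoˡ (ℚP.≤-trans 0≤1 p) (1≤^ k p))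

  -- ∑ n f = f 0 + ⋯ + f (n - 1)
  ∑ : ℕ → (ℕ → ℚ) → ℚ
  ∑ zero    f = 0ℚ
  ∑ (suc n) f = ∑ n f + f n

  ∑-bound : ∀ n {f b} → (∀ i → i ℕ.< n → ∣ f i ∣ ≤ b) → ∣ ∑ n f ∣ ≤ fromℕ n * b
  ∑-bound zero {b = b} _ = ℚP.≤-reflexive (sym (ℚP.*-zeroˡ b))
  ∑-bound (suc n) {f} {b} h = subst (∣ ∑ n f + f n ∣ ≤_)
    (step (fromℕ n) b)
    (∣+∣≤ {∑ n f} {f n} (∑-bound n (λ i i<n → h i (ℕP.m<n⇒m<1+n i<n))) (h n ℕP.≤-refl))
    where
    step : ∀ m b → m * b + b ≡ (1ℚ + m) * b
    step = solve-∀ ℚ-ring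

  ∑-diff : ∀ n f g → ∑ n f - ∑ n g ≡ ∑ n (λ i → f i - g i)
  ∑-diff zero    f g = refl
  ∑-diff (suc n) f g = trans (step (∑ n f) (f n) (∑ n g) (g n))
    (cong (_+ (f n - g n)) (∑-diff n f g))
    where
    step : ∀ a b c d → (a + b) - (c + d) ≡ (a - c) + (b - d)
    step = solve-∀ ℚ-ring

  ∑-cong : ∀ n {f g : ℕ → ℚ} → (∀ i → f i ≡ g i) → ∑ n f ≡ ∑ n g
  ∑-cong zero    _ = refl
  ∑-cong (suc n) h = cong₂ _+_ (∑-cong n h) (h n)

  double : ∀ n → 2 ℕ.* suc n ≡ suc (suc (2 ℕ.* n))
  double n = cong suc (ℕP.+-suc n (n ℕ.+ 0))

  ∑-double : ∀ n f → ∑ (2 ℕ.* n) f ≡ ∑ n (λ j → f (2 ℕ.* j) + f (suc (2 ℕ.* j)))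
  ∑-double zero    f = refl
  ∑-double (suc n) f rewrite ℕP.+-suc n (n ℕ.+ 0) =
    trans (ℚP.+-assoc (∑ (2 ℕ.* n) f) (f (2 ℕ.* n)) (f (suc (2 ℕ.* n))))
          (cong (_+ (f (2 ℕ.* n) + f (suc (2 ℕ.* n)))) (∑-double n f))

  zetaSum : ℕ → ℕ → ℚ
  zetaSum k n = ∑ n (λ j → unit j ^ k)

  unit-step : ∀ n → unit n - unit (suc n) ≡ unit n * unit (suc n)
  unit-step n = trans (recip-diff (0<fromℕ n) (0<fromℕ (suc n)))
    (step (fromℕ (suc n)) (unit n * unit (suc n)))
    where
    step : ∀ m u → ((1ℚ + m) - m) * u ≡ u
    step = solve-∀ ℚ-ring

  unit≤1 : ∀ n → unit n ≤ 1ℚ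
  unit≤1 n = unit-anti {0} {n} ℕ.z≤n

  term≤ : ∀ k n → unit n ^ suc (suc k) ≤ unit n * unit n
  term≤ k n = *-monoˡ (<⇒≤ (0<unit n)) (^≤ k (<⇒≤ (0<unit n)) (unit≤1 n))

  -- n ↦ zetaSum n + 1/n is decreasing from n = 1 on
  zeta-desc : ∀ k n → zetaSum (2 ℕ.+ k) (suc (suc n)) + unit (suc n)
                     ≤ zetaSum (2 ℕ.+ k) (suc n) + unit n
  zeta-desc k n = ≤-by (unit n - unit (suc n) - t)
    (subst (_≤ unit n - unit (suc n) - t) (ℚP.+-inverseʳ t) (ℚP.+-monoˡ-≤ (- t)
      (subst (t ≤_) (sym (unit-step n)) (ℚP.≤-trans (term≤ k (suc n))
        (ℚP.*-monoʳ-≤-nonNeg (unit (suc n)) {{ℚ.nonNegative (<⇒≤ (0<unit (suc n)))}}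
          (unit-anti (ℕP.n≤1+n n)))))))
    (step (zetaSum (2 ℕ.+ k) (suc n)) t (unit n) (unit (suc n)))
    where
    t = unit (suc n) ^ (2 ℕ.+ k)
    step : ∀ s t u v → s + u ≡ ((s + t) + v) + (u - v - t)
    step = solve-∀ ℚ-ring

  zeta-desc* : ∀ k m j → zetaSum (2 ℕ.+ k) (suc (j ℕ.+ m)) + unit (j ℕ.+ m)
                       ≤ zetaSum (2 ℕ.+ k) (suc m) + unit m
  zeta-desc* k m zero    = ℚP.≤-refl
  zeta-desc* k m (suc j) = ℚP.≤-trans (zeta-desc k (j ℕ.+ m)) (zeta-desc* k m j)

  zeta-mono : ∀ k m j → zetaSum k m ≤ zetaSum k (j ℕ.+ m)
  zeta-mono k m zero    = ℚP.≤-refl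
  zeta-mono k m (suc j) = ℚP.≤-trans (zeta-mono k m j)
    (≤-by (unit (j ℕ.+ m) ^ k) (0≤^ k (<⇒≤ (0<unit (j ℕ.+ m)))) refl)

  zeta-tail : ∀ k m j → zetaSum (2 ℕ.+ k) (j ℕ.+ suc m) ≤ zetaSum (2 ℕ.+ k) (suc m) + unit m
  zeta-tail k m j = subst (λ i → zetaSum (2 ℕ.+ k) i ≤ zetaSum (2 ℕ.+ k) (suc m) + unit m)
    (sym (ℕP.+-suc j m))
    (ℚP.≤-trans (≤-by (unit (j ℕ.+ m)) (<⇒≤ (0<unit (j ℕ.+ m))) refl) (zeta-desc* k m j))

  zeta≥1 : ∀ k n → 1ℚ ≤ zetaSum k (suc n)
  zeta≥1 k n = ℚP.≤-trans (≤-by {1ℚ} {zetaSum k 1} 0ℚ ℚP.≤-refl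
      (trans (cong (0ℚ +_) (unit0^ k)) refl))
    (subst (zetaSum k 1 ≤_) (cong (zetaSum k) (ℕP.+-comm n 1)) (zeta-mono k 1 n))
    where
    unit0^ : ∀ k → unit 0 ^ k ≡ 1ℚ
    unit0^ zero    = refl
    unit0^ (suc k) = cong (unit 0 *_) (unit0^ k)

  -- the greatest a ≤ b satisfying P (0 if there is none)

  greatest : {P : ℕ → Set} → (∀ a → Dec (P a)) → ℕ → ℕ
  greatest P? zero    = 0
  greatest P? (suc b) with P? (suc b)
  ... | yes _ = suc b
  ... | no  _ = greatest P? b

  greatest-spec : ∀ {P : ℕ → Set} (P? : ∀ a → Dec (P a)) b → P 0 → ¬ P (suc b) →
                  P (greatest P? b) × ¬ P (suc (greatest P? b))
  greatest-spec P? zero    p0 ¬p = p0 , ¬p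
  greatest-spec P? (suc b) p0 ¬p with P? (suc b)
  ... | yes p  = p , ¬p
  ... | no  ¬q = greatest-spec P? b p0 ¬q

  -- gridRoot k n q is the greatest multiple of 1/(n+1) whose k-th power is at most q (q ≥ 0).

  grid : ℕ → ℕ → ℚ
  grid n a = fromℕ a * unit n

  grid-suc : ∀ n a → grid n (suc a) ≡ grid n a + unit n
  grid-suc n a = step (fromℕ a) (unit n)
    where
    step : ∀ m u → (1ℚ + m) * u ≡ m * u + u
    step = solve-∀ ℚ-ring

  gridBound : ℕ → ℚ → ℕ
  gridBound n q = suc n ℕ.* suc ℤ.∣ ℚ.↥ q ∣

  0≤grid : ∀ n a → 0ℚ ≤ grid n a
  0≤grid n a = 0≤* (0≤fromℕ a) (<⇒≤ (0<unit n))

  fromℕ-* : ∀ m n → fromℕ (m ℕ.* n) ≡ fromℕ m * fromℕ n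
  fromℕ-* zero    n = sym (ℚP.*-zeroˡ (fromℕ n))
  fromℕ-* (suc m) n = trans (fromℕ-+ n (m ℕ.* n)) (trans (cong (fromℕ n +_) (fromℕ-* m n))
    (step (fromℕ m) (fromℕ n)))
    where
    step : ∀ a b → b + a * b ≡ (1ℚ + a) * b
    step = solve-∀ ℚ-ring

  num< : ∀ q → 0ℚ ≤ q → q < fromℕ (suc ℤ.∣ ℚ.↥ q ∣)
  num< q 0≤q = ℚP.≤-<-trans (q≤num q 0≤q) (n<1+n ℤ.∣ ℚ.↥ q ∣)

  grid-bound : ∀ n q → grid n (gridBound n q) ≡ fromℕ (suc ℤ.∣ ℚ.↥ q ∣)
  grid-bound n q = trans (cong (_* unit n) (fromℕ-* (suc n) (suc ℤ.∣ ℚ.↥ q ∣)))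
    (trans (step (fromℕ (suc n)) (fromℕ (suc ℤ.∣ ℚ.↥ q ∣)) (unit n))
      (trans (cong (fromℕ (suc ℤ.∣ ℚ.↥ q ∣) *_) (*-recip (0<fromℕ n)))
             (ℚP.*-identityʳ (fromℕ (suc ℤ.∣ ℚ.↥ q ∣)))))
    where
    step : ∀ a b u → (a * b) * u ≡ b * (a * u)
    step = solve-∀ ℚ-ring

  0^suc : ∀ k → 0ℚ ^ suc k ≡ 0ℚ
  0^suc k = ℚP.*-zeroˡ (0ℚ ^ k)

  gridRoot : ℕ → ℕ → ℚ → ℚ
  gridRoot k n q = grid n (greatest (λ a → grid n a ^ k ℚP.≤? q) (gridBound n q))

  0≤gridRoot : ∀ k n q → 0ℚ ≤ gridRoot k n q
  0≤gridRoot k n q = 0≤grid n (greatest (λ a → grid n a ^ k ℚP.≤? q) (gridBound n q))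

  gridRoot-spec : ∀ k n q → 0ℚ ≤ q →
    gridRoot (suc k) n q ^ suc k ≤ q × q < (gridRoot (suc k) n q + unit n) ^ suc k
  gridRoot-spec k n q 0≤q =
    proj₁ spec ,
    subst (λ z → q < z ^ suc k) (grid-suc n a) (ℚP.≰⇒> (proj₂ spec))
    where
    N : ℕ
    N = suc ℤ.∣ ℚ.↥ q ∣
    P : ℕ → Set
    P b = grid n b ^ suc k ≤ q
    P? : ∀ b → Dec (P b)
    P? b = grid n b ^ suc k ℚP.≤? q
    a : ℕ
    a = greatest P? (gridBound n q)
    big : q < grid n (suc (gridBound n q)) ^ suc k
    big = ℚP.<-≤-trans (num< q 0≤q) (ℚP.≤-trans
      (≤^ {fromℕ N} k (fromℕ-mono {1} {N} (ℕ.s≤s ℕ.z≤n)))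
      (^-mono {fromℕ N} (suc k) (0≤fromℕ N) (ℚP.≤-trans (ℚP.≤-reflexive (sym (grid-bound n q)))
        (≤-by (unit n) (<⇒≤ (0<unit n)) (grid-suc n (gridBound n q))))))
    spec : grid n a ^ suc k ≤ q × ¬ (grid n (suc a) ^ suc k ≤ q)
    spec = greatest-spec {P} P? (gridBound n q)
      (subst (_≤ q) (sym (trans (cong (_^ suc k) (ℚP.*-zeroˡ (unit n))) (0^suc k))) 0≤q)
      (λ h → ℚP.<-irrefl refl (ℚP.<-≤-trans big h))

  0<½^ : ∀ n → 0ℚ < ½ ^ n
  0<½^ n = 0<^ n 0<½

  2^½^ : ∀ n → fromℕ (2 ℕ.^ n) * ½ ^ n ≡ 1ℚ
  2^½^ zero    = refl
  2^½^ (suc n) = trans (cong (_* ½ ^ suc n) (fromℕ-* 2 (2 ℕ.^ n)))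
    (trans (step (fromℕ (2 ℕ.^ n)) (½ ^ n)) (2^½^ n))
    where
    step : ∀ a b → (fromℕ 2 * a) * (½ * b) ≡ a * b
    step a b = trans (assoc4 (fromℕ 2) a ½ b) (ℚP.*-identityˡ (a * b))
      where
      assoc4 : ∀ c a d b → (c * a) * (d * b) ≡ (c * d) * (a * b)
      assoc4 = solve-∀ ℚ-ring

  n<2^n : ∀ n → suc n ℕ.≤ 2 ℕ.^ n
  n<2^n zero    = ℕP.≤-refl
  n<2^n (suc n) = ℕP.+-mono-≤ (ℕP.≤-trans (ℕ.s≤s ℕ.z≤n) (n<2^n n))
    (subst (suc n ℕ.≤_) (sym (ℕP.+-identityʳ (2 ℕ.^ n))) (n<2^n n))

  ½^≤unit : ∀ n → ½ ^ n ≤ unit n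
  ½^≤unit n = subst₂ _≤_ lhs (ℚP.*-identityˡ (unit n))
    (ℚP.*-monoʳ-≤-nonNeg (unit n) {{ℚ.nonNegative (<⇒≤ (0<unit n))}} h)
    where
    h : fromℕ (suc n) * ½ ^ n ≤ 1ℚ
    h = subst (fromℕ (suc n) * ½ ^ n ≤_) (2^½^ n)
      (ℚP.*-monoʳ-≤-nonNeg (½ ^ n) {{ℚ.nonNegative (<⇒≤ (0<½^ n))}} (fromℕ-mono (n<2^n n)))
    step : ∀ a b u → (a * b) * u ≡ b * (a * u)
    step = solve-∀ ℚ-ring
    lhs : (fromℕ (suc n) * ½ ^ n) * unit n ≡ ½ ^ n
    lhs = trans (step (fromℕ (suc n)) (½ ^ n) (unit n))
      (trans (cong (½ ^ n *_) (*-recip (0<fromℕ n))) (ℚP.*-identityʳ (½ ^ n)))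

  ∑-diff-bound : ∀ n {f g b} → (∀ i → i ℕ.< n → ∣ f i - g i ∣ ≤ b) → ∣ ∑ n f - ∑ n g ∣ ≤ fromℕ n * b
  ∑-diff-bound n {f} {g} {b} h =
    subst (λ z → ∣ z ∣ ≤ fromℕ n * b) (sym (∑-diff n f g)) (∑-bound n h)

  -- The Riemann sum of f over [a , a + h] with 2 ^ n equal pieces and right end points
  riemann : (ℚ → ℚ) → ℚ → ℕ → ℚ → ℚ
  riemann f a n h = h * ½ ^ n * ∑ (2 ℕ.^ n) (λ i → f (a + fromℕ (suc i) * (h * ½ ^ n)))

  module RiemannBounds (f : ℚ → ℚ) (F K : ℚ) (0≤K : 0ℚ ≤ K)
    (bounded : ∀ t → ∣ f t ∣ ≤ F)
    (lipschitz : ∀ s t → ∣ f s - f t ∣ ≤ K * ∣ s - t ∣) where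

    ∣½^∣ : ∀ n → ∣ ½ ^ n ∣ ≡ ½ ^ n
    ∣½^∣ n = ℚP.0≤p⇒∣p∣≡p (<⇒≤ (0<½^ n))

    node-diff : ∀ a n h h′ i → i ℕ.< 2 ℕ.^ n →
      ∣ f (a + fromℕ (suc i) * (h * ½ ^ n)) - f (a + fromℕ (suc i) * (h′ * ½ ^ n)) ∣ ≤ K * ∣ h - h′ ∣
    node-diff a n h h′ i i< = ℚP.≤-trans (lipschitz _ _) (*-monoˡ 0≤K (subst (_≤ ∣ h - h′ ∣)
      (sym (trans (cong ∣_∣ (step a (fromℕ (suc i)) h h′ (½ ^ n))) (ℚP.∣p*q∣≡∣p∣*∣q∣ w (h - h′))))
      (subst (∣ w ∣ * ∣ h - h′ ∣ ≤_) (ℚP.*-identityˡ ∣ h - h′ ∣)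
        (ℚP.*-monoʳ-≤-nonNeg ∣ h - h′ ∣ {{ℚP.∣-∣-nonNeg (h - h′)}}
          (subst (_≤ 1ℚ) (sym (ℚP.0≤p⇒∣p∣≡p 0≤w)) w≤1)))))
      where
      w = fromℕ (suc i) * ½ ^ n
      0≤w : 0ℚ ≤ w
      0≤w = 0≤* (0≤fromℕ (suc i)) (<⇒≤ (0<½^ n))
      w≤1 : w ≤ 1ℚ
      w≤1 = subst (w ≤_) (2^½^ n)
        (ℚP.*-monoʳ-≤-nonNeg (½ ^ n) {{ℚ.nonNegative (<⇒≤ (0<½^ n))}} (fromℕ-mono i<))
      step : ∀ a m h h′ u → (a + m * (h * u)) - (a + m * (h′ * u)) ≡ (m * u) * (h - h′)
      step = solve-∀ ℚ-ring

    riemann-lipschitz : ∀ a n h h′ →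
      ∣ riemann f a n h - riemann f a n h′ ∣ ≤ ∣ h - h′ ∣ * (F + ∣ h′ ∣ * K)
    riemann-lipschitz a n h h′ = subst₂ _≤_
      (cong ∣_∣ (sym (step h h′ u S S′)))
      (trans (step2 d F (∣ h′ ∣) K u (fromℕ (2 ℕ.^ n)))
        (trans (cong (_* (d * (F + ∣ h′ ∣ * K))) (2^½^ n)) (ℚP.*-identityˡ (d * (F + ∣ h′ ∣ * K)))))
      (∣+∣≤ {(h - h′) * (u * S)} {h′ * (u * (S - S′))}
        (∣*∣≤ {h - h′} {u * S} ℚP.≤-refl
          (∣*∣≤ {u} {S} (ℚP.≤-reflexive (∣½^∣ n)) (∑-bound (2 ℕ.^ n) (λ i _ → bounded _))))
        (∣*∣≤ {h′} {u * (S - S′)} ℚP.≤-refl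
          (∣*∣≤ {u} {S - S′} (ℚP.≤-reflexive (∣½^∣ n))
            (∑-diff-bound (2 ℕ.^ n) (node-diff a n h h′)))))
      where
      u = ½ ^ n
      d = ∣ h - h′ ∣
      S = ∑ (2 ℕ.^ n) (λ i → f (a + fromℕ (suc i) * (h * ½ ^ n)))
      S′ = ∑ (2 ℕ.^ n) (λ i → f (a + fromℕ (suc i) * (h′ * ½ ^ n)))
      step : ∀ h h′ u s s′ → h * u * s - h′ * u * s′ ≡ (h - h′) * (u * s) + h′ * (u * (s - s′))
      step = solve-∀ ℚ-ring
      step2 : ∀ d F h K u N → d * (u * (N * F)) + h * (u * (N * (K * d))) ≡ (N * u) * (d * (F + h * K))
      step2 = solve-∀ ℚ-ring

    riemann-refine : ∀ a n h → ∣ riemann f a (suc n) h - riemann f a n h ∣ ≤ K * (∣ h ∣ * ∣ h ∣) * ½ ^ suc (suc n)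
    riemann-refine a n h = subst₂ _≤_
      (cong ∣_∣ (sym eq))
      (trans (step2 (∣ h ∣) K (fromℕ (2 ℕ.^ n)) (½ ^ n))
        (trans (cong (_* (K * (∣ h ∣ * ∣ h ∣) * ½ ^ suc (suc n))) (2^½^ n)) (ℚP.*-identityˡ (K * (∣ h ∣ * ∣ h ∣) * ½ ^ suc (suc n)))))
      (∣*∣≤ {h * v} {T - T′} (∣*∣≤ {h} {v} ℚP.≤-refl (ℚP.≤-reflexive (∣½^∣ (suc n))))
        (∑-diff-bound (2 ℕ.^ n) (λ j _ → near j)))
      where
      N = 2 ℕ.^ n
      v = ½ ^ suc n
      fine = λ i → f (a + fromℕ (suc i) * (h * v))
      coarse = λ j → f (a + fromℕ (suc j) * (h * ½ ^ n))
      T = ∑ N (λ j → fine (2 ℕ.* j) + fine (suc (2 ℕ.* j)))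
      T′ = ∑ N (λ j → coarse j + coarse j)
      aligned : ∀ j → fine (suc (2 ℕ.* j)) ≡ coarse j
      aligned j = cong (λ z → f (a + z)) (trans
        (cong (_* (h * v)) (trans (cong fromℕ (sym (double j))) (fromℕ-* 2 (suc j))))
        (step3 (fromℕ (suc j)) h (½ ^ n)))
        where
        step3 : ∀ m h u → (fromℕ 2 * m) * (h * (½ * u)) ≡ m * (h * u)
        step3 m h u = trans (shuffle (fromℕ 2) ½ m h u) (ℚP.*-identityˡ (m * (h * u)))
          where
          shuffle : ∀ c d m h u → (c * m) * (h * (d * u)) ≡ (c * d) * (m * (h * u))
          shuffle = solve-∀ ℚ-ring
      near : ∀ j → ∣ (fine (2 ℕ.* j) + fine (suc (2 ℕ.* j))) - (coarse j + coarse j) ∣ ≤ K * (∣ h ∣ * v)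
      near j = subst (_≤ K * (∣ h ∣ * v)) (cong ∣_∣ (trans
          (step4 (fine (2 ℕ.* j)) (fine (suc (2 ℕ.* j))))
          (cong (λ z → (fine (2 ℕ.* j) + fine (suc (2 ℕ.* j))) - (z + z)) (aligned j))))
        (ℚP.≤-trans (lipschitz _ _) (*-monoˡ 0≤K (ℚP.≤-reflexive (trans
          (cong ∣_∣ (step5 a m (h * v)))
          (trans (ℚP.∣-p∣≡∣p∣ (h * v)) (trans (ℚP.∣p*q∣≡∣p∣*∣q∣ h v) (cong (∣ h ∣ *_) (∣½^∣ (suc n)))))))))
        where
        m = fromℕ (suc (2 ℕ.* j))
        step4 : ∀ x y → x - y ≡ (x + y) - (y + y)
        step4 = solve-∀ ℚ-ring
        step5 : ∀ a m w → (a + m * w) - (a + (1ℚ + m) * w) ≡ - w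
        step5 = solve-∀ ℚ-ring
      ∑-twice : ∀ N g → ∑ N (λ j → g j + g j) ≡ ∑ N g + ∑ N g
      ∑-twice zero    g = refl
      ∑-twice (suc N) g = trans (cong (_+ (g N + g N)) (∑-twice N g)) (step6 (∑ N g) (g N))
        where
        step6 : ∀ s x → (s + s) + (x + x) ≡ (s + x) + (s + x)
        step6 = solve-∀ ℚ-ring
      eq : riemann f a (suc n) h - riemann f a n h ≡ (h * v) * (T - T′)
      eq = trans (cong₂ (λ x y → h * v * x - y) (∑-double N fine)
             (trans (step7 h (½ ^ n) (∑ N coarse)) (cong (h * v *_) (sym (∑-twice N coarse)))))
             (step8 (h * v) T T′)
        where
        step7 : ∀ h u s → h * u * s ≡ h * (½ * u) * (s + s)
        step7 = solve-∀ ℚ-ring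
        step8 : ∀ w t t′ → w * t - w * t′ ≡ w * (t - t′)
        step8 = solve-∀ ℚ-ring
      step2 : ∀ h K N u → (h * (½ * u)) * (N * (K * (h * (½ * u)))) ≡ (N * u) * (K * (h * h) * (½ * (½ * u)))
      step2 = solve-∀ ℚ-ring

    telescope : ∀ a n h j → ∣ riemann f a (j ℕ.+ n) h - riemann f a n h ∣
                            ≤ K * (∣ h ∣ * ∣ h ∣) * (½ ^ suc n - ½ ^ suc (j ℕ.+ n))
    telescope a n h zero = ℚP.≤-reflexive (trans (cong ∣_∣ (ℚP.+-inverseʳ (riemann f a n h)))
      (sym (trans (cong (K * (∣ h ∣ * ∣ h ∣) *_) (ℚP.+-inverseʳ (½ ^ suc n))) (ℚP.*-zeroʳ (K * (∣ h ∣ * ∣ h ∣))))))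
    telescope a n h (suc j) = subst₂ _≤_
      (cong ∣_∣ (step (R (suc (j ℕ.+ n))) (R (j ℕ.+ n)) (R n)))
      (step2 (K * (∣ h ∣ * ∣ h ∣)) (½ ^ (j ℕ.+ n)) (½ ^ suc n))
      (∣+∣≤ {R (suc (j ℕ.+ n)) - R (j ℕ.+ n)} {R (j ℕ.+ n) - R n}
        (riemann-refine a (j ℕ.+ n) h) (telescope a n h j))
      where
      R = λ m → riemann f a m h
      step : ∀ x y z → (x - y) + (y - z) ≡ x - z
      step = solve-∀ ℚ-ring
      step2 : ∀ c u w → c * (½ * (½ * u)) + c * (w - ½ * u) ≡ c * (w - ½ * (½ * u))
      step2 = solve-∀ ℚ-ring

    riemann-close : ∀ a n h j →
      ∣ riemann f a (j ℕ.+ n) h - riemann f a n h ∣ ≤ K * (∣ h ∣ * ∣ h ∣) * ½ ^ n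
    riemann-close a n h j = ℚP.≤-trans (telescope a n h j)
      (*-monoˡ (0≤* 0≤K (0≤* (ℚP.0≤∣p∣ h) (ℚP.0≤∣p∣ h)))
        (≤-by (½ ^ suc n + ½ ^ suc (j ℕ.+ n))
          (0≤+ (<⇒≤ (0<½^ (suc n))) (<⇒≤ (0<½^ (suc (j ℕ.+ n)))))
          (step (½ ^ n) (½ ^ suc (j ℕ.+ n)))))
      where
      step : ∀ u w → u ≡ (½ * u - w) + (½ * u + w)
      step = solve-∀ ℚ-ring

open Rational using (ℚ-ring; fromℕ; recip; ∑; riemann; gridRoot; zetaSum)
module R = Rational

record ℝ : Set where
  constructor mkℝ
  field
    seq    : ℕ → ℚ
    cauchy : ∀ ε → 0ℚ ℚ.< ε →
             Σ[ N ∈ ℕ ] (∀ m n → N ℕ.≤ m → N ℕ.≤ n → ℚ.∣ seq m ℚ.- seq n ∣ ℚ.≤ ε)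

open ℝ using (seq; cauchy)

Eventually : (ℕ → Set) → Set
Eventually P = Σ[ N ∈ ℕ ] (∀ n → N ℕ.≤ n → P n)

infix 4 _≈_ _≤_ _<_

_≈_ _≤_ _<_ : ℝ → ℝ → Set
x ≈ y = ∀ ε → 0ℚ ℚ.< ε → Eventually (λ n → ℚ.∣ seq x n ℚ.- seq y n ∣ ℚ.≤ ε)
x ≤ y = ∀ ε → 0ℚ ℚ.< ε → Eventually (λ n → seq x n ℚ.≤ seq y n ℚ.+ ε)
x < y = Σ[ ε ∈ ℚ ] (0ℚ ℚ.< ε × Eventually (λ n → seq x n ℚ.+ ε ℚ.≤ seq y n))

both : ∀ {P Q : ℕ → Set} → Eventually P → Eventually Q → Eventually (λ n → P n × Q n)
both (M , p) (N , q) = M ℕ.⊔ N , λ n h →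
  p n (ℕP.≤-trans (ℕP.m≤m⊔n M N) h) , q n (ℕP.≤-trans (ℕP.m≤n⊔m M N) h)

byOrder : (s : ℕ → ℚ) →
  (∀ ε → 0ℚ ℚ.< ε → Σ[ N ∈ ℕ ] (∀ n j → N ℕ.≤ n → ℚ.∣ s (j ℕ.+ n) ℚ.- s n ∣ ℚ.≤ ε)) → ℝ
byOrder s c = mkℝ s λ ε 0<ε → let (N , h) = c ε 0<ε in N , λ m n N≤m N≤n → pick ε N h m n N≤m N≤n
  where
  pick : ∀ ε N → (∀ n j → N ℕ.≤ n → ℚ.∣ s (j ℕ.+ n) ℚ.- s n ∣ ℚ.≤ ε) →
         ∀ m n → N ℕ.≤ m → N ℕ.≤ n → ℚ.∣ s m ℚ.- s n ∣ ℚ.≤ ε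
  pick ε N h m n N≤m N≤n with ℕP.≤-total m n
  ... | inj₂ n≤m = subst (λ i → ℚ.∣ s i ℚ.- s n ∣ ℚ.≤ ε) (ℕP.m∸n+n≡m n≤m) (h n (m ℕ.∸ n) N≤n)
  ... | inj₁ m≤n = subst (ℚ._≤ ε) (R.∣-∣-sym (s n) (s m))
    (subst (λ i → ℚ.∣ s i ℚ.- s m ∣ ℚ.≤ ε) (ℕP.m∸n+n≡m m≤n) (h m (n ℕ.∸ m) N≤m))

NonExpansive₂ : (ℚ → ℚ → ℚ) → Set
NonExpansive₂ f = ∀ p p′ q q′ {a b} → ℚ.∣ p ℚ.- p′ ∣ ℚ.≤ a → ℚ.∣ q ℚ.- q′ ∣ ℚ.≤ b →
                  ℚ.∣ f p q ℚ.- f p′ q′ ∣ ℚ.≤ a ℚ.+ b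

half : ∀ {ε} → 0ℚ ℚ.< ε → 0ℚ ℚ.< ½ ℚ.* ε
half = R.0<* R.0<½

lift₂ : (f : ℚ → ℚ → ℚ) → NonExpansive₂ f → ℝ → ℝ → ℝ
lift₂ f ne x y = mkℝ (λ n → f (seq x n) (seq y n)) λ ε 0<ε →
  let (M , p) = cauchy x (½ ℚ.* ε) (half 0<ε)
      (N , q) = cauchy y (½ ℚ.* ε) (half 0<ε)
  in M ℕ.⊔ N , λ m n h h′ → subst (ℚ.∣ f (seq x m) (seq y m) ℚ.- f (seq x n) (seq y n) ∣ ℚ.≤_)
    (R.half-split ε)
    (ne (seq x m) (seq x n) (seq y m) (seq y n)
      (p m n (ℕP.≤-trans (ℕP.m≤m⊔n M N) h) (ℕP.≤-trans (ℕP.m≤m⊔n M N) h′))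
      (q m n (ℕP.≤-trans (ℕP.m≤n⊔m M N) h) (ℕP.≤-trans (ℕP.m≤n⊔m M N) h′)))

+-nonExpansive : NonExpansive₂ ℚ._+_
+-nonExpansive p p′ q q′ {a} {b} u v = subst (λ z → ℚ.∣ z ∣ ℚ.≤ a ℚ.+ b) (step p p′ q q′)
  (R.∣+∣≤ {p ℚ.- p′} {q ℚ.- q′} u v)
  where
  step : ∀ p p′ q q′ → (p ℚ.- p′) ℚ.+ (q ℚ.- q′) ≡ (p ℚ.+ q) ℚ.- (p′ ℚ.+ q′)
  step = solve-∀ ℚ-ring

0≤bound : ∀ {p q a} → ℚ.∣ p ℚ.- q ∣ ℚ.≤ a → 0ℚ ℚ.≤ a
0≤bound {p} {q} = ℚP.≤-trans (ℚP.0≤∣p∣ (p ℚ.- q))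

⊔-half : ∀ p p′ q q′ {a b} → 0ℚ ℚ.≤ a → 0ℚ ℚ.≤ b → p ℚ.≤ p′ ℚ.+ a → q ℚ.≤ q′ ℚ.+ b →
         p ℚ.⊔ q ℚ.≤ p′ ℚ.⊔ q′ ℚ.+ (a ℚ.+ b)
⊔-half p p′ q q′ {a} {b} 0≤a 0≤b u v = ℚP.⊔-lub
  (ℚP.≤-trans u (ℚP.+-mono-≤ (ℚP.p≤p⊔q p′ q′) (R.≤-by b 0≤b refl)))
  (ℚP.≤-trans v (ℚP.+-mono-≤ (ℚP.p≤q⊔p p′ q′) (R.≤-by a 0≤a (ℚP.+-comm a b))))

⊔-nonExpansive : NonExpansive₂ ℚ._⊔_
⊔-nonExpansive p p′ q q′ u v = R.∣-∣≤
  (⊔-half p p′ q q′ (0≤bound {p} {p′} u) (0≤bound {q} {q′} v) (R.∣-∣≤⇒ u) (R.∣-∣≤⇒ v))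
  (⊔-half p′ p q′ q (0≤bound {p} {p′} u) (0≤bound {q} {q′} v)
    (R.∣-∣≤⇒ (flip p p′ u)) (R.∣-∣≤⇒ (flip q q′ v)))
  where
  flip : ∀ p q {a} → ℚ.∣ p ℚ.- q ∣ ℚ.≤ a → ℚ.∣ q ℚ.- p ∣ ℚ.≤ a
  flip p q {a} = subst (ℚ._≤ a) (R.∣-∣-sym p q)

⊔-close : ∀ p p′ q {a} → ℚ.∣ p ℚ.- p′ ∣ ℚ.≤ a → ℚ.∣ p ℚ.⊔ q ℚ.- (p′ ℚ.⊔ q) ∣ ℚ.≤ a
⊔-close p p′ q {a} u = subst (ℚ.∣ p ℚ.⊔ q ℚ.- (p′ ℚ.⊔ q) ∣ ℚ.≤_) (ℚP.+-identityʳ a)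
  (⊔-nonExpansive p p′ q q u (ℚP.≤-reflexive (cong ℚ.∣_∣ (ℚP.+-inverseʳ q))))

neg-close : ∀ p q → ℚ.∣ ℚ.- p ℚ.- ℚ.- q ∣ ≡ ℚ.∣ p ℚ.- q ∣
neg-close p q = trans (cong ℚ.∣_∣ (step p q)) (ℚP.∣-p∣≡∣p∣ (p ℚ.- q))
  where
  step : ∀ p q → ℚ.- p ℚ.- ℚ.- q ≡ ℚ.- (p ℚ.- q)
  step = solve-∀ ℚ-ring

0-diff : ∀ q {ε} → 0ℚ ℚ.< ε → ℚ.∣ q ℚ.- q ∣ ℚ.≤ ε
0-diff q {ε} 0<ε = subst (ℚ._≤ ε) (sym (cong ℚ.∣_∣ (ℚP.+-inverseʳ q))) (ℚP.<⇒≤ 0<ε)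

≈-refl : ∀ x → x ≈ x
≈-refl x ε 0<ε = 0 , λ n _ → 0-diff (seq x n) 0<ε

fromℚ : ℚ → ℝ
fromℚ q = mkℝ (λ _ → q) λ ε 0<ε → 0 , λ _ _ _ _ → 0-diff q 0<ε

0ℝ 1ℝ : ℝ
0ℝ = fromℚ 0ℚ
1ℝ = fromℚ 1ℚ

infixl 6 _+_ _-_ _⊔_
infixl 7 _*_ _⊓_
infix  8 -_

_+_ : ℝ → ℝ → ℝ
_+_ = lift₂ ℚ._+_ +-nonExpansive

-_ : ℝ → ℝ
- x = mkℝ (λ n → ℚ.- seq x n) λ ε 0<ε → let (N , h) = cauchy x ε 0<ε in N , λ m n p q →
  subst (ℚ._≤ ε) (sym (neg-close (seq x m) (seq x n))) (h m n p q)

_-_ : ℝ → ℝ → ℝ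
x - y = x + (- y)

_⊔_ : ℝ → ℝ → ℝ
_⊔_ = lift₂ ℚ._⊔_ ⊔-nonExpansive

_⊓_ : ℝ → ℝ → ℝ
x ⊓ y = - ((- x) ⊔ (- y))

∣_∣ : ℝ → ℝ
∣ x ∣ = x ⊔ (- x)

boundOf : ℝ → ℚ
boundOf x = ℚ.∣ seq x (proj₁ (cauchy x 1ℚ R.0<1)) ∣ ℚ.+ 1ℚ

0<boundOf : ∀ x → 0ℚ ℚ.< boundOf x
0<boundOf x = ℚP.+-mono-≤-< (ℚP.0≤∣p∣ (seq x (proj₁ (cauchy x 1ℚ R.0<1)))) R.0<1

eventuallyBounded : ∀ x → Eventually (λ n → ℚ.∣ seq x n ∣ ℚ.≤ boundOf x)
eventuallyBounded x = N , λ n N≤n → subst (λ z → ℚ.∣ z ∣ ℚ.≤ boundOf x) (step (seq x N) (seq x n))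
  (R.∣+∣≤ {seq x N} {seq x n ℚ.- seq x N} ℚP.≤-refl (proj₂ (cauchy x 1ℚ R.0<1) n N N≤n ℕP.≤-refl))
  where
  N = proj₁ (cauchy x 1ℚ R.0<1)
  step : ∀ p q → p ℚ.+ (q ℚ.- p) ≡ q
  step = solve-∀ ℚ-ring

shrink : (B : ℚ) → 0ℚ ℚ.< B → ℚ → ℚ
shrink B 0<B ε = ε ℚ.* recip B 0<B

0<shrink : ∀ {B} (0<B : 0ℚ ℚ.< B) {ε} → 0ℚ ℚ.< ε → 0ℚ ℚ.< shrink B 0<B ε
0<shrink 0<B 0<ε = R.0<* 0<ε (R.0<recip 0<B)

_*_ : ℝ → ℝ → ℝ
x * y = mkℝ (λ n → seq x n ℚ.* seq y n) λ ε 0<ε →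
    let η           = shrink B 0<B ε
        0<η         = 0<shrink 0<B 0<ε
        (N₁ , near) = both (eventuallyBounded x) (eventuallyBounded y)
        (M , p)     = cauchy x η 0<η
        (N , q)     = cauchy y η 0<η
    in N₁ ℕ.⊔ (M ℕ.⊔ N) , λ m n h h′ →
      let M≤ = ℕP.≤-trans (ℕP.m≤m⊔n M N) (ℕP.m≤n⊔m N₁ (M ℕ.⊔ N))
          N≤ = ℕP.≤-trans (ℕP.m≤n⊔m M N) (ℕP.m≤n⊔m N₁ (M ℕ.⊔ N))
          N₁≤ = ℕP.m≤m⊔n N₁ (M ℕ.⊔ N)
      in subst₂ ℚ._≤_ (cong ℚ.∣_∣ (step (seq x m) (seq x n) (seq y m) (seq y n)))
           (trans (step2 A C η) (R.*-recip-* 0<B ε))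
           (R.∣+∣≤ {seq x m ℚ.* (seq y m ℚ.- seq y n)} {(seq x m ℚ.- seq x n) ℚ.* seq y n}
             (R.∣*∣≤ {seq x m} {seq y m ℚ.- seq y n} (proj₁ (near m (ℕP.≤-trans N₁≤ h)))
               (q m n (ℕP.≤-trans N≤ h) (ℕP.≤-trans N≤ h′)))
             (R.∣*∣≤ {seq x m ℚ.- seq x n} {seq y n}
               (p m n (ℕP.≤-trans M≤ h) (ℕP.≤-trans M≤ h′))
               (proj₂ (near n (ℕP.≤-trans N₁≤ h′)))))
  where
  A = boundOf x
  C = boundOf y
  B = A ℚ.+ C
  0<B = R.0<+ (0<boundOf x) (ℚP.<⇒≤ (0<boundOf y))
  step : ∀ a b c d → a ℚ.* (c ℚ.- d) ℚ.+ (a ℚ.- b) ℚ.* d ≡ a ℚ.* c ℚ.- b ℚ.* d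
  step = solve-∀ ℚ-ring
  step2 : ∀ a c e → a ℚ.* e ℚ.+ e ℚ.* c ≡ (a ℚ.+ c) ℚ.* e
  step2 = solve-∀ ℚ-ring

infixr 8 _^_
_^_ : ℝ → ℕ → ℝ
x ^ zero  = 1ℝ
x ^ suc n = x * x ^ n

-- For δ > 0 the function t ↦ 1 / max(t , δ) is bounded and Lipschitz.
module TruncatedReciprocal (δ : ℚ) (0<δ : 0ℚ ℚ.< δ) where

  0<⊔ : ∀ t → 0ℚ ℚ.< t ℚ.⊔ δ
  0<⊔ t = ℚP.<-≤-trans 0<δ (ℚP.p≤q⊔p t δ)

  1/⊔ : ℚ → ℚ
  1/⊔ t = recip (t ℚ.⊔ δ) (0<⊔ t)

  F K : ℚ
  F = recip δ 0<δ
  K = F ℚ.* F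

  0<F : 0ℚ ℚ.< F
  0<F = R.0<recip 0<δ

  0<K : 0ℚ ℚ.< K
  0<K = R.0<* 0<F 0<F

  0≤1/⊔ : ∀ t → 0ℚ ℚ.≤ 1/⊔ t
  0≤1/⊔ t = ℚP.<⇒≤ (R.0<recip (0<⊔ t))

  1/⊔≤ : ∀ t → 1/⊔ t ℚ.≤ F
  1/⊔≤ t = R.recip-anti 0<δ (0<⊔ t) (ℚP.p≤q⊔p t δ)

  1/⊔-bounded : ∀ t → ℚ.∣ 1/⊔ t ∣ ℚ.≤ F
  1/⊔-bounded t = subst (ℚ._≤ F) (sym (ℚP.0≤p⇒∣p∣≡p (0≤1/⊔ t))) (1/⊔≤ t)

  1/⊔-lipschitz : ∀ s t → ℚ.∣ 1/⊔ s ℚ.- 1/⊔ t ∣ ℚ.≤ K ℚ.* ℚ.∣ s ℚ.- t ∣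
  1/⊔-lipschitz s t = subst₂ ℚ._≤_ (cong ℚ.∣_∣ (sym (R.recip-diff (0<⊔ s) (0<⊔ t))))
    (ℚP.*-comm ℚ.∣ s ℚ.- t ∣ K)
    (R.∣*∣≤ {t ℚ.⊔ δ ℚ.- (s ℚ.⊔ δ)} {1/⊔ s ℚ.* 1/⊔ t}
      (subst (ℚ._≤ ℚ.∣ s ℚ.- t ∣) (R.∣-∣-sym (s ℚ.⊔ δ) (t ℚ.⊔ δ)) (⊔-close s t δ ℚP.≤-refl))
      (R.∣*∣≤ {1/⊔ s} {1/⊔ t} (1/⊔-bounded s) (1/⊔-bounded t)))

-- Since δ ≤ seq y n for all large n, truncating at δ changes only finitely many terms.
inv : (y : ℝ) → 0ℝ < y → ℝ
inv y (δ , 0<δ , _) = mkℝ (λ n → 1/⊔ (seq y n)) λ ε 0<ε →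
  let (N , h) = cauchy y (shrink K 0<K ε) (0<shrink 0<K 0<ε)
  in N , λ m n p q → subst (ℚ.∣ 1/⊔ (seq y m) ℚ.- 1/⊔ (seq y n) ∣ ℚ.≤_) (R.*-recip-* 0<K ε)
    (ℚP.≤-trans (1/⊔-lipschitz (seq y m) (seq y n)) (R.*-monoˡ (ℚP.<⇒≤ 0<K) (h m n p q)))
  where open TruncatedReciprocal δ 0<δ

-- x ÷ y [ 0<y ] is the quotient x / y
infixl 7 _÷_[_]
_÷_[_] : (x y : ℝ) → 0ℝ < y → ℝ
x ÷ y [ 0<y ] = x * inv y 0<y

-- The k-th root of max(x , 0): the n-th approximation is the greatest multiple of 1/(n+1) whose
-- k-th power does not exceed max(xₙ , 0).
root : (k : ℕ) .{{_ : NonZero k}} → ℝ → ℝ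
root (suc k) x = mkℝ r λ ε 0<ε →
  let η        = ½ ℚ.* ε
      0<η      = half 0<ε
      (M , h)  = cauchy x (η R.^ suc k) (R.0<^ (suc k) 0<η)
      (N , h′) = R.unit-small η 0<η
      close : ∀ m n → M ℕ.⊔ N ℕ.≤ m → M ℕ.⊔ N ℕ.≤ n → r m ℚ.≤ r n ℚ.+ ε
      close m n p q = below m n 0<η
        (⊔-close (seq x m) (seq x n) 0ℚ
          (h m n (ℕP.≤-trans (ℕP.m≤m⊔n M N) p) (ℕP.≤-trans (ℕP.m≤m⊔n M N) q)))
        (h′ n (ℕP.≤-trans (ℕP.m≤n⊔m M N) q))
        (R.half-split ε)
  in M ℕ.⊔ N , λ m n p q → R.∣-∣≤ (close m n p q) (close n m q p)
  where
  x⁺ : ℕ → ℚ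
  x⁺ n = seq x n ℚ.⊔ 0ℚ

  r : ℕ → ℚ
  r n = gridRoot (suc k) n (x⁺ n)

  0≤r : ∀ n → 0ℚ ℚ.≤ r n
  0≤r n = R.0≤gridRoot (suc k) n (x⁺ n)

  below : ∀ m n {ε η} → 0ℚ ℚ.< η → ℚ.∣ x⁺ m ℚ.- x⁺ n ∣ ℚ.≤ η R.^ suc k → R.unit n ℚ.≤ η →
          η ℚ.+ η ≡ ε → r m ℚ.≤ r n ℚ.+ ε
  below m n {ε} {η} 0<η near u≤η η+η≡ε = R.^-cancel k (R.0≤+ (0≤r n) (subst (0ℚ ℚ.≤_) η+η≡ε
      (R.0≤+ (ℚP.<⇒≤ 0<η) (ℚP.<⇒≤ 0<η)))) (begin
    r m R.^ suc k
      ≤⟨ proj₁ (R.gridRoot-spec k m (x⁺ m) (ℚP.p≤q⊔p (seq x m) 0ℚ)) ⟩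
    x⁺ m
      ≤⟨ R.∣-∣≤⇒ near ⟩
    x⁺ n ℚ.+ η R.^ suc k
      ≤⟨ ℚP.+-monoˡ-≤ (η R.^ suc k)
           (ℚP.<⇒≤ (proj₂ (R.gridRoot-spec k n (x⁺ n) (ℚP.p≤q⊔p (seq x n) 0ℚ)))) ⟩
    (r n ℚ.+ R.unit n) R.^ suc k ℚ.+ η R.^ suc k
      ≤⟨ R.^-super k (R.0≤+ (0≤r n) 0≤u) (ℚP.<⇒≤ 0<η) ⟩
    (r n ℚ.+ R.unit n ℚ.+ η) R.^ suc k
      ≤⟨ R.^-mono (suc k) (R.0≤+ (R.0≤+ (0≤r n) 0≤u) (ℚP.<⇒≤ 0<η))
           (subst (r n ℚ.+ R.unit n ℚ.+ η ℚ.≤_)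
             (trans (ℚP.+-assoc (r n) η η) (cong (r n ℚ.+_) η+η≡ε))
             (ℚP.+-monoˡ-≤ η (ℚP.+-monoʳ-≤ (r n) u≤η))) ⟩
    (r n ℚ.+ ε) R.^ suc k ∎)
    where
    open ℚP.≤-Reasoning
    0≤u = ℚP.<⇒≤ (R.0<unit n)

-- ln x = ∫₁ˣ dt/t: the n-th approximation is the Riemann sum with 2 ^ n equal pieces over the
-- interval from 1 to xₙ (in that order, so it is negative when xₙ < 1). The integrand is written as
-- 1 / max(t , δ), which is 1/t on that interval for all large n.
ln : (x : ℝ) → 0ℝ < x → ℝ
ln x (δ₀ , 0<δ₀ , _) = byOrder s λ ε 0<ε →
  let η        = ½ ℚ.* ε
      0<η      = half 0<ε
      (N₁ , b) = eventuallyBounded y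
      (M , h)  = cauchy y (shrink L 0<L η) (0<shrink 0<L 0<η)
      (N , h′) = R.unit-small (shrink D 0<D η) (0<shrink 0<D 0<η)
  in N₁ ℕ.⊔ (M ℕ.⊔ N) , λ n j p →
    let N₁≤n = ℕP.≤-trans (ℕP.m≤m⊔n N₁ (M ℕ.⊔ N)) p
        M≤n = ℕP.≤-trans (ℕP.≤-trans (ℕP.m≤m⊔n M N) (ℕP.m≤n⊔m N₁ (M ℕ.⊔ N))) p
        N≤n = ℕP.≤-trans (ℕP.≤-trans (ℕP.m≤n⊔m M N) (ℕP.m≤n⊔m N₁ (M ℕ.⊔ N))) p
    in subst₂ ℚ._≤_
      (cong ℚ.∣_∣ (step (s (j ℕ.+ n)) (riemann 1/⊔ 1ℚ (j ℕ.+ n) (seq y n)) (s n)))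
      (trans (cong₂ ℚ._+_ (trans (ℚP.*-comm (shrink L 0<L η) L) (R.*-recip-* 0<L η))
                           (R.*-recip-* 0<D η))
             (R.half-split ε))
      (R.∣+∣≤ {s (j ℕ.+ n) ℚ.- riemann 1/⊔ 1ℚ (j ℕ.+ n) (seq y n)}
              {riemann 1/⊔ 1ℚ (j ℕ.+ n) (seq y n) ℚ.- s n}
        (ℚP.≤-trans (riemann-lipschitz 1ℚ (j ℕ.+ n) (seq y (j ℕ.+ n)) (seq y n))
          (R.*-mono (ℚP.0≤∣p∣ (seq y (j ℕ.+ n) ℚ.- seq y n))
            (h (j ℕ.+ n) n (ℕP.≤-trans M≤n (ℕP.m≤n+m n j)) M≤n)
            (R.0≤+ (ℚP.<⇒≤ 0<F) (R.0≤* (ℚP.0≤∣p∣ (seq y n)) 0≤K))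
            (ℚP.+-monoʳ-≤ F (ℚP.*-monoʳ-≤-nonNeg K {{ℚ.nonNegative 0≤K}} (b n N₁≤n)))))
        (ℚP.≤-trans (riemann-close 1ℚ n (seq y n) j)
          (R.*-mono (R.0≤* 0≤K (R.0≤* (ℚP.0≤∣p∣ (seq y n)) (ℚP.0≤∣p∣ (seq y n))))
            (R.*-monoˡ 0≤K (R.*-mono (ℚP.0≤∣p∣ (seq y n)) (b n N₁≤n) (ℚP.0≤∣p∣ (seq y n)) (b n N₁≤n)))
            (ℚP.<⇒≤ (R.0<½^ n))
            (ℚP.≤-trans (R.½^≤unit n) (h′ n N≤n)))))
  where
  δ = δ₀ ℚ.⊓ 1ℚ
  open TruncatedReciprocal δ (R.0<⊓ 0<δ₀ R.0<1)
  0≤K = ℚP.<⇒≤ 0<K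
  open R.RiemannBounds 1/⊔ F K 0≤K 1/⊔-bounded 1/⊔-lipschitz

  y : ℝ
  y = x - 1ℝ

  s : ℕ → ℚ
  s n = riemann 1/⊔ 1ℚ n (seq y n)

  H L D : ℚ
  H = boundOf y
  L = F ℚ.+ H ℚ.* K
  D = K ℚ.* (H ℚ.* H)
  0<L : 0ℚ ℚ.< L
  0<L = R.0<+ 0<F (R.0≤* (ℚP.<⇒≤ (0<boundOf y)) 0≤K)
  0<D : 0ℚ ℚ.< D
  0<D = R.0<* 0<K (R.0<* (0<boundOf y) (0<boundOf y))
  step : ∀ a b c → (a ℚ.- b) ℚ.+ (b ℚ.- c) ≡ a ℚ.- c
  step = solve-∀ ℚ-ring

-- ζ k = Σ_{j ≥ 1} 1 / j ^ k
ζ : (k : ℕ) .{{_ : NonTrivial k}} → ℝ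
ζ (suc (suc k)) = byOrder (zetaSum (suc (suc k))) λ ε 0<ε →
  let (N , h) = R.unit-small ε 0<ε in suc N , λ where
    (suc n) j (ℕ.s≤s N≤n) → R.∣-∣≤
      (ℚP.≤-trans (R.zeta-tail k n j)
        (ℚP.+-monoʳ-≤ (zetaSum (suc (suc k)) (suc n)) (h n N≤n)))
      (ℚP.≤-trans (R.zeta-mono (suc (suc k)) (suc n) j)
        (R.≤-by ε (ℚP.<⇒≤ 0<ε) refl))

0<ζ : (k : ℕ) .{{_ : NonTrivial k}} → 0ℝ < ζ k
0<ζ (suc (suc k)) = 1ℚ , R.0<1 , 1 , λ where
  (suc n) _ → subst (ℚ._≤ zetaSum (suc (suc k)) (suc n)) (sym (ℚP.+-identityˡ 1ℚ))
    (R.zeta≥1 (suc (suc k)) n)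

1≤⇒0< : ∀ {x} → 1ℝ ≤ x → 0ℝ < x
1≤⇒0< {x} 1≤x = let (N , h) = 1≤x ½ R.0<½ in ½ , R.0<½ , N , λ n N≤n →
  subst₂ ℚ._≤_ refl (step (seq x n)) (ℚP.+-monoˡ-≤ (ℚ.- ½) (h n N≤n))
  where
  step : ∀ q → q ℚ.+ ½ ℚ.- ½ ≡ q
  step = solve-∀ ℚ-ring

drop0 : ∀ {ε q} → 0ℚ ℚ.+ ε ℚ.≤ q → ε ℚ.≤ q
drop0 {ε} {q} = subst (ℚ._≤ q) (ℚP.+-identityˡ ε)

add0 : ∀ {ε q} → ε ℚ.≤ q → 0ℚ ℚ.+ ε ℚ.≤ q
add0 {ε} {q} = subst (ℚ._≤ q) (sym (ℚP.+-identityˡ ε))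

*-pos : ∀ {x y} → 0ℝ < x → 0ℝ < y → 0ℝ < x * y
*-pos (δ , 0<δ , e) (δ′ , 0<δ′ , e′) with both e e′
... | N , h = δ ℚ.* δ′ , R.0<* 0<δ 0<δ′ , N , λ n N≤n → let (p , q) = h n N≤n in
  add0 (R.*-mono (ℚP.<⇒≤ 0<δ) (drop0 p) (ℚP.<⇒≤ 0<δ′) (drop0 q))

⊓-pos : ∀ {x y} → 0ℝ < x → 0ℝ < y → 0ℝ < x ⊓ y
⊓-pos {x} {y} (δ , 0<δ , e) (δ′ , 0<δ′ , e′) with both e e′
... | N , h = δ ℚ.⊓ δ′ , R.0<⊓ 0<δ 0<δ′ , N , λ n N≤n → let (p , q) = h n N≤n in
  add0 (subst (ℚ._≤ ℚ.- (ℚ.- seq x n ℚ.⊔ ℚ.- seq y n)) (neg² (δ ℚ.⊓ δ′))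
    (ℚP.neg-antimono-≤ (ℚP.⊔-lub
      (ℚP.neg-antimono-≤ (ℚP.≤-trans (ℚP.p⊓q≤p δ δ′) (drop0 p)))
      (ℚP.neg-antimono-≤ (ℚP.≤-trans (ℚP.p⊓q≤q δ δ′) (drop0 q))))))
  where
  neg² : ∀ q → ℚ.- ℚ.- q ≡ q
  neg² = solve-∀ ℚ-ring

root-pos : ∀ k .{{_ : NonZero k}} {x} → 0ℝ < x → 0ℝ < root k x
root-pos (suc k) {x} (δ , 0<δ , N , h) = ½ ℚ.* c , half 0<c , N ℕ.⊔ M , λ n p →
  add0 (bound n (h n (ℕP.≤-trans (ℕP.m≤m⊔n N M) p)) (u n (ℕP.≤-trans (ℕP.m≤n⊔m N M) p)))
  where
  c = δ ℚ.⊓ 1ℚ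
  0<c = R.0<⊓ 0<δ R.0<1
  M = proj₁ (R.unit-small (½ ℚ.* c) (half 0<c))
  u = proj₂ (R.unit-small (½ ℚ.* c) (half 0<c))

  bound : ∀ n → 0ℚ ℚ.+ δ ℚ.≤ seq x n → R.unit n ℚ.≤ ½ ℚ.* c → ½ ℚ.* c ℚ.≤ seq (root (suc k) x) n
  bound n δ≤ u≤ = subst₂ ℚ._≤_ (step₁ c) (step₂ r (½ ℚ.* c)) (ℚP.+-monoˡ-≤ (ℚ.- (½ ℚ.* c))
    (ℚP.≤-trans
      (R.^-cancel {c} {r ℚ.+ R.unit n} k (R.0≤+ (R.0≤gridRoot (suc k) n (seq x n ℚ.⊔ 0ℚ)) (ℚP.<⇒≤ (R.0<unit n))) (begin
        c R.^ suc k                  ≤⟨ R.^≤ k (ℚP.<⇒≤ 0<c) (ℚP.p⊓q≤q δ 1ℚ) ⟩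
        c                            ≤⟨ ℚP.p⊓q≤p δ 1ℚ ⟩
        δ                            ≤⟨ drop0 δ≤ ⟩
        seq x n                      ≤⟨ ℚP.p≤p⊔q (seq x n) 0ℚ ⟩
        seq x n ℚ.⊔ 0ℚ               ≤⟨ ℚP.<⇒≤ (proj₂ (R.gridRoot-spec k n (seq x n ℚ.⊔ 0ℚ)
                                                          (ℚP.p≤q⊔p (seq x n) 0ℚ))) ⟩
        (r ℚ.+ R.unit n) R.^ suc k   ∎))
      (ℚP.+-monoʳ-≤ r u≤)))
    where
    open ℚP.≤-Reasoning
    r = seq (root (suc k) x) n
    step₁ : ∀ c → c ℚ.- ½ ℚ.* c ≡ ½ ℚ.* c
    step₁ = solve-∀ ℚ-ring
    step₂ : ∀ r d → r ℚ.+ d ℚ.- d ≡ r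
    step₂ = solve-∀ ℚ-ring

maximum minimum : ∀ {k} .{{_ : NonZero k}} → Vec ℝ k → ℝ
maximum {suc _} = Vec.foldr₁ _⊔_
minimum {suc _} = Vec.foldr₁ _⊓_

product : ∀ {k} → Vec ℝ k → ℝ
product = Vec.foldr′ _*_ 1ℝ

minimum-pos : ∀ {k} .{{_ : NonZero k}} {n : Vec ℝ k} → All (1ℝ ≤_) n → 0ℝ < minimum n
minimum-pos {n = x ∷ []} (p ∷ []) = 1≤⇒0< {x} p
minimum-pos {n = x ∷ n@(_ ∷ _)} (p ∷ ps@(_ ∷ _)) =
  ⊓-pos {x} {minimum n} (1≤⇒0< {x} p) (minimum-pos ps)

product-pos : ∀ {k} {n : Vec ℝ k} → All (1ℝ ≤_) n → 0ℝ < product n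
product-pos []                   = 1ℚ , R.0<1 , 0 , λ _ _ → ℚP.≤-refl
product-pos {n = x ∷ n} (p ∷ ps) = *-pos {x} {product n} (1≤⇒0< {x} p) (product-pos ps)

record 𝒞 {k : ℕ} .{{_ : NonZero k}} (E : ℝ) (n : Vec ℝ k) : Set where
  field
    ≥1    : All (1ℝ ≤_) n
    ratio : maximum n ÷ minimum n [ minimum-pos ≥1 ] ≤ E

-- sup-norm distance at most ε
Within : ∀ {k} → ℚ → Vec ℝ k → Vec ℝ k → Set
Within ε = Pointwise (λ x y → ∣ x - y ∣ ≤ fromℚ ε)

-- Compactness in Bishop's form, complete and totally bounded, which is classically equivalent to
-- the covering definition (for metric spaces); a subset of ℝᵏ must also respect equality of reals.
record Compact {k : ℕ} (K : Pred (Vec ℝ k) 0ℓ) : Set where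
  field
    respects : ∀ {u v} → Pointwise _≈_ u v → K u → K v
    complete : (s : ℕ → Vec ℝ k) → (∀ i → K (s i)) →
               (∀ ε → 0ℚ ℚ.< ε →
                 Σ[ N ∈ ℕ ] (∀ m n → N ℕ.≤ m → N ℕ.≤ n → Within ε (s m) (s n))) →
               Σ[ l ∈ Vec ℝ k ] (K l × (∀ ε → 0ℚ ℚ.< ε → Eventually (λ n → Within ε (s n) l)))
    totallyBounded : ∀ ε → 0ℚ ℚ.< ε →
               Σ[ net ∈ List (Vec ℝ k) ] (ListAll.All K net × (∀ v → K v → Any (Within ε v) net))

-- F = F₁ + 𝒪(g) on 𝒞 E. The function F is given by its graph, because the value of ∣Q∣ at a real
-- vector is not computable and so ∣Q∣ is not available as an operation on 𝒞 E. Lying outside a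
-- compact set is negative information, which is why positivity of g is stated as ¬ (g ≤ 0).
record _≐_+𝒪_ {k : ℕ} .{{_ : NonZero k}} {E : ℝ} (F : Vec ℝ k → ℝ → Set)
              (F₁ g : (n : Vec ℝ k) → 𝒞 E n → ℝ) : Set₁ where
  field
    C₀         : Pred (Vec ℝ k) 0ℓ
    C₀-compact : Compact C₀
    C₀⊆𝒞       : ∀ n → C₀ n → 𝒞 E n
    g-positive : ∀ n (n∈𝒞 : 𝒞 E n) → ¬ C₀ n → ¬ (g n n∈𝒞 ≤ 0ℝ)
    M          : ℝ
    C          : Pred (Vec ℝ k) 0ℓ
    C-compact  : Compact C
    C⊆𝒞        : ∀ n → C n → 𝒞 E n
    estimate   : ∀ n (n∈𝒞 : 𝒞 E n) → ¬ C n → ∀ y → F n y → ∣ y - F₁ n n∈𝒞 ∣ ≤ M * g n n∈𝒞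

record Q {k : ℕ} (n : Vec ℝ k) (a : Vec ℕ k) : Set where
  field
    positive : All (0 ℕ.<_) a
    coprime  : Vec.foldr′ gcd 0 a ≡ 1
    bounded  : Pointwise (λ aᵢ nᵢ → fromℚ (fromℕ aᵢ) ≤ nᵢ) a n

HasCardinality : {A : Set} → Pred A 0ℓ → ℕ → Set
HasCardinality P N = Σ[ xs ∈ List _ ] (Unique xs × (∀ a → a ∈ xs ⇔ P a) × length xs ≡ N)

-- ∣Q∣ n y: the cardinality of Q(k , n) is the real number y
∣Q∣ : ∀ {k} → Vec ℝ k → ℝ → Set
∣Q∣ n y = Σ[ N ∈ ℕ ] (HasCardinality (Q n) N × y ≈ fromℚ (fromℕ N))

γ : ∀ {k} .{{_ : NonZero k}} → Vec ℝ k → ℝ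
γ {k} n = root k (product n)

γ-pos : ∀ {k} .{{_ : NonZero k}} {n : Vec ℝ k} → All (1ℝ ≤_) n → 0ℝ < γ n
γ-pos {k} {n} n≥1 = root-pos k {product n} (product-pos n≥1)

instance
  nonTrivial⇒nonZero : ∀ {k} .{{_ : NonTrivial k}} → NonZero k
  nonTrivial⇒nonZero {k} = ℕ.nonTrivial⇒nonZero k

f : (k : ℕ) .{{_ : NonTrivial k}} {E : ℝ} (n : Vec ℝ k) → 𝒞 E n → ℝ
f 2                     n n∈𝒞 = γ n * ln (γ n) (γ-pos (𝒞.≥1 n∈𝒞))
f k@(suc (suc (suc _))) n n∈𝒞 = γ n ^ (k ℕ.∸ 1)

-- ∣Q∣ n is defined at every n: that no cardinality exists is refutable, although a cardinality
-- cannot be computed from n.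
∣Q∣-defined : ∀ {k} (n : Vec ℝ k) → ¬ ¬ (Σ[ y ∈ ℝ ] ∣Q∣ n y)
∣Q∣-defined n none = select (candidates n) (candidates-unique n) λ (xs , unique , sound , complete) →
  none (fromℚ (fromℕ (length xs)) , length xs , (xs , unique ,
    (λ a → mk⇔ (λ a∈xs → proj₂ (sound a a∈xs))
               (λ q → complete a (candidates-complete n a (Q.bounded q)) q)) , refl) ,
    ≈-refl (fromℚ (fromℕ (length xs))))
  where
  ceil : ℝ → ℕ
  ceil x = ℤ.∣ ℚ.↥ (boundOf x ℚ.+ 1ℚ) ∣

  fromℕ-cancel : ∀ {a b} → fromℕ a ℚ.≤ fromℕ b → a ℕ.≤ b
  fromℕ-cancel {a} {b} h with a ℕP.≤? b
  ... | yes a≤b = a≤b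
  ... | no  a≰b = contradiction (ℚP.<-≤-trans (R.n<1+n b) (ℚP.≤-trans (R.fromℕ-mono (ℕP.≰⇒> a≰b)) h))
                                (ℚP.<-irrefl refl)

  ≤num : ∀ a q → 0ℚ ℚ.≤ q → fromℕ a ℚ.≤ q → a ℕ.≤ ℤ.∣ ℚ.↥ q ∣
  ≤num a q 0≤q h = fromℕ-cancel {a} {ℤ.∣ ℚ.↥ q ∣} (ℚP.≤-trans h (R.q≤num q 0≤q))

  ≤ceil : ∀ {a} x → fromℚ (fromℕ a) ≤ x → a ℕ.≤ ceil x
  ≤ceil {a} x a≤x =
    let (N , h) = both (a≤x 1ℚ R.0<1) (eventuallyBounded x)
        (p , q) = h N ℕP.≤-refl
    in ≤num a (boundOf x ℚ.+ 1ℚ) (R.0≤+ (ℚP.<⇒≤ (0<boundOf x)) R.0≤1)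
         (ℚP.≤-trans p (ℚP.+-monoˡ-≤ 1ℚ (ℚP.≤-trans (R.p≤∣p∣ (seq x N)) q)))

  candidates : ∀ {k} → Vec ℝ k → List (Vec ℕ k)
  candidates []      = List.[ [] ]
  candidates (x ∷ n) = List.cartesianProductWith _∷_ (List.upTo (suc (ceil x))) (candidates n)

  candidates-unique : ∀ {k} (n : Vec ℝ k) → Unique (candidates n)
  candidates-unique []      = ListAll.[] ∷ []
  candidates-unique (x ∷ n) =
    Unique.cartesianProductWith⁺ _∷_ VecP.∷-injective (Unique.upTo⁺ (suc (ceil x))) (candidates-unique n)

  candidates-complete : ∀ {k} (n : Vec ℝ k) (a : Vec ℕ k) →
    Pointwise (λ aᵢ nᵢ → fromℚ (fromℕ aᵢ) ≤ nᵢ) a n → a ∈ candidates n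
  candidates-complete []      []      []       = here refl
  candidates-complete (x ∷ n) (a ∷ as) (p ∷ ps) =
    ∈-cartesianProductWith⁺ _∷_ (∈-upTo⁺ (ℕ.s≤s (≤ceil {a} x p))) (candidates-complete n as ps)

  Selection : ∀ {A : Set} (P : A → Set) → List A → Set
  Selection {A} P xs = Σ[ ys ∈ List A ] (Unique ys ×
    (∀ a → a ∈ ys → a ∈ xs × P a) × (∀ a → a ∈ xs → P a → a ∈ ys))

  select : ∀ {A : Set} {P : A → Set} (xs : List A) → Unique xs → ¬ ¬ Selection P xs
  select []       _            c = c ([] , [] , (λ _ ()) , (λ _ ()))
  select {A} {P} (x ∷ xs) (x∉xs ∷ unique) c = select {A} {P} xs unique λ (ys , u , s , t) →
    ¬¬-excluded-middle λ where
      (yes p) → c (x ∷ ys ,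
        ListAll.tabulate (λ {y} y∈ys → ListAll.lookup x∉xs (proj₁ (s y y∈ys))) ∷ u ,
        (λ { a (here refl) → here refl , p
           ; a (there a∈) → there (proj₁ (s a a∈)) , proj₂ (s a a∈) }) ,
        (λ { a (here refl) _ → here refl
           ; a (there a∈) q → there (t a a∈ q) }))
      (no ¬p) → c (ys , u ,
        (λ a a∈ → there (proj₁ (s a a∈)) , proj₂ (s a a∈)) ,
        (λ { a (here refl) q → contradiction q ¬p
           ; a (there a∈) q → t a a∈ q }))

{-# OPTIONS --safe #-}

-- Let D be the largest ⌊nᵢ⌋. Möbius inversion gives ∣Q∣ = Σ_{d ≤ D} μ(d) ∏ᵢ ⌊⌊nᵢ⌋ / d⌋, and Dirichlet
-- convolution gives Σ_{d ≤ D} μ(d) d⁻ᵏ ζ_{⌊D / d⌋} = 1, where ζ_q is the q-th partial sum of ζ(k). Hence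
-- ∣Q∣ ζ(k) - ∏ᵢ ⌊nᵢ⌋ is a sum over d ≤ D of terms of order (D / d)ᵏ⁻¹, in total 𝒪(Dᵏ⁻¹ Σ_{d ≤ D} d¹⁻ᵏ), and
-- D = 𝒪(γ) because max n ≤ E min n. For k = 2 the harmonic sum is 𝒪(ln γ) as soon as γ ≥ 2: both grow by at
-- least, respectively at most, a constant with each doubling. This excludes the compact set of all n with
-- nᵢ ≤ 20; for k > 2 nothing has to be excluded. The floors of real numbers exist only up to double negation,
-- which is enough because ≤ on ℝ is stable under double negation.
module Submission where

open import Data.Empty using (⊥; ⊥-elim)
import Data.Integer.Base as ℤ
open import Data.List as List using (List; []; _∷_; length)
open import Data.List.Membership.Propositional using (_∈_; lose)
open import Data.List.Membership.Propositional.Properties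
  using (∈-cartesianProductWith⁺; ∈-cartesianProductWith⁻; ∈-downFrom⁺; ∈-downFrom⁻; ∈-filter⁺; ∈-filter⁻; ∈-upTo⁺)
open import Data.List.Membership.Propositional.Properties.WithK using (unique∧set⇒bag)
open import Data.List.Relation.Binary.BagAndSetEquality using (∼bag⇒↭)
open import Data.List.Relation.Binary.Permutation.Propositional.Properties using (↭-length)
import Data.List.Relation.Unary.All as ListAll
open import Data.List.Relation.Unary.Any using (Any; here)
open import Data.List.Relation.Unary.Unique.Propositional using (Unique; []; _∷_)
import Data.List.Relation.Unary.Unique.Propositional.Properties as Unique
open import Data.Nat as ℕ using (ℕ; zero; suc; NonTrivial)
open import Data.Nat.Divisibility
  using (_∣_; _∣?_; divides; divides-refl; ∣⇒≤; ∣-trans; m∣m*n; n∣m*n; *-monoˡ-∣; *-cancelʳ-∣; _∣0; 0∣⇒≡0)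
import Data.Nat.DivMod as DivMod
open import Data.Nat.GCD using (gcd; gcd[m,n]∣m; gcd[m,n]∣n; gcd-greatest)
import Data.Nat.ListAction as ListAction
open import Data.Nat.Primality
  using (Prime; prime?; prime⇒nonZero; prime⇒nonTrivial; euclidsLemma; prime⇒irreducible)
open import Data.Nat.Primality.Factorisation using (factorise)
import Data.Nat.Properties as ℕP
open import Data.Product using (_×_; _,_; proj₁; proj₂; Σ-syntax)
open import Data.Rational as ℚ using (ℚ; 0ℚ; 1ℚ; ½) hiding (module ℚ)
import Data.Rational.Properties as ℚP
open import Data.Sum using (_⊎_; inj₁; inj₂)
open import Data.Vec as Vec using (Vec; []; _∷_)
import Data.Vec.Properties as VecP
open import Data.Vec.Relation.Binary.Pointwise.Inductive using (Pointwise; []; _∷_)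
open import Data.Vec.Relation.Unary.All as All using (All; []; _∷_)
open import Function.Bundles using (_⇔_; mk⇔; module Equivalence)
open import Level using (0ℓ)
open import Relation.Binary.PropositionalEquality
  using (_≡_; _≢_; refl; sym; trans; cong; cong₂; subst; subst₂; module ≡-Reasoning)
open import Relation.Nullary using (¬_; Dec; yes; no; contradiction)
open import Relation.Nullary.Decidable using (¬¬-excluded-middle)
open import Relation.Unary using (Pred)
open import Tactic.RingSolver using (solve-∀)

-- Multiplying by ζ(k) instead of dividing keeps the whole estimate finite. The series Σ μ(d) d⁻ᵏ
-- for 1 / ζ(k) would bring a limit and a tail of its own; cutting ζ at ⌊D / d⌋ makes the
-- convolution an exact identity between rationals. The N-th approximation of ζ(k) is the partial
-- sum `zetaSum k N`, so the comparison takes place in ℚ at a single index N ≥ D, with a bound that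
-- does not depend on N. For a fixed n that bound is one rational number, and the passage to ℝ only
-- asks that the approximations of the right-hand side eventually exceed it. The obstacle for k = 2
-- is that γ ln γ vanishes at γ = 1, so a compact set around that point has to be produced in
-- Bishop's form. It is therefore cut out by non-strict inequalities, which survive limits, and its
-- finite nets must consist of points of the set itself. The side 20 is generous: it pays for
-- reading real inequalities at a coarse fixed precision and for the rounding in the root.

module RationalEstimates where

  open ℚ using (_+_; _*_; _-_; -_; _≤_; _<_; ∣_∣)
  open import Defs using (module Rational)
  open Rational

  -- Finite sums and the Möbius function

  ∑-ext : ∀ n {f g} → (∀ i → i ℕ.< n → f i ≡ g i) → ∑ n f ≡ ∑ n g
  ∑-ext zero    _ = refl
  ∑-ext (suc n) h = cong₂ _+_ (∑-ext n (λ i i<n → h i (ℕP.m<n⇒m<1+n i<n))) (h n ℕP.≤-refl)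

  ∑-+ : ∀ n f g → ∑ n (λ i → f i + g i) ≡ ∑ n f + ∑ n g
  ∑-+ zero    f g = refl
  ∑-+ (suc n) f g = trans (cong (_+ (f n + g n)) (∑-+ n f g)) (step (∑ n f) (∑ n g) (f n) (g n))
    where
    step : ∀ a b c d → (a + b) + (c + d) ≡ (a + c) + (b + d)
    step = solve-∀ ℚ-ring

  ∑-*ˡ : ∀ n c f → ∑ n (λ i → c * f i) ≡ c * ∑ n f
  ∑-*ˡ zero    c f = sym (ℚP.*-zeroʳ c)
  ∑-*ˡ (suc n) c f = trans (cong (_+ c * f n) (∑-*ˡ n c f)) (sym (ℚP.*-distribˡ-+ c (∑ n f) (f n)))

  ∑-*ʳ : ∀ n c f → ∑ n (λ i → f i * c) ≡ ∑ n f * c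
  ∑-*ʳ n c f = trans (∑-cong n (λ i → ℚP.*-comm (f i) c)) (trans (∑-*ˡ n c f) (ℚP.*-comm c (∑ n f)))

  ∑-0 : ∀ n → ∑ n (λ _ → 0ℚ) ≡ 0ℚ
  ∑-0 zero    = refl
  ∑-0 (suc n) = trans (cong (_+ 0ℚ) (∑-0 n)) (ℚP.+-identityʳ 0ℚ)

  ∑-swap : ∀ m n (f : ℕ → ℕ → ℚ) → ∑ m (λ i → ∑ n (f i)) ≡ ∑ n (λ j → ∑ m (λ i → f i j))
  ∑-swap zero    n f = sym (∑-0 n)
  ∑-swap (suc m) n f = trans (cong (_+ ∑ n (f m)) (∑-swap m n f)) (sym (∑-+ n _ (f m)))

  ∑-mono : ∀ n {f g} → (∀ i → i ℕ.< n → f i ≤ g i) → ∑ n f ≤ ∑ n g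
  ∑-mono zero    _ = ℚP.≤-refl
  ∑-mono (suc n) h = ℚP.+-mono-≤ (∑-mono n (λ i i<n → h i (ℕP.m<n⇒m<1+n i<n))) (h n ℕP.≤-refl)

  ∑-abs : ∀ n {f g} → (∀ i → i ℕ.< n → ∣ f i ∣ ≤ g i) → ∣ ∑ n f ∣ ≤ ∑ n g
  ∑-abs zero    _ = ℚP.≤-refl
  ∑-abs (suc n) {f} h =
    ∣+∣≤ {∑ n f} {f n} (∑-abs n (λ i i<n → h i (ℕP.m<n⇒m<1+n i<n))) (h n ℕP.≤-refl)

  ∑-trim : ∀ n j {f} → (∀ i → n ℕ.≤ i → f i ≡ 0ℚ) → ∑ (j ℕ.+ n) f ≡ ∑ n f
  ∑-trim n zero    h = refl
  ∑-trim n (suc j) {f} h =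
    trans (cong (∑ (j ℕ.+ n) f +_) (h (j ℕ.+ n) (ℕP.m≤n+m n j)))
      (trans (ℚP.+-identityʳ _) (∑-trim n j h))

  -- Indicators and sums over multiples.

  𝟙 : {P : Set} → Dec P → ℚ
  𝟙 (yes _) = 1ℚ
  𝟙 (no  _) = 0ℚ

  𝟙-yes : {P : Set} (d : Dec P) → P → 𝟙 d ≡ 1ℚ
  𝟙-yes (yes _) _ = refl
  𝟙-yes (no ¬p) p = contradiction p ¬p

  𝟙-no : {P : Set} (d : Dec P) → ¬ P → 𝟙 d ≡ 0ℚ
  𝟙-no (yes p) ¬p = contradiction p ¬p
  𝟙-no (no _)  _  = refl

  𝟙-cong : {P Q : Set} (d : Dec P) (e : Dec Q) → (P → Q) → (Q → P) → 𝟙 d ≡ 𝟙 e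
  𝟙-cong (yes p) e to _    = sym (𝟙-yes e (to p))
  𝟙-cong (no ¬p) e _  from = sym (𝟙-no e (λ q → ¬p (from q)))

  suc-/-∣ : ∀ N c → suc c ∣ suc N → suc N ℕ./ suc c ≡ suc (N ℕ./ suc c) × suc N ≡ suc (N ℕ./ suc c) ℕ.* suc c
  suc-/-∣ N c (divides (suc q) eq) = trans quot (cong suc (sym N/d≡q)) , trans eq (cong (λ z → suc z ℕ.* suc c) (sym N/d≡q))
    where
    quot : suc N ℕ./ suc c ≡ suc q
    quot = trans (cong (ℕ._/ suc c) eq) (DivMod.m*n/n≡m (suc q) (suc c))
    N/d≡q : N ℕ./ suc c ≡ q
    N/d≡q = trans (cong (ℕ._/ suc c) (ℕP.suc-injective eq))
      (trans (DivMod.+-distrib-/-∣ʳ c {q ℕ.* suc c} {suc c} (divides-refl q))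
        (cong₂ ℕ._+_ (DivMod.m<n⇒m/n≡0 {c} {suc c} ℕP.≤-refl) (DivMod.m*n/n≡m q (suc c))))

  suc-/-∤ : ∀ N c → ¬ suc c ∣ suc N → suc N ℕ./ suc c ≡ N ℕ./ suc c
  suc-/-∤ N c ∤ with ℕP.m≤n⇒m<n∨m≡n (DivMod.m%n<n N (suc c))
  ... | inj₂ eq = contradiction (divides (suc q) (trans (cong suc (DivMod.m≡m%n+[m/n]*n N (suc c)))
                    (cong (ℕ._+ q ℕ.* suc c) eq))) ∤
    where q = N ℕ./ suc c
  ... | inj₁ r<  = trans (cong (λ z → suc z ℕ./ suc c) (DivMod.m≡m%n+[m/n]*n N (suc c)))
      (trans (DivMod.+-distrib-/-∣ʳ (suc (N ℕ.% suc c)) {q ℕ.* suc c} {suc c} (divides-refl q))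
        (cong₂ ℕ._+_ (DivMod.m<n⇒m/n≡0 {suc (N ℕ.% suc c)} {suc c} r<) (DivMod.m*n/n≡m q (suc c))))
    where q = N ℕ./ suc c

  -- Induction on N: the quotient by `suc c` goes up by one exactly when `suc c` divides `suc N`, so
  -- both sides gain a term at the same moments.
  ∑-multiples : ∀ c N (F : ℕ → ℚ) → ∑ N (λ i → 𝟙 (suc c ∣? suc i) * F (suc i)) ≡ ∑ (N ℕ./ suc c) (λ j → F (suc j ℕ.* suc c))
  ∑-multiples c zero    F = refl
  ∑-multiples c (suc N) F with suc c ∣? suc N
  ... | no ∤ = trans (cong₂ _+_ (∑-multiples c N F) (ℚP.*-zeroˡ (F (suc N))))
    (trans (ℚP.+-identityʳ _) (cong (λ z → ∑ z (λ j → F (suc j ℕ.* suc c))) (sym (suc-/-∤ N c ∤))))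
  ... | yes d = trans (cong₂ _+_ (∑-multiples c N F)
      (trans (ℚP.*-identityˡ (F (suc N))) (cong F (proj₂ (suc-/-∣ N c d)))))
    (cong (λ z → ∑ z (λ j → F (suc j ℕ.* suc c))) (sym (proj₁ (suc-/-∣ N c d))))

  -- Products and Euler factors.

  Π : ℕ → (ℕ → ℚ) → ℚ
  Π zero    f = 1ℚ
  Π (suc n) f = Π n f * f n

  Π-ext : ∀ n {f g} → (∀ i → i ℕ.< n → f i ≡ g i) → Π n f ≡ Π n g
  Π-ext zero    _ = refl
  Π-ext (suc n) h = cong₂ _*_ (Π-ext n (λ i i<n → h i (ℕP.m<n⇒m<1+n i<n))) (h n ℕP.≤-refl)

  Π-trim : ∀ n j {f} → (∀ i → n ℕ.≤ i → f i ≡ 1ℚ) → Π (j ℕ.+ n) f ≡ Π n f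
  Π-trim n zero    h = refl
  Π-trim n (suc j) {f} h =
    trans (cong (Π (j ℕ.+ n) f *_) (h (j ℕ.+ n) (ℕP.m≤n+m n j)))
      (trans (ℚP.*-identityʳ _) (Π-trim n j h))

  Π-zero : ∀ n {f} p → p ℕ.< n → f p ≡ 0ℚ → Π n f ≡ 0ℚ
  Π-zero (suc n) {f} p p<sn eq with ℕP.m≤n⇒m<n∨m≡n (ℕP.≤-pred p<sn)
  ... | inj₁ p<n  = trans (cong (_* f n) (Π-zero n p p<n eq)) (ℚP.*-zeroˡ (f n))
  ... | inj₂ refl = trans (cong (Π n f *_) eq) (ℚP.*-zeroʳ (Π n f))

  Π-flip : ∀ n {f g} p → p ℕ.< n → f p ≡ - g p → (∀ i → i ≢ p → f i ≡ g i) → Π n f ≡ - Π n g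
  Π-flip (suc n) {f} {g} p p<sn eq h with ℕP.m≤n⇒m<n∨m≡n (ℕP.≤-pred p<sn)
  ... | inj₁ p<n  = trans (cong₂ _*_ (Π-flip n p p<n eq h) (h n (λ n≡p → ℕP.<-irrefl (sym n≡p) p<n)))
    (sym (ℚP.neg-distribˡ-* (Π n g) (g n)))
  ... | inj₂ refl = trans (cong₂ _*_ (Π-ext n (λ i i<n → h i (λ i≡n → ℕP.<-irrefl i≡n i<n))) eq)
    (sym (ℚP.neg-distribʳ-* (Π n g) (g n)))

  Π-abs≤1 : ∀ n {f} → (∀ i → ∣ f i ∣ ≤ 1ℚ) → ∣ Π n f ∣ ≤ 1ℚ
  Π-abs≤1 zero    _ = ℚP.≤-refl
  Π-abs≤1 (suc n) {f} h = ∣*∣≤ {Π n f} {f n} (Π-abs≤1 n h) (h n)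

  -- Composite indices get the factor 1, so that the Euler product can run over an initial segment
  -- of ℕ instead of a list of primes.
  localFactor : ℕ → ℕ → ℚ
  localFactor p d with prime? p | p ∣? d | p ℕ.* p ∣? d
  ... | no _  | _     | _     = 1ℚ
  ... | yes _ | no _  | _     = 1ℚ
  ... | yes _ | yes _ | no _  = - 1ℚ
  ... | yes _ | yes _ | yes _ = 0ℚ

  localFactor-abs : ∀ p d → ∣ localFactor p d ∣ ≤ 1ℚ
  localFactor-abs p d with prime? p | p ∣? d | p ℕ.* p ∣? d
  ... | no _  | _     | _     = ℚP.≤-refl
  ... | yes _ | no _  | _     = ℚP.≤-refl
  ... | yes _ | yes _ | no _  = ℚP.≤-refl
  ... | yes _ | yes _ | yes _ = 0≤1

  localFactor-∤ : ∀ p d → ¬ p ∣ d → localFactor p d ≡ 1ℚ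
  localFactor-∤ p d ∤ with prime? p | p ∣? d | p ℕ.* p ∣? d
  ... | no _  | _     | _ = refl
  ... | yes _ | no _  | _ = refl
  ... | yes _ | yes h | _ = contradiction h ∤

  localFactor-∣ : ∀ p d → Prime p → p ∣ d → ¬ p ℕ.* p ∣ d → localFactor p d ≡ - 1ℚ
  localFactor-∣ p d pr h ∤ with prime? p | p ∣? d | p ℕ.* p ∣? d
  ... | no ¬pr | _     | _      = contradiction pr ¬pr
  ... | yes _  | no ¬h | _      = contradiction h ¬h
  ... | yes _  | yes _ | no _   = refl
  ... | yes _  | yes _ | yes h² = contradiction h² ∤

  localFactor-∣² : ∀ p d → Prime p → p ℕ.* p ∣ d → localFactor p d ≡ 0ℚ
  localFactor-∣² p d pr h with prime? p | p ∣? d | p ℕ.* p ∣? d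
  ... | no ¬pr | _     | _     = contradiction pr ¬pr
  ... | yes _  | no ¬h | _     = contradiction (∣-trans (m∣m*n p) h) ¬h
  ... | yes _  | yes _ | no ∤  = contradiction h ∤
  ... | yes _  | yes _ | yes _ = refl

  localFactor-cong : ∀ p d e → (Prime p → p ∣ d → p ∣ e) → (Prime p → p ∣ e → p ∣ d) →
    (Prime p → p ℕ.* p ∣ d → p ℕ.* p ∣ e) → (Prime p → p ℕ.* p ∣ e → p ℕ.* p ∣ d) →
    localFactor p d ≡ localFactor p e
  localFactor-cong p d e to from to² from² with prime? p | p ∣? d | p ℕ.* p ∣? d | p ∣? e | p ℕ.* p ∣? e
  ... | no _   | _      | _     | _      | _     = refl
  ... | yes _  | no _   | _     | no _   | _     = refl
  ... | yes _  | yes _  | no _  | yes _  | no _  = refl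
  ... | yes _  | yes _  | yes _ | yes _  | yes _ = refl
  ... | yes pr | no ∤   | _     | yes h  | _     = contradiction (from pr h) ∤
  ... | yes pr | yes h  | _     | no ∤   | _     = contradiction (to pr h) ∤
  ... | yes pr | yes _  | no ∤  | yes _  | yes h = contradiction (from² pr h) ∤
  ... | yes pr | yes _  | yes h | yes _  | no ∤  = contradiction (to² pr h) ∤

  -- The Möbius function, as a product of Euler factors; factors at p > d are 1.
  μ : ℕ → ℚ
  μ d = Π (suc d) (λ p → localFactor p d)

  ∣μ∣≤1 : ∀ d → ∣ μ d ∣ ≤ 1ℚ
  ∣μ∣≤1 d = Π-abs≤1 (suc d) (λ p → localFactor-abs p d)

  -- The products for d and for d p have different lengths; this puts them over a common range.
  μ-trim : ∀ d j → Π (j ℕ.+ suc (suc d)) (λ p → localFactor p (suc d)) ≡ μ (suc d)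
  μ-trim d j = Π-trim (suc (suc d)) j (λ p d<p → localFactor-∤ p (suc d)
    (λ h → ℕP.<-irrefl refl (ℕP.<-≤-trans d<p (∣⇒≤ h))))

  μ-square : ∀ p d → Prime p → p ℕ.* p ∣ suc d → μ (suc d) ≡ 0ℚ
  μ-square p d pr h = Π-zero (suc (suc d)) p (ℕ.s≤s (∣⇒≤ (∣-trans (m∣m*n p) h))) (localFactor-∣² p (suc d) pr h)

  prime-∤ : ∀ {p q} → Prime p → Prime q → p ≢ q → ¬ p ∣ q
  prime-∤ {p} pp pq p≢q h with prime⇒irreducible pq h
  ... | inj₁ refl = contradiction (ℕ.nonTrivial⇒n>1 p {{prime⇒nonTrivial pp}}) (λ { (ℕ.s≤s ()) })
  ... | inj₂ eq   = p≢q eq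

  prime∣cancelʳ : ∀ {q p} d → Prime q → ¬ q ∣ p → q ∣ d ℕ.* p → q ∣ d
  prime∣cancelʳ {q} {p} d pq ∤ h with euclidsLemma d p pq h
  ... | inj₁ h′ = h′
  ... | inj₂ h′ = contradiction h′ ∤

  square∣cancelʳ : ∀ {q p} d → Prime q → ¬ q ∣ p → q ℕ.* q ∣ d ℕ.* p → q ℕ.* q ∣ d
  square∣cancelʳ {q} {p} d pq ∤ h with prime∣cancelʳ d pq ∤ (∣-trans (m∣m*n q) h)
  ... | divides-refl e = *-monoˡ-∣ q (prime∣cancelʳ e pq ∤
    (*-cancelʳ-∣ q {{prime⇒nonZero pq}} (subst (q ℕ.* q ∣_) (swap e q p) h)))
    where
    swap : ∀ e q p → e ℕ.* q ℕ.* p ≡ e ℕ.* p ℕ.* q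
    swap e q p = trans (ℕP.*-assoc e q p) (trans (cong (e ℕ.*_) (ℕP.*-comm q p)) (sym (ℕP.*-assoc e p q)))

  -- Only the factor at p changes, from 1 to -1: for a prime q ≠ p, divisibility by q and by q² does
  -- not see the factor p.
  μ-prime-* : ∀ c d → Prime (suc c) → ¬ suc c ∣ suc d → μ (suc d ℕ.* suc c) ≡ - μ (suc d)
  μ-prime-* c d pr ∤ = trans
    (Π-flip (suc (suc d ℕ.* p)) {λ q → localFactor q (suc d ℕ.* p)} {λ q → localFactor q (suc d)} p
      (ℕ.s≤s (ℕP.m≤m+n p (d ℕ.* p)))
      (trans (localFactor-∣ p (suc d ℕ.* p) pr (n∣m*n (suc d)) (λ h → ∤ (*-cancelʳ-∣ p h)))
             (cong -_ (sym (localFactor-∤ p (suc d) ∤))))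
      (λ q q≢p → localFactor-cong q (suc d ℕ.* p) (suc d)
        (λ pq → prime∣cancelʳ (suc d) pq (prime-∤ pq pr q≢p))
        (λ _ h → ∣-trans h (m∣m*n p))
        (λ pq → square∣cancelʳ (suc d) pq (prime-∤ pq pr q≢p))
        (λ _ h → ∣-trans h (m∣m*n p))))
    (cong -_ (trans (cong (λ z → Π z (λ q → localFactor q (suc d))) (sym (ℕP.m∸n+n≡m bound)))
      (μ-trim d (suc (suc d ℕ.* p) ℕ.∸ suc (suc d)))))
    where
    p = suc c
    bound : suc (suc d) ℕ.≤ suc (suc d ℕ.* p)
    bound = ℕ.s≤s (ℕP.m≤m*n (suc d) p)

  prime-divisor : ∀ n → 1 ℕ.< n → Σ[ p ∈ ℕ ] (Prime p × p ∣ n)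
  prime-divisor n@(suc _) 1<n with factorise n
  ... | record { factors = []     ; isFactorisation = eq } = contradiction (sym eq) (ℕP.<⇒≢ 1<n)
  ... | record { factors = p ∷ ps ; isFactorisation = eq ; factorsPrime = pr ListAll.∷ _ } =
    p , pr , subst (p ∣_) (sym eq) (m∣m*n (ListAction.product ps))

  coprime-divisor : ∀ {p d} m → Prime p → ¬ p ∣ d → d ∣ m ℕ.* p → d ∣ m
  coprime-divisor {p} {d} m pr ∤ (divides q eq) with euclidsLemma q d pr (divides m (sym eq))
  ... | inj₂ h = contradiction h ∤
  ... | inj₁ (divides-refl r) = divides r (ℕP.*-cancelʳ-≡ m (r ℕ.* d) p {{prime⇒nonZero pr}} (trans eq
    (trans (ℕP.*-assoc r p d) (trans (cong (r ℕ.*_) (ℕP.*-comm p d)) (sym (ℕP.*-assoc r d p))))))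

  -- The divisors d and d p with p ∤ d cancel, and μ vanishes at the multiples of p².
  μ-sum-prime : ∀ c m → Prime (suc c) → ∑ (suc m ℕ.* suc c) (λ j → 𝟙 (suc j ∣? suc m ℕ.* suc c) * μ (suc j)) ≡ 0ℚ
  μ-sum-prime c m′ pr = begin
    ∑ n (λ j → f (suc j))
      ≡⟨ ∑-cong n (λ j → split (𝟙 (p ∣? suc j)) (f (suc j))) ⟩
    ∑ n (λ j → 𝟙 (p ∣? suc j) * f (suc j) + g (suc j))
      ≡⟨ ∑-+ n _ _ ⟩
    ∑ n (λ j → 𝟙 (p ∣? suc j) * f (suc j)) + ∑ n (λ j → g (suc j))
      ≡⟨ cong₂ _+_ multiples (trans (cong (λ z → ∑ z (λ j → g (suc j))) (sym (ℕP.m∸n+n≡m m≤n)))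
           (∑-trim m (n ℕ.∸ m) (λ j m≤j → vanish j m≤j))) ⟩
    ∑ m (λ j → f (suc j ℕ.* p)) + ∑ m (λ j → g (suc j))
      ≡⟨ ∑-+ m _ _ ⟨
    ∑ m (λ j → f (suc j ℕ.* p) + g (suc j))
      ≡⟨ ∑-cong m cancel ⟩
    ∑ m (λ _ → 0ℚ)
      ≡⟨ ∑-0 m ⟩
    0ℚ ∎
    where
    open ≡-Reasoning
    p = suc c
    m = suc m′
    n = m ℕ.* p
    f g : ℕ → ℚ
    f d = 𝟙 (d ∣? n) * μ d
    g d = (1ℚ - 𝟙 (p ∣? d)) * f d
    split : ∀ a x → x ≡ a * x + (1ℚ - a) * x
    split = solve-∀ ℚ-ring
    m≤n : m ℕ.≤ n
    m≤n = ℕP.m≤m*n m p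
    multiples : ∑ n (λ j → 𝟙 (p ∣? suc j) * f (suc j)) ≡ ∑ m (λ j → f (suc j ℕ.* p))
    multiples = trans (∑-multiples c n f) (cong (λ z → ∑ z (λ j → f (suc j ℕ.* p))) (DivMod.m*n/n≡m m p))
    -- A divisor of m p that is prime to p divides m, hence is at most m. Cut to length m, this sum
    -- pairs term by term with the one over multiples of p.
    vanish : ∀ j → m ℕ.≤ j → g (suc j) ≡ 0ℚ
    vanish j m≤j with p ∣? suc j
    ... | yes _ = ℚP.*-zeroˡ (f (suc j))
    ... | no ∤  = trans (cong (λ z → 1ℚ * (z * μ (suc j))) (𝟙-no (suc j ∣? n) (λ h →
        ℕP.<-irrefl refl (ℕP.≤-trans (∣⇒≤ (coprime-divisor m pr ∤ h)) m≤j))))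
      (trans (ℚP.*-identityˡ _) (ℚP.*-zeroˡ (μ (suc j))))
    cancel : ∀ j → f (suc j ℕ.* p) + g (suc j) ≡ 0ℚ
    cancel j with p ∣? suc j
    ... | yes h = cong₂ _+_ (trans (cong (𝟙 (suc j ℕ.* p ∣? n) *_) (μ-square p _ pr (*-monoˡ-∣ p h)))
        (ℚP.*-zeroʳ (𝟙 (suc j ℕ.* p ∣? n)))) (ℚP.*-zeroˡ (f (suc j)))
    ... | no ∤  = trans (cong (_+ 1ℚ * f (suc j)) (cong₂ _*_
        (𝟙-cong (suc j ℕ.* p ∣? n) (suc j ∣? n) (∣-trans (m∣m*n p))
          (λ h → *-monoˡ-∣ p (coprime-divisor m pr ∤ h)))
        (μ-prime-* c j pr ∤)))
      (neg-cancel (𝟙 (suc j ∣? n)) (μ (suc j)))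
      where
      neg-cancel : ∀ a x → a * (- x) + 1ℚ * (a * x) ≡ 0ℚ
      neg-cancel = solve-∀ ℚ-ring

  μ-sum-divisors : ∀ n → ∑ (suc n) (λ j → 𝟙 (suc j ∣? suc n) * μ (suc j)) ≡ 𝟙 (suc n ℕ.≟ 1)
  μ-sum-divisors zero    = refl
  μ-sum-divisors (suc n) with prime-divisor (suc (suc n)) (ℕ.s≤s (ℕ.s≤s ℕ.z≤n))
  ... | suc c , pr , divides (suc m) eq = trans (cong S eq) (trans (μ-sum-prime c m pr)
    (sym (𝟙-no (suc (suc n) ℕ.≟ 1) λ ())))
    where
    S : ℕ → ℚ
    S N = ∑ N (λ j → 𝟙 (suc j ∣? N) * μ (suc j))
  ... | zero , _ , divides m eq = contradiction (trans eq (ℕP.*-zeroʳ m)) λ ()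

  -- Divisors of n + 1 do not exceed n + 1, so the range may be any larger D. A range common to all
  -- n is what allows the order of summation to be exchanged later.
  μ-sum : ∀ n D → n ℕ.< D → ∑ D (λ j → 𝟙 (suc j ∣? suc n) * μ (suc j)) ≡ 𝟙 (suc n ℕ.≟ 1)
  μ-sum n D n<D = trans (cong (λ z → ∑ z (λ j → 𝟙 (suc j ∣? suc n) * μ (suc j))) (sym (ℕP.m∸n+n≡m n<D)))
    (trans (∑-trim (suc n) (D ℕ.∸ suc n) (λ j n<j → trans (cong (_* μ (suc j))
        (𝟙-no (suc j ∣? suc n) (λ h → ℕP.<-irrefl refl (ℕP.≤-trans (∣⇒≤ h) n<j)))) (ℚP.*-zeroˡ (μ (suc j)))))
      (μ-sum-divisors n))

  -- Counting coprime vectors in a box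

  boxSum : ∀ {k} → Vec ℕ k → (Vec ℕ k → ℚ) → ℚ
  boxSum []       F = F []
  boxSum (m ∷ ms) F = ∑ m (λ i → boxSum ms (λ a → F (suc i ∷ a)))

  InBox : ∀ {k} → Vec ℕ k → Vec ℕ k → Set
  InBox m a = All (0 ℕ.<_) a × Pointwise ℕ._≤_ a m

  boxSum-ext : ∀ {k} (m : Vec ℕ k) {F G} → (∀ a → InBox m a → F a ≡ G a) → boxSum m F ≡ boxSum m G
  boxSum-ext []       h = h [] ([] , [])
  boxSum-ext (m ∷ ms) h = ∑-ext m λ i i<m → boxSum-ext ms λ a (p , q) →
    h (suc i ∷ a) (ℕ.s≤s ℕ.z≤n ∷ p , i<m ∷ q)

  boxSum-∑ : ∀ {k} (m : Vec ℕ k) n (F : ℕ → Vec ℕ k → ℚ) →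
    boxSum m (λ a → ∑ n (λ j → F j a)) ≡ ∑ n (λ j → boxSum m (F j))
  boxSum-∑ []       n F = refl
  boxSum-∑ (m ∷ ms) n F = trans (∑-cong m (λ i → boxSum-∑ ms n (λ j a → F j (suc i ∷ a))))
    (∑-swap m n (λ i j → boxSum ms (λ a → F j (suc i ∷ a))))

  boxSum-*ˡ : ∀ {k} (m : Vec ℕ k) c F → boxSum m (λ a → c * F a) ≡ c * boxSum m F
  boxSum-*ˡ []       c F = refl
  boxSum-*ˡ (m ∷ ms) c F = trans (∑-cong m (λ i → boxSum-*ˡ ms c (λ a → F (suc i ∷ a)))) (∑-*ˡ m c _)

  ∏ : ∀ {k} → Vec ℚ k → ℚ
  ∏ = Vec.foldr′ _*_ 1ℚ

  ∑-1 : ∀ n → ∑ n (λ _ → 1ℚ) ≡ fromℕ n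
  ∑-1 zero    = refl
  ∑-1 (suc n) = trans (cong (_+ 1ℚ) (∑-1 n)) (ℚP.+-comm (fromℕ n) 1ℚ)

  -- Divisibility of a gcd is a condition on each coordinate separately, so the sum over the box
  -- factors, and each factor counts multiples. The empty gcd is 0, divisible by everything, in
  -- agreement with the empty product 1.
  boxSum-∣gcd : ∀ {k} (m : Vec ℕ k) c →
    boxSum m (λ a → 𝟙 (suc c ∣? Vec.foldr′ gcd 0 a)) ≡ ∏ (Vec.map (λ i → fromℕ (i ℕ./ suc c)) m)
  boxSum-∣gcd []       c = 𝟙-yes (suc c ∣? 0) (suc c ∣0)
  boxSum-∣gcd (m ∷ ms) c = begin
    ∑ m (λ i → boxSum ms (λ a → 𝟙 (d ∣? gcd (suc i) (Vec.foldr′ gcd 0 a))))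
      ≡⟨ ∑-cong m (λ i → boxSum-ext ms (λ a _ → factor (suc i) (Vec.foldr′ gcd 0 a))) ⟩
    ∑ m (λ i → boxSum ms (λ a → 𝟙 (d ∣? suc i) * 𝟙 (d ∣? Vec.foldr′ gcd 0 a)))
      ≡⟨ ∑-cong m (λ i → trans (boxSum-*ˡ ms (𝟙 (d ∣? suc i)) _) (cong (𝟙 (d ∣? suc i) *_) (boxSum-∣gcd ms c))) ⟩
    ∑ m (λ i → 𝟙 (d ∣? suc i) * rest)
      ≡⟨ ∑-*ʳ m rest _ ⟩
    ∑ m (λ i → 𝟙 (d ∣? suc i)) * rest
      ≡⟨ cong (_* rest) (trans (∑-cong m (λ i → sym (ℚP.*-identityʳ (𝟙 (d ∣? suc i)))))
           (trans (∑-multiples c m (λ _ → 1ℚ)) (∑-1 (m ℕ./ d)))) ⟩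
    fromℕ (m ℕ./ d) * rest ∎
    where
    open ≡-Reasoning
    d = suc c
    rest = ∏ (Vec.map (λ i → fromℕ (i ℕ./ d)) ms)
    factor : ∀ x y → 𝟙 (d ∣? gcd x y) ≡ 𝟙 (d ∣? x) * 𝟙 (d ∣? y)
    factor x y with d ∣? x | d ∣? y
    ... | yes p | yes q = 𝟙-yes (d ∣? gcd x y) (gcd-greatest p q)
    ... | yes _ | no ¬q = 𝟙-no (d ∣? gcd x y) (λ h → ¬q (∣-trans h (gcd[m,n]∣n x y)))
    ... | no ¬p | yes _ = 𝟙-no (d ∣? gcd x y) (λ h → ¬p (∣-trans h (gcd[m,n]∣m x y)))
    ... | no ¬p | no _  = 𝟙-no (d ∣? gcd x y) (λ h → ¬p (∣-trans h (gcd[m,n]∣m x y)))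

  -- Enumerating the box, and Möbius inversion for its coprime points.

  box : ∀ {k} → Vec ℕ k → List (Vec ℕ k)
  box []       = [] ∷ []
  box (m ∷ ms) = List.cartesianProductWith (λ i a → suc i ∷ a) (List.downFrom m) (box ms)

  box-unique : ∀ {k} (m : Vec ℕ k) → Unique (box m)
  box-unique []       = ListAll.[] ∷ []
  box-unique (m ∷ ms) = Unique.cartesianProductWith⁺ (λ i a → suc i ∷ a)
    (λ eq → ℕP.suc-injective (VecP.∷-injectiveˡ eq) , VecP.∷-injectiveʳ eq) (Unique.downFrom⁺ m) (box-unique ms)

  ∈-box⁺ : ∀ {k} (m a : Vec ℕ k) → InBox m a → a ∈ box m
  ∈-box⁺ []       []           _ = here refl
  ∈-box⁺ (m ∷ ms) (suc i ∷ as) (_ ∷ p , i<m ∷ q) =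
    ∈-cartesianProductWith⁺ (λ i a → suc i ∷ a) (∈-downFrom⁺ i<m) (∈-box⁺ ms as (p , q))
  ∈-box⁺ (m ∷ ms) (zero ∷ as)  (() ∷ _ , _)

  ∈-box⁻ : ∀ {k} (m a : Vec ℕ k) → a ∈ box m → InBox m a
  ∈-box⁻ []       []       _ = [] , []
  ∈-box⁻ (m ∷ ms) (a ∷ as) h with ∈-cartesianProductWith⁻ (λ i a → suc i ∷ a) (List.downFrom m) (box ms) h
  ... | i , _ , i∈ , as∈ , refl = let (p , q) = ∈-box⁻ ms as as∈ in ℕ.s≤s ℕ.z≤n ∷ p , ∈-downFrom⁻ i∈ ∷ q

  listSum : {A : Set} → (A → ℚ) → List A → ℚ
  listSum F []       = 0ℚ
  listSum F (x ∷ xs) = F x + listSum F xs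

  listSum-++ : {A : Set} (F : A → ℚ) (xs ys : List A) → listSum F (xs List.++ ys) ≡ listSum F xs + listSum F ys
  listSum-++ F []       ys = sym (ℚP.+-identityˡ (listSum F ys))
  listSum-++ F (x ∷ xs) ys = trans (cong (F x +_) (listSum-++ F xs ys)) (sym (ℚP.+-assoc (F x) (listSum F xs) (listSum F ys)))

  listSum-map : {A B : Set} (F : B → ℚ) (g : A → B) (xs : List A) → listSum F (List.map g xs) ≡ listSum (λ x → F (g x)) xs
  listSum-map F g []       = refl
  listSum-map F g (x ∷ xs) = cong (F (g x) +_) (listSum-map F g xs)

  listSum-product : {A B C : Set} (F : C → ℚ) (g : A → B → C) (xs : List A) (ys : List B) →
    listSum F (List.cartesianProductWith g xs ys) ≡ listSum (λ x → listSum (λ y → F (g x y)) ys) xs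
  listSum-product F g []       ys = refl
  listSum-product F g (x ∷ xs) ys = trans (listSum-++ F (List.map (g x) ys) (List.cartesianProductWith g xs ys))
    (cong₂ _+_ (listSum-map F (g x) ys) (listSum-product F g xs ys))

  listSum-downFrom : ∀ (F : ℕ → ℚ) n → listSum F (List.downFrom n) ≡ ∑ n F
  listSum-downFrom F zero    = refl
  listSum-downFrom F (suc n) = trans (cong (F n +_) (listSum-downFrom F n)) (ℚP.+-comm (F n) (∑ n F))

  listSum-box : ∀ {k} (m : Vec ℕ k) F → listSum F (box m) ≡ boxSum m F
  listSum-box []       F = ℚP.+-identityʳ (F [])
  listSum-box (m ∷ ms) F = trans (listSum-product F (λ i a → suc i ∷ a) (List.downFrom m) (box ms))
    (trans (listSum-downFrom _ m) (∑-cong m (λ i → listSum-box ms (λ a → F (suc i ∷ a)))))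

  length-filter : {A : Set} {P : A → Set} (P? : ∀ a → Dec (P a)) (xs : List A) →
    fromℕ (length (List.filter P? xs)) ≡ listSum (λ a → 𝟙 (P? a)) xs
  length-filter P? []       = refl
  length-filter P? (x ∷ xs) with P? x
  ... | yes p = cong (1ℚ +_) (length-filter P? xs)
  ... | no ¬p = trans (length-filter P? xs) (sym (ℚP.+-identityˡ _))

  CoprimeInBox : ∀ {k} → Vec ℕ k → Vec ℕ k → Set
  CoprimeInBox m a = InBox m a × Vec.foldr′ gcd 0 a ≡ 1

  module _ {k} (m : Vec ℕ k) (xs : List (Vec ℕ k)) (unique : Unique xs) (spec : ∀ a → a ∈ xs ⇔ CoprimeInBox m a) where

    private
      coprime? : ∀ (a : Vec ℕ k) → Dec (Vec.foldr′ gcd 0 a ≡ 1)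
      coprime? a = Vec.foldr′ gcd 0 a ℕ.≟ 1

    -- The list that witnesses the cardinality is arbitrary, but a duplicate-free list is determined
    -- by its members up to permutation, so it may be exchanged for the filtered box.
    length-coprime : fromℕ (length xs) ≡ boxSum m (λ a → 𝟙 (coprime? a))
    length-coprime = trans
      (cong fromℕ (↭-length (∼bag⇒↭ (unique∧set⇒bag unique (Unique.filter⁺ coprime? (box-unique m)) (λ {a} → mk⇔
        (λ a∈ → let (p , q) = Equivalence.to (spec a) a∈ in ∈-filter⁺ coprime? (∈-box⁺ m a p) q)
        (λ a∈ → let (p , q) = ∈-filter⁻ coprime? {xs = box m} a∈ in Equivalence.from (spec a) (∈-box⁻ m a p , q)))))))
      (trans (length-filter coprime? (box m)) (listSum-box m _))

  -- The gcd divides the positive first coordinate, so it is nonzero and at most D. This places it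
  -- in the range of `μ-sum`.
  gcd-range : ∀ {k} (m a : Vec ℕ (suc k)) D → All (ℕ._≤ D) m → InBox m a →
    Σ[ g ∈ ℕ ] (Vec.foldr′ gcd 0 a ≡ suc g × g ℕ.< D)
  gcd-range (m ∷ ms) (suc a ∷ as) D (m≤D ∷ _) (_ , a≤m ∷ _) with gcd (suc a) (Vec.foldr′ gcd 0 as) in eq
  ... | zero  = contradiction (0∣⇒≡0 (subst (_∣ suc a) eq (gcd[m,n]∣m (suc a) (Vec.foldr′ gcd 0 as)))) λ ()
  ... | suc g = g , refl , ℕP.≤-trans (∣⇒≤ (subst (_∣ suc a) eq (gcd[m,n]∣m (suc a) (Vec.foldr′ gcd 0 as)))) (ℕP.≤-trans a≤m m≤D)
  gcd-range (m ∷ ms) (zero ∷ as) D _ (() ∷ _ , _)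

  coprime-count : ∀ {k} (m : Vec ℕ (suc k)) D → All (ℕ._≤ D) m →
    (xs : List (Vec ℕ (suc k))) → Unique xs → (∀ a → a ∈ xs ⇔ CoprimeInBox m a) →
    fromℕ (length xs) ≡ ∑ D (λ j → μ (suc j) * ∏ (Vec.map (λ i → fromℕ (i ℕ./ suc j)) m))
  coprime-count m D m≤D xs unique spec = begin
    fromℕ (length xs)
      ≡⟨ length-coprime m xs unique spec ⟩
    boxSum m (λ a → 𝟙 (gcds a ℕ.≟ 1))
      ≡⟨ boxSum-ext m (λ a a∈ → sym (expand a (gcd-range m a D m≤D a∈))) ⟩
    boxSum m (λ a → ∑ D (λ j → 𝟙 (suc j ∣? gcds a) * μ (suc j)))
      ≡⟨ boxSum-∑ m D (λ j a → 𝟙 (suc j ∣? gcds a) * μ (suc j)) ⟩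
    ∑ D (λ j → boxSum m (λ a → 𝟙 (suc j ∣? gcds a) * μ (suc j)))
      ≡⟨ ∑-cong D (λ j → trans (boxSum-ext m (λ a _ → ℚP.*-comm (𝟙 (suc j ∣? gcds a)) (μ (suc j))))
           (trans (boxSum-*ˡ m (μ (suc j)) _) (cong (μ (suc j) *_) (boxSum-∣gcd m j)))) ⟩
    ∑ D (λ j → μ (suc j) * ∏ (Vec.map (λ i → fromℕ (i ℕ./ suc j)) m)) ∎
    where
    open ≡-Reasoning
    gcds : Vec ℕ _ → ℕ
    gcds = Vec.foldr′ gcd 0
    expand : ∀ a → Σ[ g ∈ ℕ ] (gcds a ≡ suc g × g ℕ.< D) →
      ∑ D (λ j → 𝟙 (suc j ∣? gcds a) * μ (suc j)) ≡ 𝟙 (gcds a ℕ.≟ 1)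
    expand a (g , eq , g<D) = subst (λ z → ∑ D (λ j → 𝟙 (suc j ∣? z) * μ (suc j)) ≡ 𝟙 (z ℕ.≟ 1)) (sym eq) (μ-sum g D g<D)

  -- The error term for boxes with integral sides

  recip-unique : ∀ {q r} (0<q : 0ℚ < q) → q * r ≡ 1ℚ → r ≡ recip q 0<q
  recip-unique {q} {r} 0<q eq = trans (sym (*-recip-* 0<q r)) (trans (step q r (recip q 0<q))
    (trans (cong (_* recip q 0<q) eq) (ℚP.*-identityˡ (recip q 0<q))))
    where
    step : ∀ q r s → q * (r * s) ≡ (q * r) * s
    step = solve-∀ ℚ-ring

  -- The index is (i + 1)(j + 1) - 1, in the form to which `suc i * suc j` computes after its outer
  -- `suc` is removed.
  unit-* : ∀ i j → unit i * unit j ≡ unit (j ℕ.+ i ℕ.* suc j)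
  unit-* i j = recip-unique (0<fromℕ (j ℕ.+ i ℕ.* suc j))
    (trans (cong (_* (unit i * unit j)) (fromℕ-* (suc i) (suc j)))
      (trans (step (fromℕ (suc i)) (fromℕ (suc j)) (unit i) (unit j))
        (cong₂ _*_ (*-recip (0<fromℕ i)) (*-recip (0<fromℕ j)))))
    where
    step : ∀ a b u v → (a * b) * (u * v) ≡ (a * u) * (b * v)
    step = solve-∀ ℚ-ring

  ^-distrib-* : ∀ a b k → (a * b) ^ k ≡ a ^ k * b ^ k
  ^-distrib-* a b zero    = refl
  ^-distrib-* a b (suc k) = trans (cong ((a * b) *_) (^-distrib-* a b k)) (step a b (a ^ k) (b ^ k))
    where
    step : ∀ a b x y → (a * b) * (x * y) ≡ (a * x) * (b * y)
    step = solve-∀ ℚ-ring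

  1^ : ∀ k → 1ℚ ^ k ≡ 1ℚ
  1^ zero    = refl
  1^ (suc k) = trans (ℚP.*-identityˡ (1ℚ ^ k)) (1^ k)

  -- Cutting ζ at ⌊D / d⌋ keeps exactly the products d e ≤ D. Grouped by i = d e, the coefficient of
  -- i⁻ᵏ is the sum of μ over the divisors of i, so only i = 1 survives and no tail is left over.
  μ-zeta : ∀ k D → ∑ (suc D) (λ j → μ (suc j) * (unit j ^ k * zetaSum k (suc D ℕ./ suc j))) ≡ 1ℚ
  μ-zeta k D = begin
    ∑ (suc D) (λ j → μ (suc j) * (unit j ^ k * zetaSum k (suc D ℕ./ suc j)))
      ≡⟨ ∑-cong (suc D) (λ j → cong (μ (suc j) *_) (multiples j)) ⟩
    ∑ (suc D) (λ j → μ (suc j) * ∑ (suc D) (λ i → 𝟙 (suc j ∣? suc i) * F (suc i)))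
      ≡⟨ ∑-cong (suc D) (λ j → trans (sym (∑-*ˡ (suc D) (μ (suc j)) _))
           (∑-cong (suc D) (λ i → step (μ (suc j)) (𝟙 (suc j ∣? suc i)) (F (suc i))))) ⟩
    ∑ (suc D) (λ j → ∑ (suc D) (λ i → F (suc i) * (𝟙 (suc j ∣? suc i) * μ (suc j))))
      ≡⟨ ∑-swap (suc D) (suc D) (λ j i → F (suc i) * (𝟙 (suc j ∣? suc i) * μ (suc j))) ⟩
    ∑ (suc D) (λ i → ∑ (suc D) (λ j → F (suc i) * (𝟙 (suc j ∣? suc i) * μ (suc j))))
      ≡⟨ ∑-ext (suc D) (λ i i≤D → trans (∑-*ˡ (suc D) (F (suc i)) _) (cong (F (suc i) *_) (μ-sum i (suc D) i≤D))) ⟩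
    ∑ (suc D) (λ i → F (suc i) * 𝟙 (suc i ℕ.≟ 1))
      ≡⟨ cong (λ z → ∑ z (λ i → F (suc i) * 𝟙 (suc i ℕ.≟ 1))) (ℕP.+-comm 1 D) ⟩
    ∑ (D ℕ.+ 1) (λ i → F (suc i) * 𝟙 (suc i ℕ.≟ 1))
      ≡⟨ ∑-trim 1 D (λ { (suc i) _ → ℚP.*-zeroʳ (F (suc (suc i))) ; zero () }) ⟩
    0ℚ + F 1 * 1ℚ
      ≡⟨ trans (ℚP.+-identityˡ (F 1 * 1ℚ)) (trans (ℚP.*-identityʳ (F 1)) (1^ k)) ⟩
    1ℚ ∎
    where
    open ≡-Reasoning
    F : ℕ → ℚ
    F zero    = 0ℚ
    F (suc n) = unit n ^ k
    step : ∀ m i f → m * (i * f) ≡ f * (i * m)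
    step = solve-∀ ℚ-ring
    multiples : ∀ j → unit j ^ k * zetaSum k (suc D ℕ./ suc j) ≡ ∑ (suc D) (λ i → 𝟙 (suc j ∣? suc i) * F (suc i))
    multiples j = trans (sym (∑-*ˡ (suc D ℕ./ suc j) (unit j ^ k) (λ i → unit i ^ k)))
      (trans (∑-cong (suc D ℕ./ suc j) (λ i → trans (ℚP.*-comm (unit j ^ k) (unit i ^ k))
          (trans (sym (^-distrib-* (unit i) (unit j) k)) (cong (_^ k) (unit-* i j)))))
        (sym (∑-multiples j (suc D) F)))

  ∏-bound : ∀ {k} {x : Vec ℚ k} {X} → All (λ a → ∣ a ∣ ≤ X) x → ∣ ∏ x ∣ ≤ X ^ k
  ∏-bound []                 = ℚP.≤-refl
  ∏-bound {x = a ∷ x} (p ∷ ps) = ∣*∣≤ {a} {∏ x} p (∏-bound ps)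

  -- Multiplied by X, so that no exponent k - 1 is needed.
  ∏-close : ∀ {k} {x y : Vec ℚ k} {c X} → 0ℚ ≤ X → Pointwise (λ a b → ∣ a - b ∣ ≤ c) x y →
    All (λ a → ∣ a ∣ ≤ X) x → All (λ a → ∣ a ∣ ≤ X) y → X * ∣ ∏ x - ∏ y ∣ ≤ fromℕ k * (c * X ^ k)
  ∏-close {c = c} {X} 0≤X [] [] [] = ℚP.≤-reflexive (trans (ℚP.*-zeroʳ X) (sym (ℚP.*-zeroˡ (c * 1ℚ))))
  ∏-close {suc k} {x = a ∷ x} {y = b ∷ y} {c} {X} 0≤X (near ∷ nears) (p ∷ ps) (q ∷ qs) = begin
    X * ∣ a * ∏ x - b * ∏ y ∣
      ≡⟨ cong (λ z → X * ∣ z ∣) (split a b (∏ x) (∏ y)) ⟩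
    X * ∣ (a - b) * ∏ x + b * (∏ x - ∏ y) ∣
      ≤⟨ *-monoˡ 0≤X (∣+∣≤ {(a - b) * ∏ x} {b * (∏ x - ∏ y)} (∣*∣≤ {a - b} {∏ x} near (∏-bound ps))
           (∣*∣≤ {b} {∏ x - ∏ y} q ℚP.≤-refl)) ⟩
    X * (c * X ^ k + X * ∣ ∏ x - ∏ y ∣)
      ≤⟨ *-monoˡ 0≤X (ℚP.+-monoʳ-≤ (c * X ^ k) (∏-close 0≤X nears ps qs)) ⟩
    X * (c * X ^ k + fromℕ k * (c * X ^ k))
      ≡⟨ collect X c (X ^ k) (fromℕ k) ⟩
    (1ℚ + fromℕ k) * (c * (X * X ^ k)) ∎
    where
    open ℚP.≤-Reasoning
    split : ∀ a b x y → a * x - b * y ≡ (a - b) * x + b * (x - y)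
    split = solve-∀ ℚ-ring
    collect : ∀ X c x k → X * (c * x + k * (c * x)) ≡ (1ℚ + k) * (c * (X * x))
    collect = solve-∀ ℚ-ring

  ∏-scale : ∀ {k} (m : Vec ℕ k) u → ∏ (Vec.map (λ i → fromℕ i * u) m) ≡ ∏ (Vec.map fromℕ m) * u ^ k
  ∏-scale []       u = refl
  ∏-scale {suc k} (m ∷ ms) u = trans (cong (fromℕ m * u *_) (∏-scale ms u)) (step (fromℕ m) u (∏ (Vec.map fromℕ ms)) (u ^ k))
    where
    step : ∀ a u p v → (a * u) * (p * v) ≡ (a * p) * (u * v)
    step = solve-∀ ℚ-ring

  ∣fromℕ∣ : ∀ n → ∣ fromℕ n ∣ ≡ fromℕ n
  ∣fromℕ∣ n = ℚP.0≤p⇒∣p∣≡p (0≤fromℕ n)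

  *-monoʳ : ∀ {c a b} → 0ℚ ≤ c → a ≤ b → a * c ≤ b * c
  *-monoʳ {c} 0≤c = ℚP.*-monoʳ-≤-nonNeg c {{ℚ.nonNegative 0≤c}}

  *-cancelˡ : ∀ {c a b} → 0ℚ < c → c * a ≤ c * b → a ≤ b
  *-cancelˡ {c} 0<c = ℚP.*-cancelˡ-≤-pos c {{ℚ.positive 0<c}}

  module _ (i j : ℕ) where

    private
      r q : ℕ
      r = i ℕ.% suc j
      q = i ℕ./ suc j

    quotient-remainder : fromℕ i * unit j ≡ fromℕ r * unit j + fromℕ q
    quotient-remainder = trans (cong (λ z → fromℕ z * unit j) (DivMod.m≡m%n+[m/n]*n i (suc j)))
      (trans (cong (_* unit j) (trans (fromℕ-+ r (q ℕ.* suc j)) (cong (fromℕ r +_) (fromℕ-* q (suc j)))))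
        (trans (step (fromℕ r) (fromℕ q) (fromℕ (suc j)) (unit j))
          (cong (fromℕ r * unit j +_) (trans (cong (fromℕ q *_) (*-recip (0<fromℕ j))) (ℚP.*-identityʳ (fromℕ q))))))
      where
      step : ∀ r q d u → (r + q * d) * u ≡ r * u + q * (d * u)
      step = solve-∀ ℚ-ring

    remainder≤1 : fromℕ r * unit j ≤ 1ℚ
    remainder≤1 = subst (fromℕ r * unit j ≤_) (*-recip (0<fromℕ j))
      (*-monoʳ (<⇒≤ (0<unit j)) (fromℕ-mono (ℕP.<⇒≤ (DivMod.m%n<n i (suc j)))))

    quotient≤ : fromℕ q ≤ fromℕ i * unit j
    quotient≤ = ≤-by (fromℕ r * unit j) (0≤* (0≤fromℕ r) (<⇒≤ (0<unit j)))
      (trans quotient-remainder (ℚP.+-comm (fromℕ r * unit j) (fromℕ q)))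

    ≤1+quotient : fromℕ i * unit j ≤ fromℕ (suc q)
    ≤1+quotient = subst (_≤ fromℕ (suc q)) (sym quotient-remainder) (ℚP.+-monoˡ-≤ (fromℕ q) remainder≤1)

    quotient-close : ∣ fromℕ q - fromℕ i * unit j ∣ ≤ 1ℚ
    quotient-close = ∣-∣≤ (ℚP.≤-trans quotient≤ (≤-by 1ℚ 0≤1 refl))
      (subst (fromℕ i * unit j ≤_) (ℚP.+-comm 1ℚ (fromℕ q)) ≤1+quotient)

  -- The telescoping tail bound after the first term: at most 1 + 1.
  zetaSum≤2 : ∀ k n → zetaSum (2 ℕ.+ k) n ≤ fromℕ 2
  zetaSum≤2 k n = ℚP.≤-trans (subst (λ z → zetaSum (2 ℕ.+ k) n ≤ zetaSum (2 ℕ.+ k) z) (ℕP.+-comm 1 n) (zeta-mono (2 ℕ.+ k) n 1))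
    (ℚP.≤-trans (zeta-tail k 0 n) (ℚP.≤-reflexive (cong (λ z → (0ℚ + z) + 1ℚ) (1^ (2 ℕ.+ k)))))

  0≤zetaSum : ∀ k n → 0ℚ ≤ zetaSum k n
  0≤zetaSum k n = subst (λ z → 0ℚ ≤ zetaSum k z) (ℕP.+-identityʳ n) (zeta-mono k 0 n)

  -- The terms after the q-th add up to at most 1 / q, and X ≤ q + 1 ≤ 2 q because q ≥ 1. It is
  -- applied with X = D / d and q = ⌊D / d⌋.
  zetaSum-close : ∀ k q L X → 0 ℕ.< q → q ℕ.≤ L → 0ℚ ≤ X → X ≤ fromℕ (suc q) →
    X * ∣ zetaSum (2 ℕ.+ k) L - zetaSum (2 ℕ.+ k) q ∣ ≤ fromℕ 2
  zetaSum-close k (suc p) L X _ p<L 0≤X X≤ = ℚP.≤-trans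
    (*-mono 0≤X X≤2q (ℚP.0≤∣p∣ (zetaSum (2 ℕ.+ k) L - zetaSum (2 ℕ.+ k) (suc p))) (∣-∣≤ upper lower))
    (ℚP.≤-reflexive (trans (ℚP.*-assoc (fromℕ 2) (fromℕ (suc p)) (unit p))
      (trans (cong (fromℕ 2 *_) (*-recip (0<fromℕ p))) (ℚP.*-identityʳ (fromℕ 2)))))
    where
    upper : zetaSum (2 ℕ.+ k) L ≤ zetaSum (2 ℕ.+ k) (suc p) + unit p
    upper = subst (λ z → zetaSum (2 ℕ.+ k) z ≤ zetaSum (2 ℕ.+ k) (suc p) + unit p) (ℕP.m∸n+n≡m p<L)
      (zeta-tail k p (L ℕ.∸ suc p))
    lower : zetaSum (2 ℕ.+ k) (suc p) ≤ zetaSum (2 ℕ.+ k) L + unit p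
    lower = ℚP.≤-trans (subst (λ z → zetaSum (2 ℕ.+ k) (suc p) ≤ zetaSum (2 ℕ.+ k) z) (ℕP.m∸n+n≡m p<L)
        (zeta-mono (2 ℕ.+ k) (suc p) (L ℕ.∸ suc p)))
      (≤-by (unit p) (<⇒≤ (0<unit p)) refl)
    X≤2q : X ≤ fromℕ 2 * fromℕ (suc p)
    X≤2q = ℚP.≤-trans X≤ (subst (fromℕ (suc (suc p)) ≤_) (fromℕ-* 2 (suc p))
      (fromℕ-mono (ℕP.≤-trans (ℕ.s≤s (ℕP.m≤n+m (suc p) p))
        (ℕP.≤-reflexive (cong (suc p ℕ.+_) (sym (ℕP.+-identityʳ (suc p))))))))

  -- Summing the error over all d ≤ D.

  module _ (k : ℕ) (m : Vec ℕ (2 ℕ.+ k)) (D′ : ℕ) (m≤D : All (ℕ._≤ suc D′) m) (L : ℕ) (D≤L : suc D′ ℕ.≤ L) where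

    private
      D : ℕ
      D = suc D′

      P ζL c : ℚ
      P  = ∏ (Vec.map fromℕ m)
      ζL = zetaSum (2 ℕ.+ k) L
      -- The bound 2 for `ζL` times the factor `2 + k` from `∏-close`, plus 2 from the tail of ζ.
      c  = fromℕ 2 * (fromℕ (2 ℕ.+ k) + 1ℚ)

      module Term (j : ℕ) (j<D : j ℕ.< D) where

        u X : ℚ
        u = unit j
        X = fromℕ D * u

        0<X : 0ℚ < X
        0<X = 0<* (0<fromℕ D′) (0<unit j)

        quotients : Vec ℚ (2 ℕ.+ k)
        quotients = Vec.map (λ i → fromℕ (i ℕ./ suc j)) m

        q : ℕ
        q = D ℕ./ suc j

        scaled≤X : ∀ {n} (m : Vec ℕ n) → All (ℕ._≤ D) m → All (λ a → ∣ a ∣ ≤ X) (Vec.map (λ i → fromℕ i * u) m)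
        scaled≤X []       []       = []
        scaled≤X (i ∷ is) (p ∷ ps) = subst (_≤ X) (sym (ℚP.0≤p⇒∣p∣≡p (0≤* (0≤fromℕ i) (<⇒≤ (0<unit j)))))
          (*-monoʳ (<⇒≤ (0<unit j)) (fromℕ-mono p)) ∷ scaled≤X is ps

        quotients≤X : ∀ {n} (m : Vec ℕ n) → All (ℕ._≤ D) m → All (λ a → ∣ a ∣ ≤ X) (Vec.map (λ i → fromℕ (i ℕ./ suc j)) m)
        quotients≤X []       []       = []
        quotients≤X (i ∷ is) (p ∷ ps) = subst (_≤ X) (sym (∣fromℕ∣ (i ℕ./ suc j)))
          (ℚP.≤-trans (quotient≤ i j) (*-monoʳ (<⇒≤ (0<unit j)) (fromℕ-mono p))) ∷ quotients≤X is ps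

        close : ∀ {n} (m : Vec ℕ n) →
          Pointwise (λ a b → ∣ a - b ∣ ≤ 1ℚ) (Vec.map (λ i → fromℕ (i ℕ./ suc j)) m) (Vec.map (λ i → fromℕ i * u) m)
        close []       = []
        close (i ∷ is) = quotient-close i j ∷ close is

        ∏-quotients : X * ∣ ∏ quotients - P * u ^ (2 ℕ.+ k) ∣ ≤ fromℕ (2 ℕ.+ k) * X ^ (2 ℕ.+ k)
        ∏-quotients = subst₂ _≤_
          (cong (λ z → X * ∣ ∏ quotients - z ∣) (∏-scale m u))
          (cong (fromℕ (2 ℕ.+ k) *_) (ℚP.*-identityˡ (X ^ (2 ℕ.+ k))))
          (∏-close (<⇒≤ 0<X) (close m) (quotients≤X m m≤D) (scaled≤X m m≤D))

        tail : X * ∣ ζL - zetaSum (2 ℕ.+ k) q ∣ ≤ fromℕ 2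
        tail = zetaSum-close k q L X (DivMod.m≥n⇒m/n>0 {D} {suc j} j<D) (ℕP.≤-trans (DivMod.m/n≤m D (suc j)) D≤L)
          (<⇒≤ 0<X) (≤1+quotient D j)

        -- With d = j + 1, the coefficient of μ(d) in ∣Q∣ `ζL` - P once P has been multiplied by the
        -- sum in `μ-zeta`.
        T : ℚ
        T = ζL * ∏ quotients - P * (u ^ (2 ℕ.+ k) * zetaSum (2 ℕ.+ k) q)

        ∣P∣u : ∣ P * u ^ (2 ℕ.+ k) ∣ ≤ X ^ (2 ℕ.+ k)
        ∣P∣u = subst (λ z → ∣ z ∣ ≤ X ^ (2 ℕ.+ k)) (∏-scale m u) (∏-bound (scaled≤X m m≤D))

        scaled-bound : X * ∣ T ∣ ≤ X * (c * (fromℕ D ^ (1 ℕ.+ k) * u ^ (1 ℕ.+ k)))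
        scaled-bound = begin
          X * ∣ T ∣
            ≡⟨ cong (λ z → X * ∣ z ∣) (split ζL (zetaSum (2 ℕ.+ k) q) (∏ quotients) P (u ^ (2 ℕ.+ k))) ⟩
          X * ∣ ζL * A + B * (P * u ^ (2 ℕ.+ k)) ∣
            ≤⟨ *-monoˡ (<⇒≤ 0<X) (∣+∣≤ {ζL * A} {B * (P * u ^ (2 ℕ.+ k))}
                 (∣*∣≤ {ζL} {A} (subst (_≤ fromℕ 2) (sym (ℚP.0≤p⇒∣p∣≡p (0≤zetaSum (2 ℕ.+ k) L))) (zetaSum≤2 k L)) ℚP.≤-refl)
                 (∣*∣≤ {B} {P * u ^ (2 ℕ.+ k)} ℚP.≤-refl ∣P∣u)) ⟩
          X * (fromℕ 2 * ∣ A ∣ + ∣ B ∣ * X ^ (2 ℕ.+ k))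
            ≡⟨ regroup X (fromℕ 2) ∣ A ∣ ∣ B ∣ (X ^ (2 ℕ.+ k)) ⟩
          fromℕ 2 * (X * ∣ A ∣) + (X * ∣ B ∣) * X ^ (2 ℕ.+ k)
            ≤⟨ ℚP.+-mono-≤ (*-monoˡ (0≤fromℕ 2) ∏-quotients) (*-monoʳ (0≤^ (2 ℕ.+ k) (<⇒≤ 0<X)) tail) ⟩
          fromℕ 2 * (fromℕ (2 ℕ.+ k) * X ^ (2 ℕ.+ k)) + fromℕ 2 * X ^ (2 ℕ.+ k)
            ≡⟨ collect (fromℕ 2) (fromℕ (2 ℕ.+ k)) X (X ^ (1 ℕ.+ k)) ⟩
          X * (c * X ^ (1 ℕ.+ k))
            ≡⟨ cong (λ z → X * (c * z)) (^-distrib-* (fromℕ D) u (1 ℕ.+ k)) ⟩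
          X * (c * (fromℕ D ^ (1 ℕ.+ k) * u ^ (1 ℕ.+ k))) ∎
          where
          open ℚP.≤-Reasoning
          A B : ℚ
          A = ∏ quotients - P * u ^ (2 ℕ.+ k)
          B = ζL - zetaSum (2 ℕ.+ k) q
          split : ∀ z w a p v → z * a - p * (v * w) ≡ z * (a - p * v) + (z - w) * (p * v)
          split = solve-∀ ℚ-ring
          regroup : ∀ X t a b y → X * (t * a + b * y) ≡ t * (X * a) + (X * b) * y
          regroup = solve-∀ ℚ-ring
          collect : ∀ t n X y → t * (n * (X * y)) + t * (X * y) ≡ X * ((t * (n + 1ℚ)) * y)
          collect = solve-∀ ℚ-ring

        bound : ∣ T ∣ ≤ c * (fromℕ D ^ (1 ℕ.+ k) * u ^ (1 ℕ.+ k))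
        bound = *-cancelˡ 0<X scaled-bound

    -- Writing P as P times the sum in `μ-zeta` gives both terms the weights μ(d), so they can be
    -- compared for each d with ∣μ∣ ≤ 1. The bound is free of L, hence valid at every late index of
    -- the sequence that defines ζ.
    coprime-estimate : (xs : List (Vec ℕ (2 ℕ.+ k))) → Unique xs → (∀ a → a ∈ xs ⇔ CoprimeInBox m a) →
      ∣ fromℕ (length xs) * ζL - P ∣ ≤ c * (fromℕ D ^ (1 ℕ.+ k) * zetaSum (1 ℕ.+ k) D)
    coprime-estimate xs unique spec = subst₂ _≤_ (cong ∣_∣ (sym difference)) total
      (∑-abs D {λ j → μ (suc j) * T′ j} {λ j → c * (fromℕ D ^ (1 ℕ.+ k) * unit j ^ (1 ℕ.+ k))} λ j j<D →
        ℚP.≤-trans (∣*∣≤ {μ (suc j)} {T′ j} (∣μ∣≤1 (suc j)) (Term.bound j j<D)) (ℚP.≤-reflexive (ℚP.*-identityˡ _)))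
      where
      open ≡-Reasoning
      pr : ℕ → ℚ
      pr j = ∏ (Vec.map (λ i → fromℕ (i ℕ./ suc j)) m)
      s : ℕ → ℚ
      s j = unit j ^ (2 ℕ.+ k) * zetaSum (2 ℕ.+ k) (D ℕ./ suc j)
      T′ : ℕ → ℚ
      T′ j = ζL * pr j - P * s j
      total : ∑ D (λ j → c * (fromℕ D ^ (1 ℕ.+ k) * unit j ^ (1 ℕ.+ k))) ≡ c * (fromℕ D ^ (1 ℕ.+ k) * zetaSum (1 ℕ.+ k) D)
      total = trans (∑-*ˡ D c _) (cong (c *_) (∑-*ˡ D (fromℕ D ^ (1 ℕ.+ k)) _))
      step : ∀ a z p b s → (a * b) * z - p * (a * s) ≡ a * (z * b - p * s)
      step = solve-∀ ℚ-ring
      difference : fromℕ (length xs) * ζL - P ≡ ∑ D (λ j → μ (suc j) * T′ j)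
      difference = begin
        fromℕ (length xs) * ζL - P
          ≡⟨ cong₂ (λ x y → x * ζL - y) (coprime-count m D m≤D xs unique spec)
               (sym (trans (cong (P *_) (μ-zeta (2 ℕ.+ k) D′)) (ℚP.*-identityʳ P))) ⟩
        ∑ D (λ j → μ (suc j) * pr j) * ζL - P * ∑ D (λ j → μ (suc j) * s j)
          ≡⟨ cong₂ _-_ (sym (∑-*ʳ D ζL _)) (sym (∑-*ˡ D P _)) ⟩
        ∑ D (λ j → μ (suc j) * pr j * ζL) - ∑ D (λ j → P * (μ (suc j) * s j))
          ≡⟨ ∑-diff D _ _ ⟩
        ∑ D (λ j → μ (suc j) * pr j * ζL - P * (μ (suc j) * s j))
          ≡⟨ ∑-cong D (λ j → step (μ (suc j)) ζL P (pr j) (s j)) ⟩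
        ∑ D (λ j → μ (suc j) * T′ j) ∎

  -- Harmonic sums against Riemann sums of 1 / t

  ∑-split : ∀ j n f → ∑ (j ℕ.+ n) f ≡ ∑ n f + ∑ j (λ i → f (i ℕ.+ n))
  ∑-split zero    n f = sym (ℚP.+-identityʳ (∑ n f))
  ∑-split (suc j) n f = trans (cong (_+ f (j ℕ.+ n)) (∑-split j n f)) (ℚP.+-assoc (∑ n f) _ (f (j ℕ.+ n)))

  ∑-const : ∀ n c → ∑ n (λ _ → c) ≡ fromℕ n * c
  ∑-const zero    c = sym (ℚP.*-zeroˡ c)
  ∑-const (suc n) c = trans (cong (_+ c) (∑-const n c)) (step (fromℕ n) c)
    where
    step : ∀ m b → m * b + b ≡ (1ℚ + m) * b
    step = solve-∀ ℚ-ring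

  ¼ : ℚ
  ¼ = ½ * ½

  2^-suc : ∀ a → fromℕ (2 ℕ.^ suc a) ≡ fromℕ (2 ℕ.^ a) + fromℕ (2 ℕ.^ a)
  2^-suc a = trans (fromℕ-+ (2 ℕ.^ a) (2 ℕ.^ a ℕ.+ 0)) (cong (λ z → fromℕ (2 ℕ.^ a) + fromℕ z) (ℕP.+-identityʳ (2 ℕ.^ a)))

  2^-+ : ∀ a b → fromℕ (2 ℕ.^ (a ℕ.+ b)) ≡ fromℕ (2 ℕ.^ a) * fromℕ (2 ℕ.^ b)
  2^-+ a b = trans (cong fromℕ (ℕP.^-distribˡ-+-* 2 a b)) (fromℕ-* (2 ℕ.^ a) (2 ℕ.^ b))

  1≤2^ : ∀ a → 1ℚ ≤ fromℕ (2 ℕ.^ a)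
  1≤2^ a = fromℕ-mono {1} (ℕP.m^n>0 2 a)

  0<2^ : ∀ a → 0ℚ < fromℕ (2 ℕ.^ a)
  0<2^ a = ℚP.<-≤-trans 0<1 (1≤2^ a)

  4*¼ : ∀ x → fromℕ 4 * (¼ * x) ≡ x
  4*¼ x = trans (sym (ℚP.*-assoc (fromℕ 4) ¼ x)) (ℚP.*-identityˡ x)

  -- Each doubling of the number of nodes of step w contributes at least ¼ once the node 1 + 2 ^ suc a * w
  -- lies beyond 2.
  module Doubling (f : ℚ → ℚ) (lower : ∀ t T (0<T : 0ℚ < T) → 1ℚ ≤ t → t ≤ T → recip T 0<T ≤ f t)
    (w : ℚ) (0≤w : 0ℚ ≤ w) where

    S : ℕ → ℚ
    S a = w * ∑ (2 ℕ.^ a) (λ i → f (1ℚ + fromℕ (suc i) * w))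

    node≤ : ∀ a i → i ℕ.< 2 ℕ.^ a → 1ℚ + fromℕ (suc i) * w ≤ 1ℚ + fromℕ (2 ℕ.^ a) * w
    node≤ a i i< = ℚP.+-monoʳ-≤ 1ℚ (*-monoʳ 0≤w (fromℕ-mono i<))

    1≤node : ∀ n → 1ℚ ≤ 1ℚ + fromℕ n * w
    1≤node n = ≤-by (fromℕ n * w) (0≤* (0≤fromℕ n) 0≤w) refl

    0<node : ∀ n → 0ℚ < 1ℚ + fromℕ n * w
    0<node n = ℚP.<-≤-trans 0<1 (1≤node n)

    S-step : ∀ a → 1ℚ ≤ fromℕ (2 ℕ.^ suc a) * w → S a + ¼ ≤ S (suc a)
    S-step a 1≤Y = begin
      S a + ¼
        ≤⟨ ℚP.+-monoʳ-≤ (S a) quarter ⟩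
      S a + w * (N * recip T 0<T)
        ≡⟨ ℚP.*-distribˡ-+ w (∑ (2 ℕ.^ a) g) (N * recip T 0<T) ⟨
      w * (∑ (2 ℕ.^ a) g + N * recip T 0<T)
        ≤⟨ *-monoˡ 0≤w (ℚP.+-monoʳ-≤ (∑ (2 ℕ.^ a) g) upper-half) ⟩
      w * (∑ (2 ℕ.^ a) g + ∑ (2 ℕ.^ a) (λ i → g (i ℕ.+ 2 ℕ.^ a)))
        ≡⟨ cong (w *_) (∑-split (2 ℕ.^ a) (2 ℕ.^ a) g) ⟨
      w * ∑ (2 ℕ.^ a ℕ.+ 2 ℕ.^ a) g
        ≡⟨ cong (λ z → w * ∑ (2 ℕ.^ a ℕ.+ z) g) (ℕP.+-identityʳ (2 ℕ.^ a)) ⟨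
      S (suc a) ∎
      where
      open ℚP.≤-Reasoning
      N Y T : ℚ
      N = fromℕ (2 ℕ.^ a)
      Y = fromℕ (2 ℕ.^ suc a) * w
      T = 1ℚ + Y
      0<T : 0ℚ < T
      0<T = 0<node (2 ℕ.^ suc a)
      g : ℕ → ℚ
      g i = f (1ℚ + fromℕ (suc i) * w)
      upper-half : N * recip T 0<T ≤ ∑ (2 ℕ.^ a) (λ i → g (i ℕ.+ 2 ℕ.^ a))
      upper-half = subst (_≤ ∑ (2 ℕ.^ a) (λ i → g (i ℕ.+ 2 ℕ.^ a))) (∑-const (2 ℕ.^ a) (recip T 0<T))
        (∑-mono (2 ℕ.^ a) λ i i< → lower _ T 0<T (1≤node (suc (i ℕ.+ 2 ℕ.^ a)))
          (node≤ (suc a) (i ℕ.+ 2 ℕ.^ a) (subst (i ℕ.+ 2 ℕ.^ a ℕ.<_)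
            (cong (2 ℕ.^ a ℕ.+_) (sym (ℕP.+-identityʳ (2 ℕ.^ a)))) (ℕP.+-monoˡ-< (2 ℕ.^ a) i<))))
      double-w : Y ≡ N * w + N * w
      double-w = trans (cong (_* w) (2^-suc a)) (ℚP.*-distribʳ-+ w N N)
      -- Here N w = Y / 2 and T = 1 + Y ≤ 2 Y, so the new nodes contribute at least (Y / 2) / (2 Y).
      quarter : ¼ ≤ w * (N * recip T 0<T)
      quarter = begin
        ¼                               ≡⟨ *-recip-* 0<T ¼ ⟨
        T * (¼ * recip T 0<T)           ≤⟨ *-monoʳ (0≤* (<⇒≤ (0<* 0<½ 0<½)) (<⇒≤ (0<recip 0<T)))
                                             (ℚP.+-monoˡ-≤ Y 1≤Y) ⟩
        (Y + Y) * (¼ * recip T 0<T)     ≡⟨ cong (λ z → (z + z) * (¼ * recip T 0<T)) double-w ⟩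
        (N * w + N * w + (N * w + N * w)) * (¼ * recip T 0<T)
                                        ≡⟨ regroup N w ¼ (recip T 0<T) ⟩
        (¼ + ¼ + (¼ + ¼)) * (w * (N * recip T 0<T))
                                        ≡⟨ ℚP.*-identityˡ (w * (N * recip T 0<T)) ⟩
        w * (N * recip T 0<T)           ∎
        where
        regroup : ∀ n w c r → (n * w + n * w + (n * w + n * w)) * (c * r) ≡ (c + c + (c + c)) * (w * (n * r))
        regroup = solve-∀ ℚ-ring

    0≤S : ∀ a → 0ℚ ≤ S a
    0≤S a = 0≤* 0≤w (subst (_≤ ∑ (2 ℕ.^ a) (λ i → f (1ℚ + fromℕ (suc i) * w))) (∑-0 (2 ℕ.^ a))
      (∑-mono (2 ℕ.^ a) λ i _ → ℚP.≤-trans (<⇒≤ (0<recip (0<node (suc i))))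
        (lower _ _ (0<node (suc i)) (1≤node (suc i)) ℚP.≤-refl)))

    S-lower : ∀ a j → 1ℚ ≤ fromℕ (2 ℕ.^ suc a) * w → fromℕ j * ¼ ≤ S (j ℕ.+ a)
    S-lower a zero    _   = subst (_≤ S a) (sym (ℚP.*-zeroˡ ¼)) (0≤S a)
    S-lower a (suc j) 1≤Y = ℚP.≤-trans
      (ℚP.≤-trans (ℚP.≤-reflexive (step (fromℕ j) ¼)) (ℚP.+-monoˡ-≤ ¼ (S-lower a j 1≤Y)))
      (S-step (j ℕ.+ a) (ℚP.≤-trans 1≤Y (*-monoʳ 0≤w
        (fromℕ-mono (ℕP.^-monoʳ-≤ 2 (ℕ.s≤s (ℕP.m≤n+m a j)))))))
      where
      step : ∀ m c → (1ℚ + m) * c ≡ m * c + c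
      step = solve-∀ ℚ-ring

  -- This stands for ln (1 + h) ≥ (J + 1) / 4 when h ≥ 2ᴶ. The hypothesis on f is the monotone bound
  -- f t ≥ 1 / T on [1 , T], which the truncated integrand of `ln` satisfies as long as it is
  -- truncated at or below 1.
  riemann-lower : (f : ℚ → ℚ) → (∀ t T (0<T : 0ℚ < T) → 1ℚ ≤ t → t ≤ T → recip T 0<T ≤ f t) →
    ∀ J n h → J ℕ.< n → fromℕ (2 ℕ.^ J) ≤ h → fromℕ (suc J) * ¼ ≤ riemann f 1ℚ n h
  riemann-lower f lower J n h J<n 2^J≤h =
    subst (λ z → fromℕ (suc J) * ¼ ≤ riemann f 1ℚ z h) n≡ (Doubling.S-lower f lower w (<⇒≤ 0<w) a (suc J) 1≤Y)
    where
    a : ℕ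
    -- With 2ⁿ nodes of step h / 2ⁿ, the node number 2ᵃ⁺¹ lies at 1 + h / 2ᴶ ≥ 2, and J + 1
    -- doublings lead from 2ᵃ to 2ⁿ.
    a = n ℕ.∸ suc J
    n≡ : suc J ℕ.+ a ≡ n
    n≡ = ℕP.m+[n∸m]≡n J<n
    w : ℚ
    w = h * ½ ^ (suc J ℕ.+ a)
    0<w : 0ℚ < w
    0<w = 0<* (ℚP.<-≤-trans (0<2^ J) 2^J≤h) (0<½^ (suc J ℕ.+ a))
    Y : ℚ
    Y = fromℕ (2 ℕ.^ suc a) * w
    2^J*Y : fromℕ (2 ℕ.^ J) * Y ≡ h
    2^J*Y = trans (assoc (fromℕ (2 ℕ.^ J)) (fromℕ (2 ℕ.^ suc a)) h (½ ^ (suc J ℕ.+ a)))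
      (trans (cong (λ z → h * (z * ½ ^ (suc J ℕ.+ a)))
          (trans (sym (2^-+ J (suc a))) (cong (λ z → fromℕ (2 ℕ.^ z)) (ℕP.+-suc J a))))
        (trans (cong (h *_) (2^½^ (suc J ℕ.+ a))) (ℚP.*-identityʳ h)))
      where
      assoc : ∀ x y h u → x * (y * (h * u)) ≡ h * ((x * y) * u)
      assoc = solve-∀ ℚ-ring
    1≤Y : 1ℚ ≤ Y
    1≤Y = *-cancelˡ (0<2^ J) (subst₂ _≤_ (sym (ℚP.*-identityʳ (fromℕ (2 ℕ.^ J)))) (sym 2^J*Y) 2^J≤h)

  -- Dyadic blocks: the N terms after the first N = 2ᴶ are all at most 1 / (N + 1), so each doubling
  -- adds at most 1.
  harmonic≤ : ∀ J → zetaSum 1 (2 ℕ.^ J) ≤ fromℕ (suc J)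
  harmonic≤ zero    = ℚP.≤-refl
  harmonic≤ (suc J) = begin
    zetaSum 1 (2 ℕ.^ suc J)
      ≡⟨ cong (λ z → zetaSum 1 (N ℕ.+ z)) (ℕP.+-identityʳ N) ⟩
    zetaSum 1 (N ℕ.+ N)
      ≡⟨ ∑-split N N (λ j → unit j ^ 1) ⟩
    zetaSum 1 N + ∑ N (λ i → unit (i ℕ.+ N) ^ 1)
      ≤⟨ ℚP.+-mono-≤ (harmonic≤ J) block ⟩
    fromℕ (suc J) + 1ℚ
      ≡⟨ ℚP.+-comm (fromℕ (suc J)) 1ℚ ⟩
    fromℕ (suc (suc J)) ∎
    where
    open ℚP.≤-Reasoning
    N : ℕ
    N = 2 ℕ.^ J
    block : ∑ N (λ i → unit (i ℕ.+ N) ^ 1) ≤ 1ℚ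
    block = ℚP.≤-trans
      (subst (∑ N (λ i → unit (i ℕ.+ N) ^ 1) ≤_) (∑-const N (unit N))
        (∑-mono N λ i _ → ℚP.≤-trans (ℚP.≤-reflexive (ℚP.*-identityʳ (unit (i ℕ.+ N)))) (unit-anti (ℕP.m≤n+m N i))))
      (subst (fromℕ N * unit N ≤_) (*-recip (0<fromℕ N)) (*-monoʳ (<⇒≤ (0<unit N)) (<⇒≤ (n<1+n N))))

  zetaSum-monoʳ : ∀ k {m n} → m ℕ.≤ n → zetaSum k m ≤ zetaSum k n
  zetaSum-monoʳ k {m} {n} m≤n = subst (λ z → zetaSum k m ≤ zetaSum k z) (ℕP.m∸n+n≡m m≤n) (zeta-mono k m (n ℕ.∸ m))

  -- A downward search from J = D, where the bound certainly holds, to the least J. Minimality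
  -- provides the lower bound on D, and J ≤ D is kept so that an index N > D has enough subdivisions
  -- for `riemann-lower`.
  log₂-bracket : ∀ D e → Σ[ J ∈ ℕ ] (J ℕ.≤ D × D ℕ.≤ 2 ℕ.^ (J ℕ.+ e) ×
    (J ≡ 0 ⊎ Σ[ I ∈ ℕ ] (J ≡ suc I × 2 ℕ.^ (I ℕ.+ e) ℕ.< D)))
  log₂-bracket D e = search D ℕP.≤-refl
    (ℕP.≤-trans (ℕP.n≤1+n D) (ℕP.≤-trans (n<2^n D) (ℕP.^-monoʳ-≤ 2 (ℕP.m≤m+n D e))))
    where
    search : ∀ J → J ℕ.≤ D → D ℕ.≤ 2 ℕ.^ (J ℕ.+ e) → Σ[ J ∈ ℕ ] (J ℕ.≤ D × D ℕ.≤ 2 ℕ.^ (J ℕ.+ e) ×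
      (J ≡ 0 ⊎ Σ[ I ∈ ℕ ] (J ≡ suc I × 2 ℕ.^ (I ℕ.+ e) ℕ.< D)))
    search zero    J≤D D≤ = zero , J≤D , D≤ , inj₁ refl
    search (suc J) J≤D D≤ with D ℕ.≤? 2 ℕ.^ (J ℕ.+ e)
    ... | yes D≤′ = search J (ℕP.≤-trans (ℕP.n≤1+n J) J≤D) D≤′
    ... | no D≰   = suc J , J≤D , D≤ , inj₂ (J , refl , ℕP.≰⇒> D≰)

  harmonic≤riemann : (f : ℚ → ℚ) → (∀ t T (0<T : 0ℚ < T) → 1ℚ ≤ t → t ≤ T → recip T 0<T ≤ f t) →
    ∀ D e n γ → D ℕ.< n → fromℕ 2 ≤ γ → fromℕ D ≤ fromℕ (2 ℕ.^ e) * γ →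
    1ℚ ≤ fromℕ 4 * riemann f 1ℚ n (γ - 1ℚ) ×
    zetaSum 1 D ≤ fromℕ (3 ℕ.+ e) * (fromℕ 4 * riemann f 1ℚ n (γ - 1ℚ))
  -- The bracket uses e + 1 rather than e: for J = I + 1 this gives 2ᴵ⁺¹ ≤ γ, and the spare factor 2
  -- pays for passing from γ to γ - 1 ≥ 2ᴵ.
  harmonic≤riemann f lower D e n γ D<n 2≤γ D≤ with log₂-bracket D (suc e)
  ... | J , J≤D , D≤2^ , alternatives = 1≤4l , (begin
    zetaSum 1 D
      ≤⟨ zetaSum-monoʳ 1 D≤2^ ⟩
    zetaSum 1 (2 ℕ.^ (J ℕ.+ suc e))
      ≤⟨ harmonic≤ (J ℕ.+ suc e) ⟩
    fromℕ (suc (J ℕ.+ suc e))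
      ≡⟨ trans (cong fromℕ (sym (ℕP.+-suc J (suc e)))) (fromℕ-+ J (2 ℕ.+ e)) ⟩
    fromℕ J + fromℕ (2 ℕ.+ e)
      ≤⟨ ℚP.+-mono-≤ (J≤4l alternatives) (subst (_≤ fromℕ (2 ℕ.+ e) * (fromℕ 4 * l)) (ℚP.*-identityʳ (fromℕ (2 ℕ.+ e)))
           (*-monoˡ (0≤fromℕ (2 ℕ.+ e)) 1≤4l)) ⟩
    fromℕ 4 * l + fromℕ (2 ℕ.+ e) * (fromℕ 4 * l)
      ≡⟨ collect (fromℕ 4 * l) (fromℕ (2 ℕ.+ e)) ⟩
    fromℕ (3 ℕ.+ e) * (fromℕ 4 * l) ∎)
    where
    open ℚP.≤-Reasoning
    l : ℚ
    l = riemann f 1ℚ n (γ - 1ℚ)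
    collect : ∀ x c → x + c * x ≡ (1ℚ + c) * x
    collect = solve-∀ ℚ-ring
    quadruple : ∀ {c} → c * ¼ ≤ l → c ≤ fromℕ 4 * l
    quadruple {c} h = subst (_≤ fromℕ 4 * l) (trans (cong (fromℕ 4 *_) (ℚP.*-comm c ¼)) (4*¼ c)) (*-monoˡ (0≤fromℕ 4) h)
    minus-one : ∀ {a} → a + 1ℚ ≤ γ → a ≤ γ - 1ℚ
    minus-one {a} h = subst (_≤ γ - 1ℚ) (step a) (ℚP.+-monoˡ-≤ (- 1ℚ) h)
      where
      step : ∀ a → a + 1ℚ - 1ℚ ≡ a
      step = solve-∀ ℚ-ring
    1≤4l : 1ℚ ≤ fromℕ 4 * l
    1≤4l = quadruple (riemann-lower f lower 0 n (γ - 1ℚ) (ℕP.≤-trans (ℕ.s≤s ℕ.z≤n) D<n) (minus-one 2≤γ))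
    J≤4l : (J ≡ 0 ⊎ Σ[ I ∈ ℕ ] (J ≡ suc I × 2 ℕ.^ (I ℕ.+ suc e) ℕ.< D)) → fromℕ J ≤ fromℕ 4 * l
    J≤4l (inj₁ eq) = subst (λ z → fromℕ z ≤ fromℕ 4 * l) (sym eq) (ℚP.≤-trans 0≤1 1≤4l)
    J≤4l (inj₂ (I , eq , 2^<D)) = subst (λ z → fromℕ z ≤ fromℕ 4 * l) (sym eq)
      (quadruple (riemann-lower f lower I n (γ - 1ℚ) (ℕP.≤-trans (subst (ℕ._≤ D) eq J≤D) (ℕP.<⇒≤ D<n))
      (minus-one (ℚP.≤-trans (ℚP.+-monoʳ-≤ (fromℕ (2 ℕ.^ I)) (1≤2^ I)) (subst (_≤ γ) (2^-suc I) 2^≤γ)))))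
      where
      2^≤γ : fromℕ (2 ℕ.^ suc I) ≤ γ
      2^≤γ = *-cancelˡ (0<2^ e) (ℚP.≤-trans (ℚP.≤-reflexive (trans (sym (2^-+ e (suc I)))
          (cong (λ z → fromℕ (2 ℕ.^ z)) (trans (ℕP.+-suc e I) (trans (cong suc (ℕP.+-comm e I)) (sym (ℕP.+-suc I e)))))))
        (ℚP.≤-trans (fromℕ-mono (ℕP.<⇒≤ 2^<D)) D≤))

open import Defs
open Rational using (ℚ-ring; fromℕ; recip; zetaSum)
open ℝ using (seq; cauchy)
open RationalEstimates

-- Order and floors of real numbers

map-eventually : ∀ {P Q : ℕ → Set} → (∀ n → P n → Q n) → Eventually P → Eventually Q
map-eventually g (N , h) = N , λ n N≤n → g n (h n N≤n)

from : ∀ {P : ℕ → Set} N → (∀ n → N ℕ.≤ n → P n) → Eventually P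
from N h = N , h

slack : ∀ {ε} → 0ℚ ℚ.≤ ε → ∀ p → p ℚ.≤ p ℚ.+ ε
slack {ε} 0≤ε p = R.≤-by ε 0≤ε refl

≤-of-seq : ∀ {x y} → Eventually (λ n → seq x n ℚ.≤ seq y n) → x ≤ y
≤-of-seq {x} {y} e ε 0<ε = map-eventually (λ n h → ℚP.≤-trans h (slack (ℚP.<⇒≤ 0<ε) (seq y n))) e

≤ℝ-refl : ∀ x → x ≤ x
≤ℝ-refl x = ≤-of-seq {x} {x} (from 0 λ _ _ → ℚP.≤-refl)

≤ℝ-trans : ∀ {x y z} → x ≤ y → y ≤ z → x ≤ z
≤ℝ-trans {x} {y} {z} x≤y y≤z ε 0<ε = map-eventually
  (λ n (p , q) → ℚP.≤-trans p (subst (seq y n ℚ.+ ½ ℚ.* ε ℚ.≤_) (step (seq z n) ε)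
    (ℚP.+-monoˡ-≤ (½ ℚ.* ε) q)))
  (both (x≤y (½ ℚ.* ε) (half 0<ε)) (y≤z (½ ℚ.* ε) (half 0<ε)))
  where
  step : ∀ z ε → z ℚ.+ ½ ℚ.* ε ℚ.+ ½ ℚ.* ε ≡ z ℚ.+ ε
  step = solve-∀ ℚ-ring

<-≤-absurd : ∀ {x y} → x < y → ¬ (y ≤ x)
<-≤-absurd {x} {y} (δ , 0<δ , e) y≤x with both e (y≤x (½ ℚ.* δ) (half 0<δ))
... | N , h = ℚP.<-irrefl refl (ℚP.<-≤-trans 0<half-δ half-δ≤0)
  where
  0<half-δ = half 0<δ
  a = seq x N
  step₁ : ∀ a δ → a ℚ.+ δ ℚ.- (a ℚ.+ ½ ℚ.* δ) ≡ ½ ℚ.* δ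
  step₁ = solve-∀ ℚ-ring
  step₂ : ∀ a δ → a ℚ.+ ½ ℚ.* δ ℚ.- (a ℚ.+ ½ ℚ.* δ) ≡ 0ℚ
  step₂ a δ = ℚP.+-inverseʳ (a ℚ.+ ½ ℚ.* δ)
  half-δ≤0 : ½ ℚ.* δ ℚ.≤ 0ℚ
  half-δ≤0 = let (p , q) = h N ℕP.≤-refl in subst₂ ℚ._≤_ (step₁ a δ) (step₂ a δ)
    (ℚP.+-monoˡ-≤ (ℚ.- (a ℚ.+ ½ ℚ.* δ)) (ℚP.≤-trans p q))

-- The order on ℝ is not decidable, but one rational comparison at an index where both sequences
-- have settled to within ε / 8 decides this weaker alternative: the remaining drift of ε / 4 fits
-- the ε of the first case and leaves a gap ε / 4 in the second.
≤-or-> : ∀ x y ε → 0ℚ ℚ.< ε → Eventually (λ n → seq x n ℚ.≤ seq y n ℚ.+ ε) ⊎ (y < x)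
≤-or-> x y ε 0<ε with cauchy x (½ ℚ.* (½ ℚ.* (½ ℚ.* ε))) (half (half (half 0<ε)))
  | cauchy y (½ ℚ.* (½ ℚ.* (½ ℚ.* ε))) (half (half (half 0<ε)))
... | M , p | N , q with seq x (M ℕ.⊔ N) ℚP.≤? seq y (M ℕ.⊔ N) ℚ.+ ½ ℚ.* ε
... | yes h = inj₁ (M ℕ.⊔ N , λ n K≤n → begin
  seq x n
    ≤⟨ R.∣-∣≤⇒ {seq x n} {seq x K} (p n K (ℕP.≤-trans (ℕP.m≤m⊔n M N) K≤n) (ℕP.m≤m⊔n M N)) ⟩
  seq x K ℚ.+ η
    ≤⟨ ℚP.+-monoˡ-≤ η (ℚP.≤-trans h (ℚP.+-monoˡ-≤ (½ ℚ.* ε)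
         (R.∣-∣≤⇒ {seq y K} {seq y n} (q K n (ℕP.m≤n⊔m M N) (ℕP.≤-trans (ℕP.m≤n⊔m M N) K≤n))))) ⟩
  seq y n ℚ.+ η ℚ.+ ½ ℚ.* ε ℚ.+ η
    ≤⟨ slack (ℚP.<⇒≤ (half (half 0<ε))) _ ⟩
  seq y n ℚ.+ η ℚ.+ ½ ℚ.* ε ℚ.+ η ℚ.+ ½ ℚ.* (½ ℚ.* ε)
    ≡⟨ step (seq y n) ε ⟩
  seq y n ℚ.+ ε ∎)
  where
  open ℚP.≤-Reasoning
  K = M ℕ.⊔ N
  η = ½ ℚ.* (½ ℚ.* (½ ℚ.* ε))
  step : ∀ a ε → a ℚ.+ ½ ℚ.* (½ ℚ.* (½ ℚ.* ε)) ℚ.+ ½ ℚ.* ε ℚ.+ ½ ℚ.* (½ ℚ.* (½ ℚ.* ε)) ℚ.+ ½ ℚ.* (½ ℚ.* ε) ≡ a ℚ.+ ε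
  step = solve-∀ ℚ-ring
... | no h = inj₂ (½ ℚ.* (½ ℚ.* ε) , half (half 0<ε) , M ℕ.⊔ N , λ n K≤n → begin
  seq y n ℚ.+ ½ ℚ.* (½ ℚ.* ε)
    ≤⟨ ℚP.+-monoˡ-≤ (½ ℚ.* (½ ℚ.* ε)) (R.∣-∣≤⇒ {seq y n} {seq y K} (q n K (ℕP.≤-trans (ℕP.m≤n⊔m M N) K≤n) (ℕP.m≤n⊔m M N))) ⟩
  seq y K ℚ.+ η ℚ.+ ½ ℚ.* (½ ℚ.* ε)
    ≡⟨ step (seq y K) ε ⟩
  seq y K ℚ.+ ½ ℚ.* ε ℚ.- η
    ≤⟨ ℚP.+-monoˡ-≤ (ℚ.- η) (ℚP.≤-trans (ℚP.<⇒≤ (ℚP.≰⇒> h))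
         (R.∣-∣≤⇒ {seq x K} {seq x n} (p K n (ℕP.m≤m⊔n M N) (ℕP.≤-trans (ℕP.m≤m⊔n M N) K≤n)))) ⟩
  seq x n ℚ.+ η ℚ.- η
    ≡⟨ step₂ (seq x n) η ⟩
  seq x n ∎)
  where
  open ℚP.≤-Reasoning
  K = M ℕ.⊔ N
  η = ½ ℚ.* (½ ℚ.* (½ ℚ.* ε))
  step : ∀ a ε → a ℚ.+ ½ ℚ.* (½ ℚ.* (½ ℚ.* ε)) ℚ.+ ½ ℚ.* (½ ℚ.* ε) ≡ a ℚ.+ ½ ℚ.* ε ℚ.- ½ ℚ.* (½ ℚ.* (½ ℚ.* ε))
  step = solve-∀ ℚ-ring
  step₂ : ∀ a η → a ℚ.+ η ℚ.- η ≡ a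
  step₂ = solve-∀ ℚ-ring

≤-stable : ∀ {x y} → ¬ ¬ (x ≤ y) → x ≤ y
≤-stable {x} {y} ¬¬x≤y ε 0<ε = decide (≤-or-> x y ε 0<ε)
  where
  Goal : Set
  Goal = Eventually (λ n → seq x n ℚ.≤ seq y n ℚ.+ ε)
  decide : Goal ⊎ (y < x) → Goal
  decide (inj₁ e)   = e
  decide (inj₂ y<x) = contradiction (<-≤-absurd {y} {x} y<x) ¬¬x≤y

≰⇒≥ : ∀ {x y} → ¬ (x ≤ y) → y ≤ x
≰⇒≥ {x} {y} x≰y ε 0<ε = decide (≤-or-> y x ε 0<ε)
  where
  Goal : Set
  Goal = Eventually (λ n → seq y n ℚ.≤ seq x n ℚ.+ ε)
  decide : Goal ⊎ (x < y) → Goal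
  decide (inj₁ e) = e
  decide (inj₂ (δ , 0<δ , e)) = contradiction
    (≤-of-seq {x} {y} (map-eventually (λ n h → ℚP.≤-trans (slack (ℚP.<⇒≤ 0<δ) (seq x n)) h) e)) x≰y

fromℕ-cancel : ∀ {a b} → fromℕ a ℚ.≤ fromℕ b → a ℕ.≤ b
fromℕ-cancel {a} {b} h with a ℕP.≤? b
... | yes a≤b = a≤b
... | no  a≰b = contradiction (ℚP.<-≤-trans (R.n<1+n b) (ℚP.≤-trans (R.fromℕ-mono (ℕP.≰⇒> a≰b)) h))
                              (ℚP.<-irrefl refl)

bounding-ℕ : ∀ q → 0ℚ ℚ.≤ q → Σ[ e ∈ ℕ ] (q ℚ.≤ fromℕ (2 ℕ.^ e))
bounding-ℕ q 0≤q = e , ℚP.≤-trans (R.q≤num q 0≤q) (R.fromℕ-mono (ℕP.≤-trans (ℕP.n≤1+n e) (R.n<2^n e)))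
  where e = ℤ.∣ ℚ.↥ q ∣

-- Refuting m + 1 ≤ x yields only the non-strict `≤1+floor`, so maximality is recorded separately in
-- `greatest`; that is the field which identifies the points of Q with those of an integral box.
record IsFloor (x : ℝ) (m : ℕ) : Set where
  field
    floor≤   : fromℚ (fromℕ m) ≤ x
    ≤1+floor : x ≤ fromℚ (fromℕ (suc m))
    greatest : ∀ a → fromℚ (fromℕ a) ≤ x → a ℕ.≤ m

-- A finite descent from an integer bound for x. Each step decides one real inequality, which is
-- harmless under the double negation.
floor-exists : ∀ x → 0ℝ ≤ x → ¬ ¬ (Σ[ m ∈ ℕ ] IsFloor x m)
floor-exists x 0≤x = search ⌈x⌉ λ a a≤x → fromℕ-cancel (ℚP.≤-trans (≤bound a a≤x) (R.q≤num B 0≤B))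
  where
  B : ℚ
  B = boundOf x ℚ.+ 1ℚ
  0≤B : 0ℚ ℚ.≤ B
  0≤B = R.0≤+ (ℚP.<⇒≤ (0<boundOf x)) R.0≤1
  ⌈x⌉ : ℕ
  ⌈x⌉ = ℤ.∣ ℚ.↥ B ∣
  ≤bound : ∀ a → fromℚ (fromℕ a) ≤ x → fromℕ a ℚ.≤ B
  ≤bound a a≤x = let (N , h) = both (a≤x 1ℚ R.0<1) (eventuallyBounded x)
                     (p , q) = h N ℕP.≤-refl
                 in ℚP.≤-trans p (ℚP.+-monoˡ-≤ 1ℚ (ℚP.≤-trans (R.p≤∣p∣ (seq x N)) q))
  Result : Set
  Result = ¬ ¬ (Σ[ m ∈ ℕ ] IsFloor x m)
  below : ∀ {a b} → ¬ (fromℚ (fromℕ (suc b)) ≤ x) → a ℕ.< suc b ⊎ a ≡ suc b → fromℚ (fromℕ a) ≤ x → a ℕ.≤ b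
  below _   (inj₁ a<)   _   = ℕP.≤-pred a<
  below b≰x (inj₂ refl) a≤x = contradiction a≤x b≰x
  found : ∀ b → (∀ a → fromℚ (fromℕ a) ≤ x → a ℕ.≤ b) → fromℚ (fromℕ b) ≤ x → Result
  found b bound b≤x none = none (b , record
    { floor≤ = b≤x
    ; ≤1+floor = ≰⇒≥ {fromℚ (fromℕ (suc b))} {x} (λ h → ℕP.<-irrefl refl (bound (suc b) h))
    ; greatest = bound })
  search : ∀ b → (∀ a → fromℚ (fromℕ a) ≤ x → a ℕ.≤ b) → Result
  search zero    bound = found zero bound 0≤x
  search (suc b) bound none = ¬¬-excluded-middle λ where
    (yes b≤x) → found (suc b) bound b≤x none
    (no b≰x)  → search b (λ a a≤x → below b≰x (ℕP.m≤n⇒m<n∨m≡n (bound a a≤x)) a≤x) none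

-- The counting estimate along the approximating sequences

max-upper : ∀ {k} (n : Vec ℝ (suc k)) N → All (λ x → seq x N ℚ.≤ seq (maximum n) N) n
max-upper (x ∷ [])        N = ℚP.≤-refl ∷ []
max-upper (x ∷ n@(_ ∷ _)) N = ℚP.p≤p⊔q (seq x N) (seq (maximum n) N) ∷
  All.map (λ h → ℚP.≤-trans h (ℚP.p≤q⊔p (seq x N) (seq (maximum n) N))) (max-upper n N)

neg-involutive : ∀ q → ℚ.- ℚ.- q ≡ q
neg-involutive = solve-∀ ℚ-ring

⊓-seq≤ˡ : ∀ x y N → seq (x ⊓ y) N ℚ.≤ seq x N
⊓-seq≤ˡ x y N = subst (seq (x ⊓ y) N ℚ.≤_) (neg-involutive (seq x N))
  (ℚP.neg-antimono-≤ (ℚP.p≤p⊔q (ℚ.- seq x N) (ℚ.- seq y N)))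

⊓-seq≤ʳ : ∀ x y N → seq (x ⊓ y) N ℚ.≤ seq y N
⊓-seq≤ʳ x y N = subst (seq (x ⊓ y) N ℚ.≤_) (neg-involutive (seq y N))
  (ℚP.neg-antimono-≤ (ℚP.p≤q⊔p (ℚ.- seq x N) (ℚ.- seq y N)))

min-lower : ∀ {k} (n : Vec ℝ (suc k)) N → All (λ x → seq (minimum n) N ℚ.≤ seq x N) n
min-lower (x ∷ [])        N = ℚP.≤-refl ∷ []
min-lower (x ∷ n@(_ ∷ _)) N = ⊓-seq≤ˡ x (minimum n) N ∷
  All.map (ℚP.≤-trans (⊓-seq≤ʳ x (minimum n) N)) (min-lower n N)

product-seq : ∀ {k} (n : Vec ℝ k) N → seq (product n) N ≡ ∏ (Vec.map (λ x → seq x N) n)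
product-seq []      N = refl
product-seq (x ∷ n) N = cong (seq x N ℚ.*_) (product-seq n N)

recip-drop-⊔ : ∀ {m δ} (0<δ : 0ℚ ℚ.< m ℚ.⊔ δ) → δ ℚ.≤ m → m ℚ.* recip (m ℚ.⊔ δ) 0<δ ≡ 1ℚ
recip-drop-⊔ {m} {δ} 0<δ δ≤m = trans (cong (ℚ._* recip (m ℚ.⊔ δ) 0<δ) (sym (ℚP.p≥q⇒p⊔q≡p δ≤m))) (R.*-recip 0<δ)

-- As soon as the minimum exceeds the δ at which its inverse is truncated, the truncated inverse is
-- the true one, and the ratio condition can be multiplied out.
𝒞-comparable : ∀ {k E} {n : Vec ℝ (suc k)} → 𝒞 E n → ∀ η → 0ℚ ℚ.< η →
  Eventually (λ N → 0ℚ ℚ.≤ seq (minimum n) N × seq (maximum n) N ℚ.≤ (seq E N ℚ.+ η) ℚ.* seq (minimum n) N)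
𝒞-comparable {E = E} {n} n∈𝒞 η 0<η = compare (minimum-pos (𝒞.≥1 n∈𝒞)) (𝒞.ratio n∈𝒞)
  where
  -- The positivity proof is abstracted because the quotient depends on it; matching on it exposes
  -- δ.
  compare : (pos : 0ℝ < minimum n) → maximum n ÷ minimum n [ pos ] ≤ E → _
  compare (δ , 0<δ , e) ratio = map-eventually (λ N (δ≤ , r) → step N (drop0 δ≤) r) (both e (ratio η 0<η))
    where
    open TruncatedReciprocal δ 0<δ
    step : ∀ N → δ ℚ.≤ seq (minimum n) N → seq (maximum n) N ℚ.* 1/⊔ (seq (minimum n) N) ℚ.≤ seq E N ℚ.+ η →
      0ℚ ℚ.≤ seq (minimum n) N × seq (maximum n) N ℚ.≤ (seq E N ℚ.+ η) ℚ.* seq (minimum n) N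
    step N δ≤ r = 0≤min , subst (ℚ._≤ (seq E N ℚ.+ η) ℚ.* seq (minimum n) N)
      (trans (ℚP.*-assoc (seq (maximum n) N) _ (seq (minimum n) N))
        (trans (cong (seq (maximum n) N ℚ.*_)
            (trans (ℚP.*-comm _ (seq (minimum n) N)) (recip-drop-⊔ (0<⊔ (seq (minimum n) N)) δ≤)))
          (ℚP.*-identityʳ (seq (maximum n) N))))
      (*-monoʳ 0≤min r)
      where
      0≤min : 0ℚ ℚ.≤ seq (minimum n) N
      0≤min = ℚP.≤-trans (ℚP.<⇒≤ 0<δ) δ≤

maxℕ : ∀ {k} → Vec ℕ (suc k) → ℕ
maxℕ = Vec.foldr₁ ℕ._⊔_

≤maxℕ : ∀ {k} (m : Vec ℕ (suc k)) → All (ℕ._≤ maxℕ m) m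
≤maxℕ (a ∷ [])        = ℕP.≤-refl ∷ []
≤maxℕ (a ∷ m@(_ ∷ _)) = ℕP.m≤m⊔n a (maxℕ m) ∷ All.map (λ h → ℕP.≤-trans h (ℕP.m≤n⊔m a (maxℕ m))) (≤maxℕ m)

fromℕ-⊔ : ∀ a b {q} → fromℕ a ℚ.≤ q → fromℕ b ℚ.≤ q → fromℕ (a ℕ.⊔ b) ℚ.≤ q
fromℕ-⊔ a b {q} p p′ with ℕP.⊔-sel a b
... | inj₁ eq = subst (λ z → fromℕ z ℚ.≤ q) (sym eq) p
... | inj₂ eq = subst (λ z → fromℕ z ℚ.≤ q) (sym eq) p′

maxℕ≤max : ∀ {k c N} {n : Vec ℝ (suc k)} {m : Vec ℕ (suc k)} → Pointwise (λ x a → fromℕ a ℚ.≤ seq x N ℚ.+ c) n m →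
  fromℕ (maxℕ m) ℚ.≤ seq (maximum n) N ℚ.+ c
maxℕ≤max (p ∷ []) = p
maxℕ≤max {c = c} {N} {x ∷ n@(_ ∷ _)} {a ∷ m@(_ ∷ _)} (p ∷ ps@(_ ∷ _)) = fromℕ-⊔ a (maxℕ m)
  (ℚP.≤-trans p (ℚP.+-monoˡ-≤ c (ℚP.p≤p⊔q (seq x N) (seq (maximum n) N))))
  (ℚP.≤-trans (maxℕ≤max ps) (ℚP.+-monoˡ-≤ c (ℚP.p≤q⊔p (seq x N) (seq (maximum n) N))))

Near : ℕ → ℝ → ℕ → Set
Near N x a = fromℕ a ℚ.≤ seq x N ℚ.+ ½ × seq x N ℚ.≤ fromℕ (suc a) ℚ.+ ½

eventually-pointwise : ∀ {k} {A B : Set} {P : A → B → ℕ → Set} {x : Vec A k} {y : Vec B k} →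
  Pointwise (λ a b → Eventually (P a b)) x y → Eventually (λ N → Pointwise (λ a b → P a b N) x y)
eventually-pointwise []       = from 0 λ _ _ → []
eventually-pointwise (p ∷ ps) = map-eventually (λ _ (h , hs) → h ∷ hs) (both p (eventually-pointwise ps))

pointwise-map : ∀ {k} {A B : Set} {P Q : A → B → Set} {x : Vec A k} {y : Vec B k} →
  (∀ {a b} → P a b → Q a b) → Pointwise P x y → Pointwise Q x y
pointwise-map g []       = []
pointwise-map g (p ∷ ps) = g p ∷ pointwise-map g ps

∏-lower : ∀ {k} {n : Vec ℚ k} {y} → 0ℚ ℚ.≤ y → All (y ℚ.≤_) n → y R.^ k ℚ.≤ ∏ n
∏-lower 0≤y []               = ℚP.≤-refl
∏-lower {suc k} 0≤y (p ∷ ps) = R.*-mono 0≤y p (R.0≤^ k 0≤y) (∏-lower 0≤y ps)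

-- The approximate root is rounded down to a multiple of `R.unit N`, so the next multiple already
-- has a power above the product.
γ-lower : ∀ {k} (n : Vec ℝ (suc k)) N {y} → 0ℚ ℚ.≤ y → y R.^ suc k ℚ.≤ seq (product n) N →
  y ℚ.≤ seq (γ n) N ℚ.+ R.unit N
γ-lower {k} n N {y} 0≤y h = R.^-cancel k
  (R.0≤+ (R.0≤gridRoot (suc k) N v⁺) (ℚP.<⇒≤ (R.0<unit N)))
  (ℚP.≤-trans h (ℚP.≤-trans (ℚP.p≤p⊔q v 0ℚ)
    (ℚP.<⇒≤ (proj₂ (R.gridRoot-spec k N v⁺ (ℚP.p≤q⊔p v 0ℚ))))))
  where
  v v⁺ : ℚ
  v  = seq (product n) N
  v⁺ = v ℚ.⊔ 0ℚ

-- The inverse of ζ is truncated at the lower bound 1 that comes with 0<ζ.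
quotient-bound : ∀ a v {z} (0<z⊔1 : 0ℚ ℚ.< z ℚ.⊔ 1ℚ) → 1ℚ ℚ.≤ z →
  ℚ.∣ a ℚ.- v ℚ.* recip (z ℚ.⊔ 1ℚ) 0<z⊔1 ∣ ℚ.≤ ℚ.∣ a ℚ.* z ℚ.- v ∣
quotient-bound a v {z} 0<z⊔1 1≤z = subst₂ ℚ._≤_
  (cong ℚ.∣_∣ (trans (step s a z v) (cong (ℚ._- v ℚ.* s)
    (trans (cong (a ℚ.*_) (recip-drop-⊔ 0<z⊔1 1≤z)) (ℚP.*-identityʳ a)))))
  (ℚP.*-identityˡ ℚ.∣ a ℚ.* z ℚ.- v ∣)
  (R.∣*∣≤ {s} {a ℚ.* z ℚ.- v} (subst (ℚ._≤ 1ℚ) (sym (ℚP.0≤p⇒∣p∣≡p (ℚP.<⇒≤ (R.0<recip 0<z⊔1))))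
    (R.recip-anti R.0<1 0<z⊔1 (ℚP.p≤q⊔p z 1ℚ))) ℚP.≤-refl)
  where
  s : ℚ
  s = recip (z ℚ.⊔ 1ℚ) 0<z⊔1
  step : ∀ s a z v → s ℚ.* (a ℚ.* z ℚ.- v) ≡ a ℚ.* (z ℚ.* s) ℚ.- v ℚ.* s
  step = solve-∀ ℚ-ring

0≤2*bound : ∀ E → 0ℚ ℚ.≤ fromℕ 2 ℚ.* (boundOf E ℚ.+ 1ℚ)
0≤2*bound E = R.0≤* (R.0≤fromℕ 2) (R.0≤+ (ℚP.<⇒≤ (0<boundOf E)) R.0≤1)

-- Chosen so that 2 to this power dominates 2 (E + 1), the constant in D ≤ 2 max n ≤ 2 (E + 1) min
-- n. A power of two fits the dyadic comparison of the harmonic sum with ln.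
exponent : ℝ → ℕ
exponent E = proj₁ (bounding-ℕ (fromℕ 2 ℚ.* (boundOf E ℚ.+ 1ℚ)) (0≤2*bound E))

exponent-bound : ∀ E → fromℕ 2 ℚ.* (boundOf E ℚ.+ 1ℚ) ℚ.≤ fromℕ (2 ℕ.^ exponent E)
exponent-bound E = proj₂ (bounding-ℕ (fromℕ 2 ℚ.* (boundOf E ℚ.+ 1ℚ)) (0≤2*bound E))

Q⇔CoprimeInBox : ∀ {k} {n : Vec ℝ k} {m : Vec ℕ k} → Pointwise IsFloor n m → ∀ a → Q n a ⇔ CoprimeInBox m a
Q⇔CoprimeInBox floors a = mk⇔
  (λ q → (Q.positive q , to floors (Q.bounded q)) , Q.coprime q)
  (λ ((pos , below) , coprime) → record { positive = pos ; coprime = coprime ; bounded = back floors below })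
  where
  to : ∀ {k} {n : Vec ℝ k} {m a : Vec ℕ k} → Pointwise IsFloor n m →
    Pointwise (λ aᵢ nᵢ → fromℚ (fromℕ aᵢ) ≤ nᵢ) a n → Pointwise ℕ._≤_ a m
  to []       []       = []
  to {a = a ∷ _} (p ∷ ps) (q ∷ qs) = IsFloor.greatest p a q ∷ to ps qs
  back : ∀ {k} {n : Vec ℝ k} {m a : Vec ℕ k} → Pointwise IsFloor n m →
    Pointwise ℕ._≤_ a m → Pointwise (λ aᵢ nᵢ → fromℚ (fromℕ aᵢ) ≤ nᵢ) a n
  back []       []       = []
  back {n = x ∷ _} {m ∷ _} {a ∷ _} (p ∷ ps) (q ∷ qs) =
    ≤ℝ-trans {fromℚ (fromℕ a)} {fromℚ (fromℕ m)} {x}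
      (≤-of-seq {fromℚ (fromℕ a)} {fromℚ (fromℕ m)} (from 0 λ _ _ → R.fromℕ-mono q)) (IsFloor.floor≤ p) ∷ back ps qs

-- `c₁` is the constant of `coprime-estimate`. `c₂` is the cost of replacing the floors by the
-- coordinates: they differ by at most 2 and all lie within 3 D.
c₁ c₂ : ℕ → ℚ
c₁ k = fromℕ 2 ℚ.* (fromℕ (2 ℕ.+ k) ℚ.+ 1ℚ)
c₂ k = fromℕ (2 ℕ.+ k) ℚ.* (fromℕ 2 ℚ.* fromℕ 3 R.^ (1 ℕ.+ k))

0≤c₁ : ∀ k → 0ℚ ℚ.≤ c₁ k
0≤c₁ k = R.0≤* (R.0≤fromℕ 2) (R.0≤+ (R.0≤fromℕ (2 ℕ.+ k)) R.0≤1)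

0≤c₂ : ∀ k → 0ℚ ℚ.≤ c₂ k
0≤c₂ k = R.0≤* (R.0≤fromℕ (2 ℕ.+ k)) (R.0≤* (R.0≤fromℕ 2) (R.0≤^ (1 ℕ.+ k) (R.0≤fromℕ 3)))

errorTerm : (d h c c′ : ℚ) → ℕ → ℚ
errorTerm d h c c′ i = d R.^ i ℚ.* (c ℚ.* h ℚ.+ c′)

module Estimate {k : ℕ} {E : ℝ} {n : Vec ℝ (suc (suc k))} (n∈𝒞 : 𝒞 E n) {m : Vec ℕ (suc (suc k))}
  (floors : Pointwise IsFloor n m) where

  D′ D : ℕ
  D′ = ℕ.pred (maxℕ m)
  D  = suc D′

  1≤maxℕ : 1 ℕ.≤ maxℕ m
  1≤maxℕ = first (𝒞.≥1 n∈𝒞) floors (≤maxℕ m)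
    where
    first : ∀ {k} {n : Vec ℝ (suc k)} {m : Vec ℕ (suc k)} {b} → All (1ℝ ≤_) n → Pointwise IsFloor n m → All (ℕ._≤ b) m → 1 ℕ.≤ b
    first (p ∷ _) (q ∷ _) (r ∷ _) = ℕP.≤-trans (IsFloor.greatest q 1 p) r

  D≡maxℕ : D ≡ maxℕ m
  D≡maxℕ = ℕP.suc-pred (maxℕ m) {{ℕ.>-nonZero 1≤maxℕ}}

  m≤D : All (ℕ._≤ D) m
  m≤D = subst (λ b → All (ℕ._≤ b) m) (sym D≡maxℕ) (≤maxℕ m)

  near : Eventually (λ N → Pointwise (Near N) n m)
  near = eventually-pointwise (pointwise-map (λ p → both (IsFloor.floor≤ p ½ R.0<½) (IsFloor.≤1+floor p ½ R.0<½)) floors)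

  D≤coordinates : Eventually (λ N → All (λ x → fromℕ D ℚ.≤ fromℕ (2 ℕ.^ exponent E) ℚ.* seq x N) n)
  D≤coordinates = map-eventually (λ N ((near , (0≤min , max≤)) , bE) → All.map (λ {x} min≤x → begin
      fromℕ D
        ≤⟨ double D′ (seq (maximum n) N) (subst (λ z → fromℕ z ℚ.≤ seq (maximum n) N ℚ.+ ½) (sym D≡maxℕ)
             (maxℕ≤max (pointwise-map proj₁ near))) ⟩
      fromℕ 2 ℚ.* seq (maximum n) N
        ≤⟨ R.*-monoˡ (R.0≤fromℕ 2) (ℚP.≤-trans max≤ (*-monoʳ 0≤min (ℚP.+-monoˡ-≤ 1ℚ (ℚP.≤-trans (R.p≤∣p∣ (seq E N)) bE)))) ⟩
      fromℕ 2 ℚ.* ((boundOf E ℚ.+ 1ℚ) ℚ.* seq (minimum n) N)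
        ≡⟨ ℚP.*-assoc (fromℕ 2) (boundOf E ℚ.+ 1ℚ) (seq (minimum n) N) ⟨
      fromℕ 2 ℚ.* (boundOf E ℚ.+ 1ℚ) ℚ.* seq (minimum n) N
        ≤⟨ *-monoʳ 0≤min (exponent-bound E) ⟩
      fromℕ (2 ℕ.^ exponent E) ℚ.* seq (minimum n) N
        ≤⟨ R.*-monoˡ (R.0≤fromℕ (2 ℕ.^ exponent E)) min≤x ⟩
      fromℕ (2 ℕ.^ exponent E) ℚ.* seq x N ∎) (min-lower n N))
    (both (both near (𝒞-comparable n∈𝒞 1ℚ R.0<1)) (eventuallyBounded E))
    where
    open ℚP.≤-Reasoning
    -- As D ≥ 1, the reading error ½ is absorbed by a factor: 2 x ≥ 2 D - 1 ≥ D.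
    double : ∀ d x → fromℕ (suc d) ℚ.≤ x ℚ.+ ½ → fromℕ (suc d) ℚ.≤ fromℕ 2 ℚ.* x
    double d x h = ℚP.≤-trans (R.≤-by (fromℕ d) (R.0≤fromℕ d) (step (fromℕ d)))
      (ℚP.≤-trans (ℚP.+-monoˡ-≤ (ℚ.- 1ℚ) (ℚP.+-mono-≤ h h)) (ℚP.≤-reflexive (step₂ x)))
      where
      step : ∀ d → (1ℚ ℚ.+ d) ℚ.+ (1ℚ ℚ.+ d) ℚ.- 1ℚ ≡ (1ℚ ℚ.+ d) ℚ.+ d
      step = solve-∀ ℚ-ring
      step₂ : ∀ x → (x ℚ.+ ½) ℚ.+ (x ℚ.+ ½) ℚ.- 1ℚ ≡ fromℕ 2 ℚ.* x
      step₂ x = trans (step₃ x) (cong (ℚ._* x) (refl {x = fromℕ 2}))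
        where
        step₃ : ∀ x → (x ℚ.+ ½) ℚ.+ (x ℚ.+ ½) ℚ.- 1ℚ ≡ (1ℚ ℚ.+ 1ℚ) ℚ.* x
        step₃ = solve-∀ ℚ-ring

  -- All coordinates are at least y = D / 2 ^ `exponent E`, so the root is at least y up to its
  -- rounding. Once the rounding is below y / 2 at least half of y remains, whence the extra `suc`
  -- in the exponent.
  D≤γ : Eventually (λ N → fromℕ D ℚ.≤ fromℕ (2 ℕ.^ suc (exponent E)) ℚ.* seq (γ n) N)
  D≤γ = map-eventually (λ N (coords , small) → scaled N coords small)
    (both D≤coordinates (proj₁ (R.unit-small η 0<η) , proj₂ (R.unit-small η 0<η)))
    where
    u y η : ℚ
    u = ½ R.^ exponent E
    y = fromℕ D ℚ.* u
    η = ½ ℚ.* y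
    0<y : 0ℚ ℚ.< y
    0<y = R.0<* (R.0<fromℕ D′) (R.0<½^ (exponent E))
    0<η : 0ℚ ℚ.< η
    0<η = half 0<y
    2^*u : ∀ x → fromℕ (2 ℕ.^ exponent E) ℚ.* x ℚ.* u ≡ x
    2^*u x = trans (step (fromℕ (2 ℕ.^ exponent E)) x u) (trans (cong (ℚ._* x) (R.2^½^ (exponent E))) (ℚP.*-identityˡ x))
      where
      step : ∀ a x u → a ℚ.* x ℚ.* u ≡ (a ℚ.* u) ℚ.* x
      step = solve-∀ ℚ-ring
    lower : ∀ {j} {n : Vec ℝ j} {N} → All (λ x → fromℕ D ℚ.≤ fromℕ (2 ℕ.^ exponent E) ℚ.* seq x N) n →
      All (y ℚ.≤_) (Vec.map (λ x → seq x N) n)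
    lower [] = []
    lower {n = x ∷ _} {N} (p ∷ ps) = subst (y ℚ.≤_) (2^*u (seq x N)) (*-monoʳ (ℚP.<⇒≤ (R.0<½^ (exponent E))) p) ∷ lower ps
    scaled : ∀ N → All (λ x → fromℕ D ℚ.≤ fromℕ (2 ℕ.^ exponent E) ℚ.* seq x N) n → R.unit N ℚ.≤ η →
      fromℕ D ℚ.≤ fromℕ (2 ℕ.^ suc (exponent E)) ℚ.* seq (γ n) N
    scaled N coords small = begin
      fromℕ D
        ≡⟨ ℚP.*-identityʳ (fromℕ D) ⟨
      fromℕ D ℚ.* 1ℚ
        ≡⟨ cong (fromℕ D ℚ.*_) (R.2^½^ (suc (exponent E))) ⟨
      fromℕ D ℚ.* (fromℕ (2 ℕ.^ suc (exponent E)) ℚ.* (½ ℚ.* u))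
        ≡⟨ step (fromℕ D) (fromℕ (2 ℕ.^ suc (exponent E))) ½ u ⟩
      fromℕ (2 ℕ.^ suc (exponent E)) ℚ.* η
        ≤⟨ R.*-monoˡ (R.0≤fromℕ (2 ℕ.^ suc (exponent E))) η≤γ ⟩
      fromℕ (2 ℕ.^ suc (exponent E)) ℚ.* g ∎
      where
      open ℚP.≤-Reasoning
      g : ℚ
      g = seq (γ n) N
      step : ∀ d a h u → d ℚ.* (a ℚ.* (h ℚ.* u)) ≡ a ℚ.* (h ℚ.* (d ℚ.* u))
      step = solve-∀ ℚ-ring
      y≤ : y ℚ.≤ g ℚ.+ η
      y≤ = ℚP.≤-trans (γ-lower n N (ℚP.<⇒≤ 0<y) (subst (y R.^ (suc (suc k)) ℚ.≤_) (sym (product-seq n N))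
        (∏-lower (ℚP.<⇒≤ 0<y) (lower coords)))) (ℚP.+-monoʳ-≤ g small)
      cancel₁ : ∀ y → y ℚ.- ½ ℚ.* y ≡ ½ ℚ.* y
      cancel₁ = solve-∀ ℚ-ring
      cancel₂ : ∀ g h → g ℚ.+ h ℚ.- h ≡ g
      cancel₂ = solve-∀ ℚ-ring
      η≤γ : η ℚ.≤ g
      η≤γ = subst₂ ℚ._≤_ (cancel₁ y) (cancel₂ g η) (ℚP.+-monoˡ-≤ (ℚ.- η) y≤)

  P : ℚ
  P = ∏ (Vec.map fromℕ m)

  volume-close : ∀ N → Pointwise (Near N) n m →
    ℚ.∣ P ℚ.- seq (product n) N ∣ ℚ.≤ fromℕ D R.^ suc k ℚ.* c₂ k
  volume-close N near = *-cancelˡ 0<X (begin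
    X ℚ.* ℚ.∣ P ℚ.- seq (product n) N ∣
      ≡⟨ cong (λ z → X ℚ.* ℚ.∣ P ℚ.- z ∣) (product-seq n N) ⟩
    X ℚ.* ℚ.∣ P ℚ.- ∏ (Vec.map (λ x → seq x N) n) ∣
      ≤⟨ ∏-close (ℚP.<⇒≤ 0<X) (close near) (floors≤ m≤D) (coords≤ near m≤D) ⟩
    fromℕ (suc (suc k)) ℚ.* (fromℕ 2 ℚ.* (X ℚ.* X R.^ suc k))
      ≡⟨ cong (λ z → fromℕ (suc (suc k)) ℚ.* (fromℕ 2 ℚ.* (X ℚ.* z))) (^-distrib-* (fromℕ 3) (fromℕ D) (suc k)) ⟩
    fromℕ (suc (suc k)) ℚ.* (fromℕ 2 ℚ.* (X ℚ.* (fromℕ 3 R.^ suc k ℚ.* fromℕ D R.^ suc k)))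
      ≡⟨ regroup (fromℕ (suc (suc k))) (fromℕ 2) X (fromℕ 3 R.^ suc k) (fromℕ D R.^ suc k) ⟩
    X ℚ.* (fromℕ D R.^ suc k ℚ.* c₂ k) ∎)
    where
    open ℚP.≤-Reasoning
    X : ℚ
    -- Each coordinate is at most its floor plus 2, hence at most D + 2 ≤ 3 D.
    X = fromℕ 3 ℚ.* fromℕ D
    0<X : 0ℚ ℚ.< X
    0<X = R.0<* (R.0<fromℕ 2) (R.0<fromℕ D′)
    regroup : ∀ a b X t d → a ℚ.* (b ℚ.* (X ℚ.* (t ℚ.* d))) ≡ X ℚ.* (d ℚ.* (a ℚ.* (b ℚ.* t)))
    regroup = solve-∀ ℚ-ring
    ½≤ : ∀ {b} → 1ℚ ℚ.≤ b → ½ ℚ.≤ b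
    ½≤ = ℚP.≤-trans (R.≤-by ½ (ℚP.<⇒≤ R.0<½) refl)
    upper : ∀ {a x} → x ℚ.≤ fromℕ (suc a) ℚ.+ ½ → x ℚ.≤ fromℕ a ℚ.+ fromℕ 2
    upper {a} h = ℚP.≤-trans h (ℚP.≤-trans (ℚP.+-monoʳ-≤ (fromℕ (suc a)) (½≤ ℚP.≤-refl)) (ℚP.≤-reflexive
      (trans (ℚP.+-comm (fromℕ (suc a)) 1ℚ) (trans (cong fromℕ (ℕP.+-comm 2 a)) (R.fromℕ-+ a 2)))))
    within : ∀ {a x} → fromℕ a ℚ.≤ x ℚ.+ ½ → x ℚ.≤ fromℕ (suc a) ℚ.+ ½ → ℚ.∣ fromℕ a ℚ.- x ∣ ℚ.≤ fromℕ 2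
    within {a} {x} h h′ = R.∣-∣≤ (ℚP.≤-trans h (ℚP.+-monoʳ-≤ x (½≤ (R.fromℕ-mono {1} {2} (ℕ.s≤s ℕ.z≤n))))) (upper {a} h′)
    close : ∀ {j N} {n : Vec ℝ j} {m : Vec ℕ j} →
      Pointwise (Near N) n m →
      Pointwise (λ a b → ℚ.∣ a ℚ.- b ∣ ℚ.≤ fromℕ 2) (Vec.map fromℕ m) (Vec.map (λ x → seq x N) n)
    close []                           = []
    close {m = a ∷ _} ((p , q) ∷ ps) = within {a} p q ∷ close ps
    2+D≤X : fromℕ D ℚ.+ fromℕ 2 ℚ.≤ X
    2+D≤X = subst₂ ℚ._≤_ (R.fromℕ-+ D 2) (R.fromℕ-* 3 D) (R.fromℕ-mono
      (ℕP.+-monoʳ-≤ D (ℕP.+-mono-≤ {1} {D} {1} {D ℕ.+ 0} (ℕ.s≤s ℕ.z≤n) (ℕ.s≤s ℕ.z≤n))))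
    D≤X : fromℕ D ℚ.≤ X
    D≤X = ℚP.≤-trans (slack (R.0≤fromℕ 2) (fromℕ D)) 2+D≤X
    floors≤ : ∀ {j} {m : Vec ℕ j} → All (ℕ._≤ D) m → All (λ a → ℚ.∣ a ∣ ℚ.≤ X) (Vec.map fromℕ m)
    floors≤ []                     = []
    floors≤ {m = a ∷ _} (p ∷ ps) = subst (ℚ._≤ X) (sym (∣fromℕ∣ a)) (ℚP.≤-trans (R.fromℕ-mono p) D≤X) ∷ floors≤ ps
    coords≤ : ∀ {j N} {n : Vec ℝ j} {m : Vec ℕ j} →
      Pointwise (Near N) n m →
      All (ℕ._≤ D) m → All (λ a → ℚ.∣ a ∣ ℚ.≤ X) (Vec.map (λ x → seq x N) n)
    coords≤ []             []       = []
    coords≤ {N = N} {x ∷ _} {a ∷ _} ((p , q) ∷ ps) (r ∷ rs) = R.∣∣≤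
      (ℚP.≤-trans (upper {a} q) (ℚP.≤-trans (ℚP.+-monoˡ-≤ (fromℕ 2) (R.fromℕ-mono r)) 2+D≤X))
      (ℚP.≤-trans -x≤½ (½≤ (ℚP.≤-trans (R.fromℕ-mono {1} {D} (ℕ.s≤s ℕ.z≤n)) D≤X))) ∷ coords≤ ps rs
      where
      cancel : ∀ x → x ℚ.+ ½ ℚ.- x ≡ ½
      cancel = solve-∀ ℚ-ring
      -x≤½ : ℚ.- seq x N ℚ.≤ ½
      -x≤½ = subst₂ ℚ._≤_ (ℚP.+-identityˡ (ℚ.- seq x N)) (cancel (seq x N))
        (ℚP.+-monoˡ-≤ (ℚ.- seq x N) (ℚP.≤-trans (R.0≤fromℕ a) p))

  error : ℕ → ℚ
  error i = errorTerm (fromℕ D) (zetaSum i D) (c₁ k) (c₂ k) i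

  count-estimate : ∀ {i} → i ≡ suc k → (xs : List (Vec ℕ (suc (suc k)))) → Unique xs → (∀ a → a ∈ xs ⇔ Q n a) →
    Eventually (λ N → 1ℚ ℚ.≤ zetaSum (suc (suc k)) N ×
      ℚ.∣ fromℕ (length xs) ℚ.* zetaSum (suc (suc k)) N ℚ.- seq (product n) N ∣ ℚ.≤ error i)
  count-estimate refl xs unique spec =
    map-eventually (λ N (near , D≤N) → 1≤ζ N D≤N , bound N near D≤N) (both near (from D λ N D≤N → D≤N))
    where
    open ℚP.≤-Reasoning
    spec′ : ∀ a → a ∈ xs ⇔ CoprimeInBox m a
    spec′ a = mk⇔ (λ h → Equivalence.to (Q⇔CoprimeInBox floors a) (Equivalence.to (spec a) h))
                  (λ h → Equivalence.from (spec a) (Equivalence.from (Q⇔CoprimeInBox floors a) h))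
    1≤ζ : ∀ N → D ℕ.≤ N → 1ℚ ℚ.≤ zetaSum (suc (suc k)) N
    1≤ζ (suc N) _ = R.zeta≥1 (suc (suc k)) N
    L : ℚ
    L = fromℕ (length xs)
    split : ∀ l p v → l ℚ.- v ≡ (l ℚ.- p) ℚ.+ (p ℚ.- v)
    split = solve-∀ ℚ-ring
    collect : ∀ c d z c′ → c ℚ.* (d ℚ.* z) ℚ.+ d ℚ.* c′ ≡ d ℚ.* (c ℚ.* z ℚ.+ c′)
    collect = solve-∀ ℚ-ring
    bound : ∀ N → Pointwise (Near N) n m → D ℕ.≤ N →
      ℚ.∣ L ℚ.* zetaSum (suc (suc k)) N ℚ.- seq (product n) N ∣ ℚ.≤ error (suc k)
    bound N near D≤N = begin
      ℚ.∣ L ℚ.* Z ℚ.- V ∣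
        ≡⟨ cong ℚ.∣_∣ (split (L ℚ.* Z) P V) ⟩
      ℚ.∣ (L ℚ.* Z ℚ.- P) ℚ.+ (P ℚ.- V) ∣
        ≤⟨ R.∣+∣≤ {L ℚ.* Z ℚ.- P} {P ℚ.- V} (coprime-estimate k m D′ m≤D N D≤N xs unique spec′) (volume-close N near) ⟩
      c₁ k ℚ.* (fromℕ D R.^ suc k ℚ.* zetaSum (suc k) D) ℚ.+ fromℕ D R.^ suc k ℚ.* c₂ k
        ≡⟨ collect (c₁ k) (fromℕ D R.^ suc k) (zetaSum (suc k) D) (c₂ k) ⟩
      error (suc k) ∎
      where
      V Z : ℚ
      V = seq (product n) N
      Z = zetaSum (suc (suc k)) N

-- Inequalities up to a rational error, and limits

∣-∣≤⇒≤+ : ∀ {x y ε} → ∣ x - y ∣ ≤ fromℚ ε → x ≤ y + fromℚ ε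
∣-∣≤⇒≤+ {x} {y} {ε} h η 0<η = map-eventually (λ n p → subst₂ ℚ._≤_ (step₁ (seq x n) (seq y n)) (step₂ (seq y n) ε η)
    (ℚP.+-monoʳ-≤ (seq y n) (ℚP.≤-trans (ℚP.p≤p⊔q (seq x n ℚ.- seq y n) (ℚ.- (seq x n ℚ.- seq y n))) p)))
  (h η 0<η)
  where
  step₁ : ∀ x y → y ℚ.+ (x ℚ.- y) ≡ x
  step₁ = solve-∀ ℚ-ring
  step₂ : ∀ y ε η → y ℚ.+ (ε ℚ.+ η) ≡ (y ℚ.+ ε) ℚ.+ η
  step₂ = solve-∀ ℚ-ring

∣-∣≤⇒≥- : ∀ {x y ε} → ∣ x - y ∣ ≤ fromℚ ε → y ≤ x + fromℚ ε
∣-∣≤⇒≥- {x} {y} {ε} h η 0<η = map-eventually (λ n p → subst₂ ℚ._≤_ (step₁ (seq x n) (seq y n)) (step₂ (seq x n) ε η)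
    (ℚP.+-monoʳ-≤ (seq x n) (ℚP.≤-trans (ℚP.p≤q⊔p (seq x n ℚ.- seq y n) (ℚ.- (seq x n ℚ.- seq y n))) p)))
  (h η 0<η)
  where
  step₁ : ∀ x y → x ℚ.- (x ℚ.- y) ≡ y
  step₁ = solve-∀ ℚ-ring
  step₂ : ∀ y ε η → y ℚ.+ (ε ℚ.+ η) ≡ (y ℚ.+ ε) ℚ.+ η
  step₂ = solve-∀ ℚ-ring

≤+⇒∣-∣≤ : ∀ {x y ε} → x ≤ y + fromℚ ε → y ≤ x + fromℚ ε → ∣ x - y ∣ ≤ fromℚ ε
≤+⇒∣-∣≤ {x} {y} {ε} h h′ η 0<η = map-eventually (λ n (p , q) → ℚP.⊔-lub
    (subst (seq x n ℚ.- seq y n ℚ.≤_) (step (seq y n) ε η) (ℚP.+-monoˡ-≤ (ℚ.- seq y n) p))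
    (subst₂ ℚ._≤_ (sym (R.swap- (seq x n) (seq y n))) (step (seq x n) ε η) (ℚP.+-monoˡ-≤ (ℚ.- seq x n) q)))
  (both (h η 0<η) (h′ η 0<η))
  where
  step : ∀ y ε η → (y ℚ.+ ε) ℚ.+ η ℚ.- y ≡ ε ℚ.+ η
  step = solve-∀ ℚ-ring

≤+-trans : ∀ {x y z a b} → x ≤ y + fromℚ a → y ≤ z + fromℚ b → x ≤ z + fromℚ (a ℚ.+ b)
≤+-trans {x} {y} {z} {a} {b} h h′ η 0<η = map-eventually (λ n (p , q) → ℚP.≤-trans p
    (ℚP.≤-trans (ℚP.+-monoˡ-≤ (½ ℚ.* η) (ℚP.+-monoˡ-≤ a q)) (ℚP.≤-reflexive (step (seq z n) a b η))))
  (both (h (½ ℚ.* η) (half 0<η)) (h′ (½ ℚ.* η) (half 0<η)))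
  where
  step : ∀ z a b η → (z ℚ.+ b) ℚ.+ ½ ℚ.* η ℚ.+ a ℚ.+ ½ ℚ.* η ≡ (z ℚ.+ (a ℚ.+ b)) ℚ.+ η
  step = solve-∀ ℚ-ring

≤+-mono : ∀ {x y z a b} → x ≤ y + fromℚ a → y ≤ z → a ℚ.≤ b → x ≤ z + fromℚ b
≤+-mono {x} {y} {z} {a} {b} h h′ a≤b η 0<η = map-eventually (λ n (p , q) → ℚP.≤-trans p
    (ℚP.≤-trans (ℚP.+-monoˡ-≤ (½ ℚ.* η) (ℚP.+-mono-≤ q a≤b)) (ℚP.≤-reflexive (step (seq z n) b η))))
  (both (h (½ ℚ.* η) (half 0<η)) (h′ (½ ℚ.* η) (half 0<η)))
  where
  step : ∀ z b η → z ℚ.+ ½ ℚ.* η ℚ.+ b ℚ.+ ½ ℚ.* η ≡ (z ℚ.+ b) ℚ.+ η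
  step = solve-∀ ℚ-ring

≤-from-≤+ : ∀ {x y} → (∀ ε → 0ℚ ℚ.< ε → x ≤ y + fromℚ ε) → x ≤ y
≤-from-≤+ {x} {y} h ε 0<ε = map-eventually (λ n → subst (seq x n ℚ.≤_) (step (seq y n) ε))
  (h (½ ℚ.* ε) (half 0<ε) (½ ℚ.* ε) (half 0<ε))
  where
  step : ∀ y ε → (y ℚ.+ ½ ℚ.* ε) ℚ.+ ½ ℚ.* ε ≡ y ℚ.+ ε
  step = solve-∀ ℚ-ring

⊓≤ˡ : ∀ u v → u ⊓ v ≤ u
⊓≤ˡ u v = ≤-of-seq {u ⊓ v} {u} (from 0 λ n _ → ⊓-seq≤ˡ u v n)

⊓≤ʳ : ∀ u v → u ⊓ v ≤ v
⊓≤ʳ u v = ≤-of-seq {u ⊓ v} {v} (from 0 λ n _ → ⊓-seq≤ʳ u v n)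

⊓-seq-sel : ∀ u v n → seq (u ⊓ v) n ≡ seq u n ⊎ seq (u ⊓ v) n ≡ seq v n
⊓-seq-sel u v n with ℚP.⊔-sel (ℚ.- seq u n) (ℚ.- seq v n)
... | inj₁ eq = inj₁ (trans (cong ℚ.-_ eq) (neg-involutive (seq u n)))
... | inj₂ eq = inj₂ (trans (cong ℚ.-_ eq) (neg-involutive (seq v n)))

-- Which of two reals is smaller cannot be decided, but at each index the approximation of `u ⊓ v`
-- is one of the two.
⊓-seq-elim : ∀ {P : ℚ → Set} u v n → P (seq u n) → P (seq v n) → P (seq (u ⊓ v) n)
⊓-seq-elim {P} u v n p q with ⊓-seq-sel u v n
... | inj₁ eq = subst P (sym eq) p
... | inj₂ eq = subst P (sym eq) q

⊓-glb : ∀ {x u v} → x ≤ u → x ≤ v → x ≤ u ⊓ v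
⊓-glb {x} {u} {v} h h′ η 0<η = map-eventually
  (λ n (p , q) → ⊓-seq-elim {λ w → seq x n ℚ.≤ w ℚ.+ η} u v n p q) (both (h η 0<η) (h′ η 0<η))

⊓-glb+ : ∀ {x u v ε} → x ≤ u + fromℚ ε → x ≤ v + fromℚ ε → x ≤ (u ⊓ v) + fromℚ ε
⊓-glb+ {x} {u} {v} {ε} h h′ η 0<η = map-eventually
  (λ n (p , q) → ⊓-seq-elim {λ w → seq x n ℚ.≤ (w ℚ.+ ε) ℚ.+ η} u v n p q) (both (h η 0<η) (h′ η 0<η))

*-⊓-glb : ∀ {x E u v} → x ≤ E * u → x ≤ E * v → x ≤ E * (u ⊓ v)
*-⊓-glb {x} {E} {u} {v} h h′ η 0<η = map-eventually
  (λ n (p , q) → ⊓-seq-elim {λ w → seq x n ℚ.≤ seq E n ℚ.* w ℚ.+ η} u v n p q) (both (h η 0<η) (h′ η 0<η))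

fromℚ-mono : ∀ {p q} → p ℚ.≤ q → fromℚ p ≤ fromℚ q
fromℚ-mono {p} {q} p≤q = ≤-of-seq {fromℚ p} {fromℚ q} (from 0 λ _ _ → p≤q)

eventually-nonneg : ∀ {x} → 1ℝ ≤ x → Eventually (λ n → 0ℚ ℚ.≤ seq x n)
eventually-nonneg {x} 1≤x = map-eventually (λ n h → subst₂ ℚ._≤_ (ℚP.+-inverseʳ 1ℚ) (step (seq x n)) (ℚP.+-monoˡ-≤ (ℚ.- 1ℚ) h))
  (1≤x 1ℚ R.0<1)
  where
  step : ∀ x → x ℚ.+ 1ℚ ℚ.- 1ℚ ≡ x
  step = solve-∀ ℚ-ring

eventually-≤bound : ∀ x → Eventually (λ n → seq x n ℚ.≤ boundOf x)
eventually-≤bound x = map-eventually (λ n → ℚP.≤-trans (R.p≤∣p∣ (seq x n))) (eventuallyBounded x)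

≤-scale : ∀ {E x} → 1ℝ ≤ E → 1ℝ ≤ x → x ≤ E * x
≤-scale {E} {x} 1≤E 1≤x η 0<η = map-eventually (λ n (p , (0≤x , b)) → begin
    seq x n
      ≡⟨ ℚP.*-identityˡ (seq x n) ⟨
    1ℚ ℚ.* seq x n
      ≤⟨ *-monoʳ 0≤x p ⟩
    (seq E n ℚ.+ θ) ℚ.* seq x n
      ≡⟨ ℚP.*-distribʳ-+ (seq x n) (seq E n) θ ⟩
    seq E n ℚ.* seq x n ℚ.+ θ ℚ.* seq x n
      ≤⟨ ℚP.+-monoʳ-≤ (seq E n ℚ.* seq x n) (R.*-monoˡ (ℚP.<⇒≤ 0<θ) b) ⟩
    seq E n ℚ.* seq x n ℚ.+ θ ℚ.* boundOf x
      ≡⟨ cong (seq E n ℚ.* seq x n ℚ.+_) (trans (ℚP.*-comm θ (boundOf x)) (R.*-recip-* (0<boundOf x) η)) ⟩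
    seq E n ℚ.* seq x n ℚ.+ η ∎)
  (both (1≤E θ 0<θ) (both (eventually-nonneg {x} 1≤x) (eventually-≤bound x)))
  where
  open ℚP.≤-Reasoning
  θ : ℚ
  θ = shrink (boundOf x) (0<boundOf x) η
  0<θ : 0ℚ ℚ.< θ
  0<θ = 0<shrink (0<boundOf x) 0<η

*-mono-≤+ : ∀ {E y z ε} → 1ℝ ≤ E → 0ℚ ℚ.≤ ε → y ≤ z + fromℚ ε → E * y ≤ E * z + fromℚ (boundOf E ℚ.* ε)
*-mono-≤+ {E} {y} {z} {ε} 1≤E 0≤ε h η 0<η = map-eventually (λ n (p , (0≤E , b)) → begin
    seq E n ℚ.* seq y n
      ≤⟨ R.*-monoˡ 0≤E p ⟩
    seq E n ℚ.* (seq z n ℚ.+ ε ℚ.+ θ)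
      ≡⟨ expand (seq E n) (seq z n) ε θ ⟩
    seq E n ℚ.* seq z n ℚ.+ seq E n ℚ.* (ε ℚ.+ θ)
      ≤⟨ ℚP.+-monoʳ-≤ (seq E n ℚ.* seq z n) (*-monoʳ (R.0≤+ 0≤ε (ℚP.<⇒≤ 0<θ)) b) ⟩
    seq E n ℚ.* seq z n ℚ.+ B ℚ.* (ε ℚ.+ θ)
      ≡⟨ trans (expand₂ (seq E n ℚ.* seq z n) B ε θ)
           (cong (seq E n ℚ.* seq z n ℚ.+ B ℚ.* ε ℚ.+_) (R.*-recip-* (0<boundOf E) η)) ⟩
    seq E n ℚ.* seq z n ℚ.+ B ℚ.* ε ℚ.+ η ∎)
  (both (h θ 0<θ) (both (eventually-nonneg {E} 1≤E) (eventually-≤bound E)))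
  where
  open ℚP.≤-Reasoning
  B θ : ℚ
  B = boundOf E
  θ = shrink B (0<boundOf E) η
  0<θ : 0ℚ ℚ.< θ
  0<θ = 0<shrink (0<boundOf E) 0<η
  expand : ∀ e z ε θ → e ℚ.* (z ℚ.+ ε ℚ.+ θ) ≡ e ℚ.* z ℚ.+ e ℚ.* (ε ℚ.+ θ)
  expand = solve-∀ ℚ-ring
  expand₂ : ∀ a b ε θ → a ℚ.+ b ℚ.* (ε ℚ.+ θ) ≡ a ℚ.+ b ℚ.* ε ℚ.+ b ℚ.* θ
  expand₂ = solve-∀ ℚ-ring

-- Completeness of ℝ and of ℝᵏ.

Convergesℝ : (ℕ → ℝ) → ℝ → Set
Convergesℝ s l = ∀ ε → 0ℚ ℚ.< ε → Eventually (λ n → ∣ s n - l ∣ ≤ fromℚ ε)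

module Limit (s : ℕ → ℝ)
  (c : ∀ ε → 0ℚ ℚ.< ε → Σ[ N ∈ ℕ ] (∀ m n → N ℕ.≤ m → N ℕ.≤ n → ∣ s m - s n ∣ ≤ fromℚ ε)) where

  M : ℕ → ℕ
  M i = proj₁ (cauchy (s i) (R.unit i) (R.0<unit i))

  -- The diagonal sequence: `s i` is read at an index from which it varies by at most 1 / (i + 1).
  l : ℕ → ℚ
  l i = seq (s i) (M i)

  l-near : ∀ i n → M i ℕ.≤ n → ℚ.∣ seq (s i) n ℚ.- l i ∣ ℚ.≤ R.unit i
  l-near i n M≤n = proj₂ (cauchy (s i) (R.unit i) (R.0<unit i)) n (M i) M≤n ℕP.≤-refl

  s≤l : ∀ i n → M i ℕ.≤ n → seq (s i) n ℚ.≤ l i ℚ.+ R.unit i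
  s≤l i n M≤n = R.∣-∣≤⇒ {seq (s i) n} {l i} (l-near i n M≤n)

  l≤s : ∀ i n → M i ℕ.≤ n → l i ℚ.≤ seq (s i) n ℚ.+ R.unit i
  l≤s i n M≤n = R.∣-∣≤⇒ {l i} {seq (s i) n} (subst (ℚ._≤ R.unit i) (R.∣-∣-sym (seq (s i) n) (l i)) (l-near i n M≤n))

  quarters : ∀ p ε → p ℚ.+ ½ ℚ.* (½ ℚ.* ε) ℚ.+ ½ ℚ.* (½ ℚ.* ε) ℚ.+ ½ ℚ.* (½ ℚ.* ε) ℚ.+ ½ ℚ.* (½ ℚ.* ε) ≡ p ℚ.+ ε
  quarters = solve-∀ ℚ-ring

  module At (ε : ℚ) (0<ε : 0ℚ ℚ.< ε) where
    η : ℚ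
    -- Four errors occur in each chain below: one at either end for a change of index or the passage
    -- to the diagonal, and two for comparing terms of s, namely their distance and the precision at
    -- which ≤ is read.
    η = ½ ℚ.* (½ ℚ.* ε)
    0<η : 0ℚ ℚ.< η
    0<η = half (half 0<ε)
    N₁ N₂ N : ℕ
    N₁ = proj₁ (c η 0<η)
    N₂ = proj₁ (R.unit-small η 0<η)
    N = N₁ ℕ.⊔ N₂
    unit≤ : ∀ i → N ℕ.≤ i → R.unit i ℚ.≤ η
    unit≤ i h = proj₂ (R.unit-small η 0<η) i (ℕP.≤-trans (ℕP.m≤n⊔m N₁ N₂) h)
    s≤s : ∀ i j → N ℕ.≤ i → N ℕ.≤ j → Eventually (λ m → seq (s i) m ℚ.≤ seq (s j) m ℚ.+ η ℚ.+ η)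
    s≤s i j p q = ∣-∣≤⇒≤+ {s i} {s j} {η}
      (proj₂ (c η 0<η) i j (ℕP.≤-trans (ℕP.m≤m⊔n N₁ N₂) p) (ℕP.≤-trans (ℕP.m≤m⊔n N₁ N₂) q)) η 0<η

    l≤l : ∀ i j → N ℕ.≤ i → N ℕ.≤ j → l i ℚ.≤ l j ℚ.+ ε
    l≤l i j p q = let (K , h) = both (s≤s i j p q) (both (from (M i) (λ _ h → h)) (from (M j) (λ _ h → h)))
                      (a , (b , b′)) = h K ℕP.≤-refl
      in begin
        l i
          ≤⟨ ℚP.≤-trans (l≤s i K b) (ℚP.+-monoʳ-≤ (seq (s i) K) (unit≤ i p)) ⟩
        seq (s i) K ℚ.+ η
          ≤⟨ ℚP.+-monoˡ-≤ η a ⟩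
        seq (s j) K ℚ.+ η ℚ.+ η ℚ.+ η
          ≤⟨ ℚP.+-monoˡ-≤ η (ℚP.+-monoˡ-≤ η (ℚP.+-monoˡ-≤ η (ℚP.≤-trans (s≤l j K b′) (ℚP.+-monoʳ-≤ (l j) (unit≤ j q))))) ⟩
        l j ℚ.+ η ℚ.+ η ℚ.+ η ℚ.+ η
          ≡⟨ quarters (l j) ε ⟩
        l j ℚ.+ ε ∎
      where open ℚP.≤-Reasoning

    K : ℕ → ℕ
    K i = proj₁ (cauchy (s i) η 0<η)

    close : ∀ i m n → K i ℕ.≤ m → K i ℕ.≤ n → seq (s i) m ℚ.≤ seq (s i) n ℚ.+ η
    close i m n p q = R.∣-∣≤⇒ {seq (s i) m} {seq (s i) n} (proj₂ (cauchy (s i) η 0<η) m n p q)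

    s-l : ∀ i n → N ℕ.≤ i → N ℕ.≤ n → K i ℕ.≤ n → seq (s i) n ℚ.≤ l n ℚ.+ ε
    s-l i n p q r = let (J , h) = both (s≤s i n p q) (both (from (K i) (λ _ h → h)) (from (M n) (λ _ h → h)))
                        (a , (b , b′)) = h J ℕP.≤-refl
      in begin
        seq (s i) n
          ≤⟨ close i n J r b ⟩
        seq (s i) J ℚ.+ η
          ≤⟨ ℚP.+-monoˡ-≤ η a ⟩
        seq (s n) J ℚ.+ η ℚ.+ η ℚ.+ η
          ≤⟨ ℚP.+-monoˡ-≤ η (ℚP.+-monoˡ-≤ η (ℚP.+-monoˡ-≤ η (ℚP.≤-trans (s≤l n J b′) (ℚP.+-monoʳ-≤ (l n) (unit≤ n q))))) ⟩
        l n ℚ.+ η ℚ.+ η ℚ.+ η ℚ.+ η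
          ≡⟨ quarters (l n) ε ⟩
        l n ℚ.+ ε ∎
      where open ℚP.≤-Reasoning

    l-s : ∀ i n → N ℕ.≤ i → N ℕ.≤ n → K i ℕ.≤ n → l n ℚ.≤ seq (s i) n ℚ.+ ε
    l-s i n p q r = let (J , h) = both (s≤s n i q p) (both (from (K i) (λ _ h → h)) (from (M n) (λ _ h → h)))
                        (a , (b , b′)) = h J ℕP.≤-refl
      in begin
        l n
          ≤⟨ ℚP.≤-trans (l≤s n J b′) (ℚP.+-monoʳ-≤ (seq (s n) J) (unit≤ n q)) ⟩
        seq (s n) J ℚ.+ η
          ≤⟨ ℚP.+-monoˡ-≤ η a ⟩
        seq (s i) J ℚ.+ η ℚ.+ η ℚ.+ η
          ≤⟨ ℚP.+-monoˡ-≤ η (ℚP.+-monoˡ-≤ η (ℚP.+-monoˡ-≤ η (close i J n b r))) ⟩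
        seq (s i) n ℚ.+ η ℚ.+ η ℚ.+ η ℚ.+ η
          ≡⟨ quarters (seq (s i) n) ε ⟩
        seq (s i) n ℚ.+ ε ∎
      where open ℚP.≤-Reasoning

  limit : ℝ
  limit = mkℝ l λ ε 0<ε → At.N ε 0<ε , λ m n p q → R.∣-∣≤ {l m} {l n} (At.l≤l ε 0<ε m n p q) (At.l≤l ε 0<ε n m q p)

  converges : Convergesℝ s limit
  converges ε 0<ε = At.N ε 0<ε , λ i p → ≤+⇒∣-∣≤ {s i} {limit} {ε}
    (≤-of-seq {s i} {limit + fromℚ ε} (from (At.N ε 0<ε ℕ.⊔ At.K ε 0<ε i) λ n h →
      At.s-l ε 0<ε i n p (ℕP.≤-trans (ℕP.m≤m⊔n (At.N ε 0<ε) (At.K ε 0<ε i)) h)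
        (ℕP.≤-trans (ℕP.m≤n⊔m (At.N ε 0<ε) (At.K ε 0<ε i)) h)))
    (≤-of-seq {limit} {s i + fromℚ ε} (from (At.N ε 0<ε ℕ.⊔ At.K ε 0<ε i) λ n h →
      At.l-s ε 0<ε i n p (ℕP.≤-trans (ℕP.m≤m⊔n (At.N ε 0<ε) (At.K ε 0<ε i)) h)
        (ℕP.≤-trans (ℕP.m≤n⊔m (At.N ε 0<ε) (At.K ε 0<ε i)) h)))

within-head : ∀ {k ε} {u v : Vec ℝ (suc k)} → Within ε u v → ∣ Vec.head u - Vec.head v ∣ ≤ fromℚ ε
within-head {u = _ ∷ _} {_ ∷ _} (p ∷ _) = p

within-tail : ∀ {k ε} {u v : Vec ℝ (suc k)} → Within ε u v → Within ε (Vec.tail u) (Vec.tail v)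
within-tail {u = _ ∷ _} {_ ∷ _} (_ ∷ ps) = ps

within-∷ : ∀ {k ε} {u : Vec ℝ (suc k)} {x v} → ∣ Vec.head u - x ∣ ≤ fromℚ ε → Within ε (Vec.tail u) v → Within ε u (x ∷ v)
within-∷ {u = _ ∷ _} p ps = p ∷ ps

within-[] : ∀ {ε} {u v : Vec ℝ 0} → Within ε u v
within-[] {u = []} {[]} = []

vec-limit : ∀ {k} (s : ℕ → Vec ℝ k) →
  (∀ ε → 0ℚ ℚ.< ε → Σ[ N ∈ ℕ ] (∀ m n → N ℕ.≤ m → N ℕ.≤ n → Within ε (s m) (s n))) →
  Σ[ l ∈ Vec ℝ k ] (∀ ε → 0ℚ ℚ.< ε → Eventually (λ n → Within ε (s n) l))
vec-limit {zero}  s c = [] , λ ε 0<ε → 0 , λ n _ → within-[] {ε}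
vec-limit {suc k} s c =
  let (l , conv) = vec-limit (λ n → Vec.tail (s n)) (λ ε 0<ε →
        let (N , h) = c ε 0<ε in N , λ m n p q → within-tail {ε = ε} {u = s m} {s n} (h m n p q))
  in Limit.limit (λ n → Vec.head (s n)) heads ∷ l , λ ε 0<ε →
       map-eventually (λ n (p , q) → within-∷ {ε = ε} {s n} p q)
         (both (Limit.converges (λ n → Vec.head (s n)) heads ε 0<ε) (conv ε 0<ε))
  where
  heads : ∀ ε → 0ℚ ℚ.< ε → Σ[ N ∈ ℕ ] (∀ m n → N ℕ.≤ m → N ℕ.≤ n → ∣ Vec.head (s m) - Vec.head (s n) ∣ ≤ fromℚ ε)
  heads ε 0<ε = let (N , h) = c ε 0<ε in N , λ m n p q → within-head {ε = ε} {u = s m} {s n} (h m n p q)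

-- The exceptional compact set for k = 2

-- If one coordinate exceeds 20 and both are at least 1 then, up to the precision of the approximations,
-- x y ≥ 9, which leaves γ ≥ 2.
side : ℚ
side = fromℕ 20

-- The ratio condition appears as two inequalities free of quotients and of positivity proofs, so
-- that it visibly passes to limits.
record Region (E x y : ℝ) : Set where
  field
    1≤x  : 1ℝ ≤ x
    1≤y  : 1ℝ ≤ y
    x≤20 : x ≤ fromℚ side
    y≤20 : y ≤ fromℚ side
    x≤Ey : x ≤ E * y
    y≤Ex : y ≤ E * x

open Region

𝒞⇒ratio : ∀ {E x y} → 1ℝ ≤ E → 𝒞 E (x ∷ y ∷ []) → x ≤ E * y × y ≤ E * x
𝒞⇒ratio {E} {x} {y} 1≤E n∈𝒞 =
  below x y (λ N → All.head (max-upper n N)) (λ N → All.head (All.tail (min-lower n N))) ,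
  below y x (λ N → All.head (All.tail (max-upper n N))) (λ N → All.head (min-lower n N))
  where
  n : Vec ℝ (suc (suc zero))
  n = x ∷ y ∷ []
  below : ∀ u v → (∀ N → seq u N ℚ.≤ seq (maximum n) N) → (∀ N → seq (minimum n) N ℚ.≤ seq v N) → u ≤ E * v
  below u v u≤max min≤v η 0<η = map-eventually (λ N ((0≤min , max≤) , (0≤E , b)) → begin
      seq u N
        ≤⟨ ℚP.≤-trans (u≤max N) max≤ ⟩
      (seq E N ℚ.+ θ) ℚ.* seq (minimum n) N
        ≤⟨ R.*-monoˡ (R.0≤+ 0≤E (ℚP.<⇒≤ 0<θ)) (min≤v N) ⟩
      (seq E N ℚ.+ θ) ℚ.* seq v N
        ≡⟨ ℚP.*-distribʳ-+ (seq v N) (seq E N) θ ⟩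
      seq E N ℚ.* seq v N ℚ.+ θ ℚ.* seq v N
        ≤⟨ ℚP.+-monoʳ-≤ (seq E N ℚ.* seq v N) (R.*-monoˡ (ℚP.<⇒≤ 0<θ) b) ⟩
      seq E N ℚ.* seq v N ℚ.+ θ ℚ.* boundOf v
        ≡⟨ cong (seq E N ℚ.* seq v N ℚ.+_) (trans (ℚP.*-comm θ (boundOf v)) (R.*-recip-* (0<boundOf v) η)) ⟩
      seq E N ℚ.* seq v N ℚ.+ η ∎)
    (both (𝒞-comparable n∈𝒞 θ 0<θ) (both (eventually-nonneg {E} 1≤E) (eventually-≤bound v)))
    where
    open ℚP.≤-Reasoning
    θ : ℚ
    θ = shrink (boundOf v) (0<boundOf v) η
    0<θ : 0ℚ ℚ.< θ
    0<θ = 0<shrink (0<boundOf v) 0<η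

-- Comparing x ⊔ y with E (x ⊓ y) also requires x ≤ E x and y ≤ E y, which is where 1 ≤ E enters.
region⇒𝒞 : ∀ {E x y} → 1ℝ ≤ E → Region E x y → 𝒞 E (x ∷ y ∷ [])
region⇒𝒞 {E} {x} {y} 1≤E r = record { ≥1 = n≥1 ; ratio = quotient (minimum-pos n≥1) }
  where
  open ℚP.≤-Reasoning
  n≥1 : All (1ℝ ≤_) (x ∷ y ∷ [])
  n≥1 = 1≤x r ∷ 1≤y r ∷ []
  lub : ∀ N {c} → seq x N ℚ.≤ c → seq y N ℚ.≤ c → seq (x ⊔ y) N ℚ.≤ c
  lub N p q = ℚP.⊔-lub p q
  max≤E*min : x ⊔ y ≤ E * (x ⊓ y)
  max≤E*min η 0<η = map-eventually (λ N (p , q) → lub N p q) (both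
    (*-⊓-glb {x} {E} {x} {y} (≤-scale {E} {x} 1≤E (1≤x r)) (x≤Ey r) η 0<η)
    (*-⊓-glb {y} {E} {x} {y} (y≤Ex r) (≤-scale {E} {y} 1≤E (1≤y r)) η 0<η))
  quotient : (pos : 0ℝ < x ⊓ y) → (x ⊔ y) ÷ (x ⊓ y) [ pos ] ≤ E
  quotient (δ , 0<δ , e) η 0<η = map-eventually (λ N (max≤ , 0≤E) → step N max≤ 0≤E)
    (both (max≤E*min θ 0<θ) (eventually-nonneg {E} 1≤E))
    where
    open TruncatedReciprocal δ 0<δ
    θ : ℚ
    θ = shrink F 0<F η
    0<θ : 0ℚ ℚ.< θ
    0<θ = 0<shrink 0<F 0<η
    step : ∀ N → seq (x ⊔ y) N ℚ.≤ seq (E * (x ⊓ y)) N ℚ.+ θ → 0ℚ ℚ.≤ seq E N →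
      seq (x ⊔ y) N ℚ.* 1/⊔ (seq (x ⊓ y) N) ℚ.≤ seq E N ℚ.+ η
    step N max≤ 0≤E = begin
      seq (x ⊔ y) N ℚ.* s
        ≤⟨ *-monoʳ (0≤1/⊔ m) max≤ ⟩
      (seq E N ℚ.* m ℚ.+ θ) ℚ.* s
        ≡⟨ expand (seq E N) m θ s ⟩
      seq E N ℚ.* (m ℚ.* s) ℚ.+ θ ℚ.* s
        ≤⟨ ℚP.+-mono-≤ (R.*-monoˡ 0≤E ms≤1) (R.*-monoˡ (ℚP.<⇒≤ 0<θ) (1/⊔≤ m)) ⟩
      seq E N ℚ.* 1ℚ ℚ.+ θ ℚ.* F
        ≡⟨ cong₂ ℚ._+_ (ℚP.*-identityʳ (seq E N)) (trans (ℚP.*-comm θ F) (R.*-recip-* 0<F η)) ⟩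
      seq E N ℚ.+ η ∎
      where
      m s : ℚ
      m = seq (x ⊓ y) N
      s = 1/⊔ m
      expand : ∀ e m θ s → (e ℚ.* m ℚ.+ θ) ℚ.* s ≡ e ℚ.* (m ℚ.* s) ℚ.+ θ ℚ.* s
      expand = solve-∀ ℚ-ring
      ms≤1 : m ℚ.* s ℚ.≤ 1ℚ
      ms≤1 = subst (m ℚ.* s ℚ.≤_) (R.*-recip (0<⊔ m)) (*-monoʳ (0≤1/⊔ m) (ℚP.p≤p⊔q m δ))

-- Closedness and total boundedness of the region.

Near₂ : ℚ → ℝ → ℝ → Set
Near₂ ε x y = x ≤ y + fromℚ ε × y ≤ x + fromℚ ε

-- Non-strict inequalities survive approximation. The same argument yields completeness and
-- invariance under ≈.
region-closed : ∀ {E x y} → 1ℝ ≤ E →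
  (∀ ε → 0ℚ ℚ.< ε → Σ[ u ∈ ℝ ] Σ[ v ∈ ℝ ] (Region E u v × Near₂ ε u x × Near₂ ε v y)) → Region E x y
region-closed {E} {x} {y} 1≤E near = record
  { 1≤x  = ≤-from-≤+ {1ℝ} {x} λ ε 0<ε → let (u , v , r , (p , _) , _) = near ε 0<ε in
             ≤ℝ-trans {1ℝ} {u} {x + fromℚ ε} (1≤x r) p
  ; 1≤y  = ≤-from-≤+ {1ℝ} {y} λ ε 0<ε → let (u , v , r , _ , (p , _)) = near ε 0<ε in
             ≤ℝ-trans {1ℝ} {v} {y + fromℚ ε} (1≤y r) p
  ; x≤20 = ≤-from-≤+ {x} {fromℚ side} λ ε 0<ε → let (u , v , r , (_ , p) , _) = near ε 0<ε in
             ≤+-mono {x} {u} {fromℚ side} {ε} {ε} p (x≤20 r) ℚP.≤-refl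
  ; y≤20 = ≤-from-≤+ {y} {fromℚ side} λ ε 0<ε → let (u , v , r , _ , (_ , p)) = near ε 0<ε in
             ≤+-mono {y} {v} {fromℚ side} {ε} {ε} p (y≤20 r) ℚP.≤-refl
  ; x≤Ey = ratio {x} {y} λ ε 0<ε → let (u , v , r , (_ , p) , (q , _)) = near ε 0<ε in u , v , p , x≤Ey r , q
  ; y≤Ex = ratio {y} {x} λ ε 0<ε → let (u , v , r , (p , _) , (_ , q)) = near ε 0<ε in v , u , q , y≤Ex r , p }
  where
  b : ℚ
  -- From x ≤ u + η, u ≤ E v and v ≤ y + η the total error is η + E η.
  b = 1ℚ ℚ.+ boundOf E
  0<b : 0ℚ ℚ.< b
  0<b = R.0<+ R.0<1 (ℚP.<⇒≤ (0<boundOf E))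
  ratio : ∀ {x y} → (∀ ε → 0ℚ ℚ.< ε →
    Σ[ u ∈ ℝ ] Σ[ v ∈ ℝ ] (x ≤ u + fromℚ ε × u ≤ E * v × v ≤ y + fromℚ ε)) → x ≤ E * y
  ratio {x} {y} h = ≤-from-≤+ {x} {E * y} λ ε 0<ε →
    let η = shrink b 0<b ε
        0<η = 0<shrink 0<b 0<ε
        (u , v , p , q , r) = h η 0<η
    in subst (λ z → x ≤ E * y + fromℚ z) (trans (step η (boundOf E)) (R.*-recip-* 0<b ε))
         (≤+-trans {x} {E * v} {E * y} {η} {boundOf E ℚ.* η}
           (≤+-mono {x} {u} {E * v} {η} {η} p q ℚP.≤-refl)
           (*-mono-≤+ {E} {v} {y} {η} 1≤E (ℚP.<⇒≤ 0<η) r))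
    where
    step : ∀ η b → η ℚ.+ b ℚ.* η ≡ (1ℚ ℚ.+ b) ℚ.* η
    step = solve-∀ ℚ-ring

greatest≤ : ∀ {P : ℕ → Set} (P? : ∀ a → Dec (P a)) b → R.greatest P? b ℕ.≤ b
greatest≤ P? zero    = ℕ.z≤n
greatest≤ P? (suc b) with P? (suc b)
... | yes _ = ℕP.≤-refl
... | no _  = ℕP.≤-trans (greatest≤ P? b) (ℕP.n≤1+n b)

clamp : ℚ → ℚ
clamp q = (q ℚ.⊔ 1ℚ) ℚ.⊓ side

1≤side : 1ℚ ℚ.≤ side
1≤side = R.fromℕ-mono {1} {20} (ℕ.s≤s ℕ.z≤n)

1≤clamp : ∀ q → 1ℚ ℚ.≤ clamp q
1≤clamp q = ℚP.⊓-glb (ℚP.p≤q⊔p q 1ℚ) 1≤side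

clamp≤20 : ∀ q → clamp q ℚ.≤ side
clamp≤20 q = ℚP.p⊓q≤q (q ℚ.⊔ 1ℚ) side

clamp-below : ∀ {p} q {ε} → 0ℚ ℚ.≤ ε → p ℚ.≤ side ℚ.+ ε → p ℚ.≤ q ℚ.+ ε → p ℚ.≤ clamp q ℚ.+ ε
clamp-below {p} q {ε} 0≤ε h h′ with ℚP.⊓-sel (q ℚ.⊔ 1ℚ) side
... | inj₁ eq = subst (λ z → p ℚ.≤ z ℚ.+ ε) (sym eq) (ℚP.≤-trans h′ (ℚP.+-monoˡ-≤ ε (ℚP.p≤p⊔q q 1ℚ)))
... | inj₂ eq = subst (λ z → p ℚ.≤ z ℚ.+ ε) (sym eq) h

clamp-above : ∀ {p q} → 1ℚ ℚ.≤ p → q ℚ.≤ p → clamp q ℚ.≤ p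
clamp-above {p} {q} 1≤p q≤p = ℚP.≤-trans (ℚP.p⊓q≤p (q ℚ.⊔ 1ℚ) side) (ℚP.⊔-lub q≤p 1≤p)

gridSize : ℕ → ℕ
gridSize K = 20 ℕ.* suc K

gridPoint : ℕ → ℕ → ℚ
gridPoint K a = clamp (R.grid K a)

-- Take the greatest multiple of 1 / (K + 1) below q. Since 1 ≤ q ≤ 20, clamping it to the interval
-- keeps it below q and does not spoil the distance.
gridPoint-near : ∀ K q → 1ℚ ℚ.≤ q → q ℚ.≤ side →
  Σ[ a ∈ ℕ ] (a ℕ.< suc (gridSize K) × gridPoint K a ℚ.≤ q × q ℚ.≤ gridPoint K a ℚ.+ R.unit K)
gridPoint-near K q 1≤q q≤20 = a , ℕ.s≤s (greatest≤ P? (gridSize K)) , clamp-above 1≤q (proj₁ spec) ,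
  clamp-below (R.grid K a) 0≤u (ℚP.≤-trans q≤20 (slack 0≤u side))
    (subst (q ℚ.≤_) (R.grid-suc K a) (ℚP.<⇒≤ (ℚP.≰⇒> (proj₂ spec))))
  where
  P : ℕ → Set
  P a = R.grid K a ℚ.≤ q
  P? : ∀ a → Dec (P a)
  P? a = R.grid K a ℚP.≤? q
  a : ℕ
  a = R.greatest P? (gridSize K)
  0≤u : 0ℚ ℚ.≤ R.unit K
  0≤u = ℚP.<⇒≤ (R.0<unit K)
  top : R.grid K (gridSize K) ≡ side
  top = trans (cong (ℚ._* R.unit K) (R.fromℕ-* 20 (suc K)))
    (trans (ℚP.*-assoc side (fromℕ (suc K)) (R.unit K))
      (trans (cong (side ℚ.*_) (R.*-recip (R.0<fromℕ K))) (ℚP.*-identityʳ side)))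
  beyond : ¬ P (suc (gridSize K))
  beyond h = ℚP.<-irrefl refl (ℚP.<-≤-trans
    (subst₂ ℚ._<_ (ℚP.+-identityʳ side) (trans (cong (ℚ._+ R.unit K) (sym top)) (sym (R.grid-suc K (gridSize K))))
      (ℚP.+-monoʳ-< side (R.0<unit K)))
    (ℚP.≤-trans h q≤20))
  spec : P a × ¬ P (suc a)
  spec = R.greatest-spec {P} P? (gridSize K)
    (ℚP.≤-trans (ℚP.≤-reflexive (ℚP.*-zeroˡ (R.unit K))) (ℚP.≤-trans R.0≤1 1≤q)) beyond

module Grid (δ : ℚ) (0<δ : 0ℚ ℚ.< δ) where

  η : ℚ
  η = ½ ℚ.* (½ ℚ.* δ)

  0<η : 0ℚ ℚ.< η
  0<η = half (half 0<δ)

  0≤η : 0ℚ ℚ.≤ η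
  0≤η = ℚP.<⇒≤ 0<η

  K : ℕ
  K = proj₁ (R.unit-small η 0<η)

  -- The approximation q of x may stick out of [1 , 20], by at most 2 η, so it is clamped before a
  -- grid point is chosen. With η each for reading x and for the mesh, the budget is 4 η = δ.
  approximate : ∀ x → 1ℝ ≤ x → x ≤ fromℚ side →
    Σ[ a ∈ ℕ ] (a ℕ.< suc (gridSize K) × Near₂ δ x (fromℚ (gridPoint K a)))
  approximate x 1≤x x≤20 = a , a< ,
    ≤-of-seq {x} {fromℚ p + fromℚ δ} (from N λ n N≤n → begin
      seq x n
        ≤⟨ R.∣-∣≤⇒ {seq x n} {q} (close n N N≤n ℕP.≤-refl) ⟩
      q ℚ.+ η
        ≤⟨ ℚP.+-monoˡ-≤ η q≤clamp ⟩
      clamp q ℚ.+ (η ℚ.+ η) ℚ.+ η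
        ≤⟨ ℚP.+-monoˡ-≤ η (ℚP.+-monoˡ-≤ (η ℚ.+ η) (ℚP.≤-trans clamp≤p (ℚP.+-monoʳ-≤ p unit≤η))) ⟩
      p ℚ.+ η ℚ.+ (η ℚ.+ η) ℚ.+ η
        ≡⟨ quarters p δ ⟩
      p ℚ.+ δ ∎) ,
    ≤-of-seq {fromℚ p} {x + fromℚ δ} (from N λ n N≤n → begin
      p
        ≤⟨ p≤clamp ⟩
      clamp q
        ≤⟨ clamp-above {q ℚ.+ (η ℚ.+ η)} {q} 1≤q+2η (slack (R.0≤+ 0≤η 0≤η) q) ⟩
      q ℚ.+ (η ℚ.+ η)
        ≤⟨ ℚP.+-monoˡ-≤ (η ℚ.+ η) (R.∣-∣≤⇒ {q} {seq x n} (close N n ℕP.≤-refl N≤n)) ⟩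
      seq x n ℚ.+ η ℚ.+ (η ℚ.+ η)
        ≤⟨ slack 0≤η _ ⟩
      seq x n ℚ.+ η ℚ.+ (η ℚ.+ η) ℚ.+ η
        ≡⟨ quarters (seq x n) δ ⟩
      seq x n ℚ.+ δ ∎)
    where
    open ℚP.≤-Reasoning
    quarters : ∀ p δ → p ℚ.+ ½ ℚ.* (½ ℚ.* δ) ℚ.+ (½ ℚ.* (½ ℚ.* δ) ℚ.+ ½ ℚ.* (½ ℚ.* δ)) ℚ.+ ½ ℚ.* (½ ℚ.* δ) ≡ p ℚ.+ δ
    quarters = solve-∀ ℚ-ring
    N : ℕ
    N = proj₁ (cauchy x η 0<η)
    close : ∀ m n → N ℕ.≤ m → N ℕ.≤ n → ℚ.∣ seq x m ℚ.- seq x n ∣ ℚ.≤ η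
    close = proj₂ (cauchy x η 0<η)
    q : ℚ
    q = seq x N
    1≤q+2η : 1ℚ ℚ.≤ q ℚ.+ (η ℚ.+ η)
    1≤q+2η = let (J , h) = both (1≤x η 0<η) (from N λ _ h → h)
                 (a , b) = h J ℕP.≤-refl
      in ℚP.≤-trans a (ℚP.≤-trans (ℚP.+-monoˡ-≤ η (R.∣-∣≤⇒ {seq x J} {q} (close J N b ℕP.≤-refl)))
           (ℚP.≤-reflexive (ℚP.+-assoc q η η)))
    q≤20+2η : q ℚ.≤ side ℚ.+ (η ℚ.+ η)
    q≤20+2η = let (J , h) = both (x≤20 η 0<η) (from N λ _ h → h)
                  (a , b) = h J ℕP.≤-refl
      in ℚP.≤-trans (R.∣-∣≤⇒ {q} {seq x J} (close N J ℕP.≤-refl b)) (ℚP.≤-trans (ℚP.+-monoˡ-≤ η a)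
           (ℚP.≤-reflexive (ℚP.+-assoc side η η)))
    q≤clamp : q ℚ.≤ clamp q ℚ.+ (η ℚ.+ η)
    q≤clamp = clamp-below q (R.0≤+ 0≤η 0≤η) q≤20+2η (slack (R.0≤+ 0≤η 0≤η) q)
    found = gridPoint-near K (clamp q) (1≤clamp q) (clamp≤20 q)
    a : ℕ
    a = proj₁ found
    a< : a ℕ.< suc (gridSize K)
    a< = proj₁ (proj₂ found)
    p : ℚ
    p = gridPoint K a
    p≤clamp : p ℚ.≤ clamp q
    p≤clamp = proj₁ (proj₂ (proj₂ found))
    clamp≤p : clamp q ℚ.≤ p ℚ.+ R.unit K
    clamp≤p = proj₂ (proj₂ (proj₂ found))
    unit≤η : R.unit K ℚ.≤ η
    unit≤η = proj₂ (R.unit-small η 0<η) K ℕP.≤-refl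

InRegion : ℝ → Pred (Vec ℝ (suc (suc zero))) 0ℓ
InRegion E (x ∷ y ∷ []) = Region E x y

module _ (E : ℝ) (1≤E : 1ℝ ≤ E) where

  -- A retraction of the square [1 , 20]² onto the region: it carries a grid of the square to a net of the region.
  retract : ℝ → ℝ → Vec ℝ (suc (suc zero))
  retract p q = (p ⊓ (E * q)) ∷ (q ⊓ (E * p)) ∷ []

  retract-region : ∀ {p q} → 1ℝ ≤ p → p ≤ fromℚ side → 1ℝ ≤ q → q ≤ fromℚ side → InRegion E (retract p q)
  retract-region {p} {q} 1≤p p≤20 1≤q q≤20 = record
    { 1≤x  = 1≤⊓ {p} {q} 1≤p 1≤q
    ; 1≤y  = 1≤⊓ {q} {p} 1≤q 1≤p
    ; x≤20 = ≤ℝ-trans {p ⊓ (E * q)} {p} {fromℚ side} (⊓≤ˡ p (E * q)) p≤20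
    ; y≤20 = ≤ℝ-trans {q ⊓ (E * p)} {q} {fromℚ side} (⊓≤ˡ q (E * p)) q≤20
    ; x≤Ey = ratio {p} {q} 1≤p
    ; y≤Ex = ratio {q} {p} 1≤q }
    where
    1≤E* : ∀ {p} → 1ℝ ≤ p → 1ℝ ≤ E * p
    1≤E* {p} 1≤p = ≤ℝ-trans {1ℝ} {p} {E * p} 1≤p (≤-scale {E} {p} 1≤E 1≤p)
    1≤⊓ : ∀ {p q} → 1ℝ ≤ p → 1ℝ ≤ q → 1ℝ ≤ p ⊓ (E * q)
    1≤⊓ {p} {q} 1≤p 1≤q = ⊓-glb {1ℝ} {p} {E * q} 1≤p (1≤E* {q} 1≤q)
    ratio : ∀ {p q} → 1ℝ ≤ p → p ⊓ (E * q) ≤ E * (q ⊓ (E * p))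
    ratio {p} {q} 1≤p = *-⊓-glb {p ⊓ (E * q)} {E} {q} {E * p} (⊓≤ʳ p (E * q))
      (≤ℝ-trans {p ⊓ (E * q)} {p} {E * (E * p)} (⊓≤ˡ p (E * q))
        (≤ℝ-trans {p} {E * p} {E * (E * p)} (≤-scale {E} {p} 1≤E 1≤p) (≤-scale {E} {E * p} 1≤E (1≤E* {p} 1≤p))))

  -- The retraction fixes the region, because x ≤ E y there, and it enlarges errors at most by the
  -- factor 1 or the bound for E.
  retract-near : ∀ {x y p q δ ε} → 0ℚ ℚ.≤ δ → δ ℚ.≤ ε → boundOf E ℚ.* δ ℚ.≤ ε → x ≤ E * y →
    Near₂ δ x p → Near₂ δ y q → ∣ x - (p ⊓ (E * q)) ∣ ≤ fromℚ ε
  retract-near {x} {y} {p} {q} {δ} {ε} 0≤δ δ≤ε bδ≤ε x≤Ey (x≤p , p≤x) (y≤q , _) = ≤+⇒∣-∣≤ {x} {p ⊓ (E * q)} {ε}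
    (⊓-glb+ {x} {p} {E * q} {ε} (≤+-mono {x} {p} {p} {δ} {ε} x≤p (≤ℝ-refl p) δ≤ε)
      (≤ℝ-trans {x} {E * y} {E * q + fromℚ ε} x≤Ey
        (≤+-mono {E * y} {E * q} {E * q} {boundOf E ℚ.* δ} {ε} (*-mono-≤+ {E} {y} {q} {δ} 1≤E 0≤δ y≤q) (≤ℝ-refl (E * q)) bδ≤ε)))
    (≤ℝ-trans {p ⊓ (E * q)} {p} {x + fromℚ ε} (⊓≤ˡ p (E * q)) (≤+-mono {p} {x} {x} {δ} {ε} p≤x (≤ℝ-refl x) δ≤ε))

  region-compact : Compact (InRegion E)
  region-compact = record
    { respects = respects′
    ; complete = λ s s∈ c → let (l , conv) = vec-limit s c in l , closed l (λ ε 0<ε → let (N , h) = conv ε 0<ε in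
        s N , s∈ N , h N ℕP.≤-refl) , conv
    ; totallyBounded = totally }
    where
    closed : ∀ l → (∀ ε → 0ℚ ℚ.< ε → Σ[ v ∈ Vec ℝ (suc (suc zero)) ] (InRegion E v × Within ε v l)) → InRegion E l
    closed (x ∷ y ∷ []) h = region-closed 1≤E λ ε 0<ε → coordinates ε (h ε 0<ε)
      where
      coordinates : ∀ ε → Σ[ v ∈ Vec ℝ (suc (suc zero)) ] (InRegion E v × Within ε v (x ∷ y ∷ [])) →
        Σ[ u ∈ ℝ ] Σ[ v ∈ ℝ ] (Region E u v × Near₂ ε u x × Near₂ ε v y)
      coordinates ε (u ∷ v ∷ [] , r , (p ∷ q ∷ [])) = u , v , r ,
        (∣-∣≤⇒≤+ {u} {x} {ε} p , ∣-∣≤⇒≥- {u} {x} {ε} p) , (∣-∣≤⇒≤+ {v} {y} {ε} q , ∣-∣≤⇒≥- {v} {y} {ε} q)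

    ≈⇒∣-∣≤ : ∀ {x y} → x ≈ y → ∀ ε → 0ℚ ℚ.< ε → ∣ x - y ∣ ≤ fromℚ ε
    ≈⇒∣-∣≤ {x} {y} x≈y ε 0<ε = ≤+⇒∣-∣≤ {x} {y} {ε}
      (≤-of-seq {x} {y + fromℚ ε} (map-eventually (λ n → R.∣-∣≤⇒ {seq x n} {seq y n}) (x≈y ε 0<ε)))
      (≤-of-seq {y} {x + fromℚ ε} (map-eventually (λ n h → R.∣-∣≤⇒ {seq y n} {seq x n}
        (subst (ℚ._≤ ε) (R.∣-∣-sym (seq x n) (seq y n)) h)) (x≈y ε 0<ε)))

    respects′ : ∀ {u v} → Pointwise _≈_ u v → InRegion E u → InRegion E v
    respects′ {u@(x ∷ y ∷ [])} {v@(x′ ∷ y′ ∷ [])} (p ∷ q ∷ []) r = closed v λ ε 0<ε →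
      u , r , (≈⇒∣-∣≤ {x} {x′} p ε 0<ε ∷ ≈⇒∣-∣≤ {y} {y′} q ε 0<ε ∷ [])

    b : ℚ
    b = 1ℚ ℚ.+ boundOf E
    0<b : 0ℚ ℚ.< b
    0<b = R.0<+ R.0<1 (ℚP.<⇒≤ (0<boundOf E))

    totally : ∀ ε → 0ℚ ℚ.< ε →
      Σ[ net ∈ List (Vec ℝ (suc (suc zero))) ] (ListAll.All (InRegion E) net × (∀ v → InRegion E v → Any (Within ε v) net))
    totally ε 0<ε = net , ListAll.tabulate inside , cover
      where
      δ : ℚ
      -- Then δ + `boundOf E` δ = ε, so either summand is an admissible error in `retract-near`.
      δ = shrink b 0<b ε
      0<δ : 0ℚ ℚ.< δ
      0<δ = 0<shrink 0<b 0<ε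
      0≤bδ : 0ℚ ℚ.≤ boundOf E ℚ.* δ
      0≤bδ = R.0≤* (ℚP.<⇒≤ (0<boundOf E)) (ℚP.<⇒≤ 0<δ)
      total : δ ℚ.+ boundOf E ℚ.* δ ≡ ε
      total = trans (step δ (boundOf E)) (R.*-recip-* 0<b ε)
        where
        step : ∀ η b → η ℚ.+ b ℚ.* η ≡ (1ℚ ℚ.+ b) ℚ.* η
        step = solve-∀ ℚ-ring
      δ≤ε : δ ℚ.≤ ε
      δ≤ε = R.≤-by (boundOf E ℚ.* δ) 0≤bδ (sym total)
      bδ≤ε : boundOf E ℚ.* δ ℚ.≤ ε
      bδ≤ε = R.≤-by δ (ℚP.<⇒≤ 0<δ) (trans (sym total) (ℚP.+-comm δ (boundOf E ℚ.* δ)))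
      open Grid δ 0<δ using (K; approximate)
      point : ℕ → ℝ
      point a = fromℚ (gridPoint K a)
      indices : List ℕ
      indices = List.upTo (suc (gridSize K))
      net : List (Vec ℝ (suc (suc zero)))
      net = List.cartesianProductWith (λ a b → retract (point a) (point b)) indices indices
      1≤point : ∀ a → 1ℝ ≤ point a
      1≤point a = fromℚ-mono (1≤clamp (R.grid K a))
      point≤20 : ∀ a → point a ≤ fromℚ side
      point≤20 a = fromℚ-mono (clamp≤20 (R.grid K a))
      inside : ∀ {v} → v ∈ net → InRegion E v
      inside {v} v∈ = let (a , b , _ , _ , eq) = ∈-cartesianProductWith⁻ (λ a b → retract (point a) (point b)) indices indices v∈
        in subst (InRegion E) (sym eq) (retract-region {point a} {point b} (1≤point a) (point≤20 a) (1≤point b) (point≤20 b))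
      cover : ∀ v → InRegion E v → Any (Within ε v) net
      cover (x ∷ y ∷ []) r =
        let (a , a< , near-a) = approximate x (1≤x r) (x≤20 r)
            (b , b< , near-b) = approximate y (1≤y r) (y≤20 r)
        in lose (∈-cartesianProductWith⁺ (λ a b → retract (point a) (point b)) (∈-upTo⁺ a<) (∈-upTo⁺ b<))
             (retract-near {x} {y} {point a} {point b} (ℚP.<⇒≤ 0<δ) δ≤ε bδ≤ε (x≤Ey r) near-a near-b ∷
              retract-near {y} {x} {point b} {point a} (ℚP.<⇒≤ 0<δ) δ≤ε bδ≤ε (y≤Ex r) near-b near-a ∷ [])

∅-compact : ∀ {k} → Compact {k} (λ _ → ⊥)
∅-compact = record
  { respects       = λ _ ()
  ; complete       = λ s s∈ → ⊥-elim (s∈ 0)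
  ; totallyBounded = λ _ _ → [] , ListAll.[] , λ _ () }

-- The two error terms

floors-exist : ∀ {k} {n : Vec ℝ k} → All (1ℝ ≤_) n → ¬ ¬ (Σ[ m ∈ Vec ℕ k ] Pointwise IsFloor n m)
floors-exist []               none = none ([] , [])
floors-exist {n = x ∷ n} (p ∷ ps) none = floors-exist ps λ (m , floors) →
  floor-exists x (≤ℝ-trans {0ℝ} {1ℝ} {x} (fromℚ-mono R.0≤1) p) λ (a , floor) → none (a ∷ m , floor ∷ floors)

-- For a fixed vector the error b is a single rational, so it suffices that the approximations of z
-- eventually exceed it.
∣-∣-from-close : ∀ {x y a b} → x ≈ fromℚ a → Eventually (λ N → ℚ.∣ a ℚ.- seq y N ∣ ℚ.≤ b) →
  ∀ z → Eventually (λ N → b ℚ.≤ seq z N) → ∣ x - y ∣ ≤ z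
∣-∣-from-close {x} {y} {a} {b} x≈a near z b≤z ε 0<ε = map-eventually (λ N ((p , q) , r) → bound N p q r)
  (both (both (x≈a ε 0<ε) near) b≤z)
  where
  step : ∀ x a y → (x ℚ.- a) ℚ.+ (a ℚ.- y) ≡ x ℚ.- y
  step = solve-∀ ℚ-ring
  bound : ∀ N → ℚ.∣ seq x N ℚ.- a ∣ ℚ.≤ ε → ℚ.∣ a ℚ.- seq y N ∣ ℚ.≤ b → b ℚ.≤ seq z N → seq ∣ x - y ∣ N ℚ.≤ seq z N ℚ.+ ε
  bound N p q r = ℚP.≤-trans
    (ℚP.⊔-lub (R.p≤∣p∣ d) (subst (ℚ.- d ℚ.≤_) (ℚP.∣-p∣≡∣p∣ d) (R.p≤∣p∣ (ℚ.- d))))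
    (ℚP.≤-trans (subst (ℚ._≤ ε ℚ.+ b) (cong ℚ.∣_∣ (step (seq x N) a (seq y N))) (R.∣+∣≤ {seq x N ℚ.- a} {a ℚ.- seq y N} p q))
      (ℚP.≤-trans (ℚP.+-monoʳ-≤ ε r) (ℚP.≤-reflexive (ℚP.+-comm ε (seq z N)))))
    where
    d : ℚ
    d = seq x N ℚ.- seq y N

^-seq : ∀ x k N → seq (x ^ k) N ≡ seq x N R.^ k
^-seq x zero    N = refl
^-seq x (suc k) N = cong (seq x N ℚ.*_) (^-seq x k N)

^-pos : ∀ {x} k → 0ℝ < x → 0ℝ < x ^ k
^-pos zero        _   = 1ℚ , R.0<1 , 0 , λ _ _ → ℚP.≤-refl
^-pos {x} (suc k) pos = *-pos {x} {x ^ k} pos (^-pos {x} k pos)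

-- The N-th approximation of `ln` is by definition a Riemann sum over [1 , x_N], so the harmonic
-- comparison applies index by index. The integrand is truncated at `δ ⊓ 1`, which is at most t for
-- t ≥ 1.
ln-lower : ∀ x (pos : 0ℝ < x) D e N → D ℕ.< N → fromℕ 2 ℚ.≤ seq x N → fromℕ D ℚ.≤ fromℕ (2 ℕ.^ e) ℚ.* seq x N →
  1ℚ ℚ.≤ fromℕ 4 ℚ.* seq (ln x pos) N ×
  zetaSum 1 D ℚ.≤ fromℕ (3 ℕ.+ e) ℚ.* (fromℕ 4 ℚ.* seq (ln x pos) N)
ln-lower x (δ , 0<δ , _) D e N = harmonic≤riemann 1/⊔ lower D e N (seq x N)
  where
  open TruncatedReciprocal (δ ℚ.⊓ 1ℚ) (R.0<⊓ 0<δ R.0<1)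
  lower : ∀ t T (0<T : 0ℚ ℚ.< T) → 1ℚ ℚ.≤ t → t ℚ.≤ T → recip T 0<T ℚ.≤ 1/⊔ t
  lower t T 0<T 1≤t t≤T = R.recip-anti (0<⊔ t) 0<T (ℚP.⊔-lub t≤T (ℚP.≤-trans (ℚP.p⊓q≤q δ 1ℚ) (ℚP.≤-trans 1≤t t≤T)))

-- The bound is 9 = 3² rather than 4 because the rounding of the root may cost up to 1.
γ≥2 : ∀ {x y} N → fromℕ 9 ℚ.≤ seq x N ℚ.* (seq y N ℚ.* 1ℚ) → fromℕ 2 ℚ.≤ seq (γ (x ∷ y ∷ [])) N
γ≥2 {x} {y} N 9≤V = subst₂ ℚ._≤_ refl (cancel g) (ℚP.+-monoˡ-≤ (ℚ.- 1ℚ)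
  (ℚP.≤-trans (γ-lower (x ∷ y ∷ []) N {fromℕ 3} (R.0≤fromℕ 3) 9≤V) (ℚP.+-monoʳ-≤ g (R.unit≤1 N))))
  where
  g : ℚ
  g = seq (γ (x ∷ y ∷ [])) N
  cancel : ∀ g → g ℚ.+ 1ℚ ℚ.- 1ℚ ≡ g
  cancel = solve-∀ ℚ-ring

-- If γ ≥ 2 could be refuted, no coordinate could exceed 20, and by stability of ≤ the point would
-- lie in the region. Lying outside is negative information, so the conclusion is doubly negated.
γ-large : ∀ {E} {n : Vec ℝ (suc (suc zero))} → 1ℝ ≤ E → 𝒞 E n → ¬ InRegion E n →
  ¬ ¬ Eventually (λ N → fromℕ 2 ℚ.≤ seq (γ n) N)
γ-large {E} {x ∷ y ∷ []} 1≤E n∈𝒞 outside none = outside (record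
  { 1≤x  = x≥1
  ; 1≤y  = y≥1
  ; x≤20 = ≤-stable {x} {fromℚ side} λ x≰20 → none (map-eventually (λ N (p , q) → γ≥2 {x} {y} N
      -- 9 = 18 · ½, where 20 ≤ x is read with precision 2 and 1 ≤ y with precision ½.
      (R.*-mono (R.0≤fromℕ 18) p (ℚP.<⇒≤ R.0<½) (subst (½ ℚ.≤_) (sym (ℚP.*-identityʳ (seq y N))) q)))
      (both (18≤ x (≰⇒≥ {x} {fromℚ side} x≰20)) (½≤ y y≥1)))
  ; y≤20 = ≤-stable {y} {fromℚ side} λ y≰20 → none (map-eventually (λ N (p , q) → γ≥2 {x} {y} N
      (R.*-mono (ℚP.<⇒≤ R.0<½) q (R.0≤fromℕ 18) (subst (fromℕ 18 ℚ.≤_) (sym (ℚP.*-identityʳ (seq y N))) p)))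
      (both (18≤ y (≰⇒≥ {y} {fromℚ side} y≰20)) (½≤ x x≥1)))
  ; x≤Ey = proj₁ (𝒞⇒ratio 1≤E n∈𝒞)
  ; y≤Ex = proj₂ (𝒞⇒ratio 1≤E n∈𝒞) })
  where
  x≥1 : 1ℝ ≤ x
  x≥1 = All.head (𝒞.≥1 n∈𝒞)
  y≥1 : 1ℝ ≤ y
  y≥1 = All.head (All.tail (𝒞.≥1 n∈𝒞))
  cancel : ∀ c x → x ℚ.+ c ℚ.- c ≡ x
  cancel = solve-∀ ℚ-ring
  18≤ : ∀ x → fromℚ side ≤ x → Eventually (λ N → fromℕ 18 ℚ.≤ seq x N)
  18≤ x h = map-eventually (λ N p → subst (fromℕ 18 ℚ.≤_) (cancel (fromℕ 2) (seq x N)) (ℚP.+-monoˡ-≤ (ℚ.- fromℕ 2) p))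
    (h (fromℕ 2) (R.0<fromℕ 1))
  ½≤ : ∀ x → 1ℝ ≤ x → Eventually (λ N → ½ ℚ.≤ seq x N)
  ½≤ x h = map-eventually (λ N p → subst (½ ℚ.≤_) (cancel ½ (seq x N)) (ℚP.+-monoˡ-≤ (ℚ.- ½) p)) (h ½ R.0<½)

-- The goal is an inequality between reals, hence stable; behind `≤-stable` both the floors and the
-- bound on the error may be taken as given.
estimate : ∀ {k} .{{nt : NonTrivial (suc (suc k))}} {E} {n : Vec ℝ (suc (suc k))} (n∈𝒞 : 𝒞 E n) i → i ≡ suc k →
  ∀ y → ∣Q∣ n y → ∀ z →
  (∀ {m} (floors : Pointwise IsFloor n m) → ¬ ¬ Eventually (λ N → Estimate.error n∈𝒞 floors i ℚ.≤ seq z N)) →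
  ∣ y - product n ÷ ζ (suc (suc k)) {{nt}} [ 0<ζ (suc (suc k)) {{nt}} ] ∣ ≤ z
estimate {k} {{nt}} {E} {n} n∈𝒞 i i≡ y (_ , (xs , unique , spec , refl) , y≈N) z error≤ =
  ≤-stable {∣ y - F₁ ∣} {z} λ fails → floors-exist (𝒞.≥1 n∈𝒞) λ (m , floors) → error≤ floors λ ev →
    fails (∣-∣-from-close {y} {F₁} y≈N (close floors) z ev)
  where
  F₁ : ℝ
  F₁ = product n ÷ ζ (suc (suc k)) {{nt}} [ 0<ζ (suc (suc k)) {{nt}} ]
  close : ∀ {m} (floors : Pointwise IsFloor n m) →
    Eventually (λ N → ℚ.∣ fromℕ (length xs) ℚ.- seq F₁ N ∣ ℚ.≤ Estimate.error n∈𝒞 floors i)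
  close floors = map-eventually
    (λ N (1≤ζ , h) → ℚP.≤-trans (quotient-bound (fromℕ (length xs)) (seq (product n) N)
      {zetaSum (suc (suc k)) N} (TruncatedReciprocal.0<⊔ 1ℚ R.0<1 (zetaSum (suc (suc k)) N)) 1≤ζ) h)
    (Estimate.count-estimate n∈𝒞 floors i≡ xs unique spec)

bound₂ : (A f c c′ : ℚ) → ℚ
bound₂ A f c c′ = A ℚ.* (fromℕ 4 ℚ.* (c ℚ.* f ℚ.+ c′))

-- The bound 1 ≤ 4 ln x absorbs the constant `c′` into the logarithmic term.
error≤₂ : ∀ {A f c c′ d h} x (pos : 0ℝ < x) N → 0ℚ ℚ.≤ c → 0ℚ ℚ.≤ c′ → 0ℚ ℚ.≤ d → 0ℚ ℚ.≤ h →
  d ℚ.≤ A ℚ.* seq x N → 1ℚ ℚ.≤ fromℕ 4 ℚ.* seq (ln x pos) N → h ℚ.≤ f ℚ.* (fromℕ 4 ℚ.* seq (ln x pos) N) →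
  errorTerm d h c c′ 1 ℚ.≤ seq (fromℚ (bound₂ A f c c′) * (x * ln x pos)) N
error≤₂ {A} {f} {c} {c′} {d} {h} x pos N 0≤c 0≤c′ 0≤d 0≤h d≤ = arithmetic (seq x N) (seq (ln x pos) N) d≤
  where
  open ℚP.≤-Reasoning
  regroup : ∀ a g c d f t l →
    (a ℚ.* g) ℚ.* (c ℚ.* (f ℚ.* (t ℚ.* l)) ℚ.+ d ℚ.* (t ℚ.* l)) ≡ (a ℚ.* (t ℚ.* (c ℚ.* f ℚ.+ d))) ℚ.* (g ℚ.* l)
  regroup = solve-∀ ℚ-ring
  arithmetic : ∀ g l → d ℚ.≤ A ℚ.* g → 1ℚ ℚ.≤ fromℕ 4 ℚ.* l → h ℚ.≤ f ℚ.* (fromℕ 4 ℚ.* l) →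
    errorTerm d h c c′ 1 ℚ.≤ bound₂ A f c c′ ℚ.* (g ℚ.* l)
  arithmetic g l d≤ 1≤4l h≤ = begin
    d R.^ 1 ℚ.* (c ℚ.* h ℚ.+ c′)
      ≡⟨ cong₂ (λ x y → x ℚ.* (c ℚ.* h ℚ.+ y)) (ℚP.*-identityʳ d) (sym (ℚP.*-identityʳ c′)) ⟩
    d ℚ.* (c ℚ.* h ℚ.+ c′ ℚ.* 1ℚ)
      ≤⟨ R.*-mono 0≤d d≤ (R.0≤+ (R.0≤* 0≤c 0≤h) (R.0≤* 0≤c′ R.0≤1))
           (ℚP.+-mono-≤ (R.*-monoˡ 0≤c h≤) (R.*-monoˡ 0≤c′ 1≤4l)) ⟩
    (A ℚ.* g) ℚ.* (c ℚ.* (f ℚ.* (fromℕ 4 ℚ.* l)) ℚ.+ c′ ℚ.* (fromℕ 4 ℚ.* l))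
      ≡⟨ regroup A g c c′ f (fromℕ 4) l ⟩
    bound₂ A f c c′ ℚ.* (g ℚ.* l) ∎

eventually-error≤₂ : ∀ {E n} (n∈𝒞 : 𝒞 {suc (suc zero)} E n) (pos : 0ℝ < γ n) {m} (floors : Pointwise IsFloor n m) →
  Eventually (λ N → fromℕ 2 ℚ.≤ seq (γ n) N) →
  Eventually (λ N → Estimate.error n∈𝒞 floors 1 ℚ.≤
    seq (fromℚ (bound₂ (fromℕ (2 ℕ.^ suc (exponent E))) (fromℕ (4 ℕ.+ exponent E)) (c₁ 0) (c₂ 0)) * (γ n * ln (γ n) pos)) N)
eventually-error≤₂ {E} {n} n∈𝒞 pos floors large = map-eventually
  (λ N ((D≤ , 2≤γ) , D<N) → let (p , q) = ln-lower (γ n) pos D (suc (exponent E)) N D<N 2≤γ D≤ in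
    error≤₂ {fromℕ (2 ℕ.^ suc (exponent E))} {fromℕ (4 ℕ.+ exponent E)} (γ n) pos N (0≤c₁ 0) (0≤c₂ 0) (R.0≤fromℕ D) (0≤zetaSum 1 D) D≤ p q)
  (both (both D≤γ large) (from (suc D) λ _ h → h))
  where open Estimate n∈𝒞 floors

-- From x ≥ 2 and 4 ln x ≥ 1 follows 4 x ln x ≥ 2, whereas x ln x ≤ 0 read with precision ¼ gives 4
-- x ln x ≤ 1.
x*ln-positive : ∀ {x} (pos : 0ℝ < x) → Eventually (λ N → fromℕ 2 ℚ.≤ seq x N) → ¬ (x * ln x pos ≤ 0ℝ)
x*ln-positive {x} pos large small = absurd (both (both large (from 2 λ _ h → h)) (small ¼ (R.0<* R.0<½ R.0<½)))
  where
  open ℚP.≤-Reasoning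
  swap : ∀ g t l → g ℚ.* (t ℚ.* l) ≡ t ℚ.* (g ℚ.* l)
  swap = solve-∀ ℚ-ring
  impossible : ∀ g l → fromℕ 2 ℚ.≤ g → 1ℚ ℚ.≤ fromℕ 4 ℚ.* l → ¬ (g ℚ.* l ℚ.≤ 0ℚ ℚ.+ ¼)
  impossible g l 2≤g 1≤4l p = ℚP.<-irrefl refl (ℚP.<-≤-trans (R.n<1+n 1) (begin
    fromℕ 2                  ≤⟨ R.*-mono (R.0≤fromℕ 2) 2≤g R.0≤1 1≤4l ⟩
    g ℚ.* (fromℕ 4 ℚ.* l)    ≡⟨ swap g (fromℕ 4) l ⟩
    fromℕ 4 ℚ.* (g ℚ.* l)    ≤⟨ R.*-monoˡ (R.0≤fromℕ 4) p ⟩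
    fromℕ 1                  ∎))
  absurd : ¬ Eventually (λ N → (fromℕ 2 ℚ.≤ seq x N × 2 ℕ.≤ N) × seq x N ℚ.* seq (ln x pos) N ℚ.≤ 0ℚ ℚ.+ ¼)
  absurd (N , h) =
    let ((2≤x , 1<N) , p) = h N ℕP.≤-refl
        x≥1 = ℚP.≤-trans (R.fromℕ-mono {1} {2} (ℕ.s≤s ℕ.z≤n)) 2≤x
        (q , _) = ln-lower x pos 1 0 N 1<N 2≤x (subst (fromℕ 1 ℚ.≤_) (sym (ℚP.*-identityˡ (seq x N))) x≥1)
    in impossible (seq x N) (seq (ln x pos) N) 2≤x q p

bound₃ : (A c c′ : ℚ) → ℕ → ℚ
bound₃ A c c′ i = A R.^ i ℚ.* (c ℚ.* fromℕ 2 ℚ.+ c′)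

-- For k > 2 the sum of d¹⁻ᵏ has an exponent of at least 2 and stays below 2, so no logarithm
-- arises.
error≤₃ : ∀ {A c c′ d h} i x N → 0ℚ ℚ.≤ c → 0ℚ ℚ.≤ c′ → 0ℚ ℚ.≤ d → h ℚ.≤ fromℕ 2 → d ℚ.≤ A ℚ.* seq x N →
  errorTerm d h c c′ i ℚ.≤ seq (fromℚ (bound₃ A c c′ i) * x ^ i) N
error≤₃ {A} {c} {c′} {d} {h} i x N 0≤c 0≤c′ 0≤d h≤2 d≤ = begin
  d R.^ i ℚ.* (c ℚ.* h ℚ.+ c′)
    ≤⟨ R.*-monoˡ (R.0≤^ i 0≤d) (ℚP.+-monoˡ-≤ c′ (R.*-monoˡ 0≤c h≤2)) ⟩
  d R.^ i ℚ.* K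
    ≤⟨ *-monoʳ (R.0≤+ (R.0≤* 0≤c (R.0≤fromℕ 2)) 0≤c′) (R.^-mono i 0≤d d≤) ⟩
  (A ℚ.* seq x N) R.^ i ℚ.* K
    ≡⟨ cong (ℚ._* K) (^-distrib-* A (seq x N) i) ⟩
  A R.^ i ℚ.* seq x N R.^ i ℚ.* K
    ≡⟨ swap (A R.^ i) (seq x N R.^ i) K ⟩
  bound₃ A c c′ i ℚ.* seq x N R.^ i
    ≡⟨ cong (bound₃ A c c′ i ℚ.*_) (^-seq x i N) ⟨
  bound₃ A c c′ i ℚ.* seq (x ^ i) N ∎
  where
  open ℚP.≤-Reasoning
  K : ℚ
  K = c ℚ.* fromℕ 2 ℚ.+ c′
  swap : ∀ a g k → (a ℚ.* g) ℚ.* k ≡ (a ℚ.* k) ℚ.* g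
  swap = solve-∀ ℚ-ring

eventually-error≤₃ : ∀ {j E n} (n∈𝒞 : 𝒞 {suc (suc (suc j))} E n) {m} (floors : Pointwise IsFloor n m) →
  Eventually (λ N → Estimate.error n∈𝒞 floors (suc (suc j)) ℚ.≤
    seq (fromℚ (bound₃ (fromℕ (2 ℕ.^ suc (exponent E))) (c₁ (suc j)) (c₂ (suc j)) (suc (suc j))) * γ n ^ (suc (suc j))) N)
eventually-error≤₃ {j} {E} {n} n∈𝒞 floors = map-eventually
  (λ N → error≤₃ {fromℕ (2 ℕ.^ suc (exponent E))} (suc (suc j)) (γ n) N (0≤c₁ (suc j)) (0≤c₂ (suc j)) (R.0≤fromℕ D) (zetaSum≤2 j D)) D≤γ
  where open Estimate n∈𝒞 floors

-- The numeral and the instance are those in the clauses of f, which keeps the two sides syntactically equal.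
f-2 : ∀ .{{nt : NonTrivial (suc (suc zero))}} {E} (n : Vec ℝ (suc (suc zero))) (n∈𝒞 : 𝒞 E n) →
  f (suc (suc zero)) {{nt}} n n∈𝒞 ≡ γ n * ln (γ n) (γ-pos (𝒞.≥1 n∈𝒞))
f-2 n n∈𝒞 = refl

f-≥3 : ∀ {j} .{{nt : NonTrivial (suc (suc (suc j)))}} {E} (n : Vec ℝ (suc (suc (suc j)))) (n∈𝒞 : 𝒞 E n) →
  f (suc (suc (suc j))) {{nt}} n n∈𝒞 ≡ γ n ^ (suc (suc (suc j)) ℕ.∸ 1)
f-≥3 n n∈𝒞 = refl

γ^-exponent : ∀ {j} .{{_ : NonTrivial (suc (suc (suc j)))}} (n : Vec ℝ (suc (suc (suc j)))) →
  γ n ^ (suc (suc (suc j)) ℕ.∸ 1) ≡ γ n ^ suc (suc j)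
γ^-exponent {j} n = cong (γ n ^_) {x = suc (suc (suc j)) ℕ.∸ 1} {y = suc (suc j)} refl

-- Assembly of the cases k = 2 and k > 2.

theorem-2 : .{{nt : NonTrivial (suc (suc zero))}} (E : ℝ) → 1ℝ ≤ E →
  _≐_+𝒪_ {suc (suc zero)} {E} ∣Q∣ (λ n _ → product n ÷ ζ (suc (suc zero)) {{nt}} [ 0<ζ (suc (suc zero)) {{nt}} ]) (f (suc (suc zero)) {{nt}})
theorem-2 {{nt}} E 1≤E = record
  { C₀         = InRegion E
  ; C₀-compact = region-compact E 1≤E
  ; C₀⊆𝒞       = inside
  ; g-positive = positive
  ; M          = fromℚ M₂
  ; C          = InRegion E
  ; C-compact  = region-compact E 1≤E
  ; C⊆𝒞        = inside
  ; estimate   = bounded }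
  where
  M₂ : ℚ
  M₂ = bound₂ (fromℕ (2 ℕ.^ suc (exponent E))) (fromℕ (4 ℕ.+ exponent E)) (c₁ 0) (c₂ 0)
  inside : ∀ n → InRegion E n → 𝒞 E n
  inside (x ∷ y ∷ []) = region⇒𝒞 1≤E
  positive : ∀ n (n∈𝒞 : 𝒞 E n) → ¬ InRegion E n → ¬ (f (suc (suc zero)) {{nt}} n n∈𝒞 ≤ 0ℝ)
  positive n n∈𝒞 outside = subst (λ g → ¬ (g ≤ 0ℝ)) (sym (f-2 {{nt}} n n∈𝒞)) λ small →
    γ-large 1≤E n∈𝒞 outside λ large → x*ln-positive {γ n} (γ-pos (𝒞.≥1 n∈𝒞)) large small
  bounded : ∀ n (n∈𝒞 : 𝒞 E n) → ¬ InRegion E n → ∀ y → ∣Q∣ n y →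
    ∣ y - product n ÷ ζ (suc (suc zero)) {{nt}} [ 0<ζ (suc (suc zero)) {{nt}} ] ∣ ≤ fromℚ M₂ * f (suc (suc zero)) {{nt}} n n∈𝒞
  bounded n n∈𝒞 outside y y∈ =
    subst (λ g → ∣ y - product n ÷ ζ (suc (suc zero)) {{nt}} [ 0<ζ (suc (suc zero)) {{nt}} ] ∣ ≤ fromℚ M₂ * g) (sym (f-2 {{nt}} n n∈𝒞))
      (estimate {{nt}} n∈𝒞 1 refl y y∈ (fromℚ M₂ * (γ n * ln (γ n) (γ-pos (𝒞.≥1 n∈𝒞)))) λ floors fails →
        γ-large 1≤E n∈𝒞 outside λ large → fails (eventually-error≤₂ n∈𝒞 (γ-pos (𝒞.≥1 n∈𝒞)) floors large))

theorem-≥3 : ∀ {j} .{{nt : NonTrivial (suc (suc (suc j)))}} (E : ℝ) → 1ℝ ≤ E →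
  _≐_+𝒪_ {suc (suc (suc j))} {E} ∣Q∣ (λ n _ → product n ÷ ζ (suc (suc (suc j))) {{nt}} [ 0<ζ (suc (suc (suc j))) {{nt}} ])
    (f (suc (suc (suc j))) {{nt}})
theorem-≥3 {j} {{nt}} E 1≤E = record
  { C₀         = λ _ → ⊥
  ; C₀-compact = ∅-compact
  ; C₀⊆𝒞       = λ _ ()
  ; g-positive = positive
  ; M          = fromℚ M₃
  ; C          = λ _ → ⊥
  ; C-compact  = ∅-compact
  ; C⊆𝒞        = λ _ ()
  ; estimate   = bounded }
  where
  M₃ : ℚ
  M₃ = bound₃ (fromℕ (2 ℕ.^ suc (exponent E))) (c₁ (suc j)) (c₂ (suc j)) (suc (suc j))
  g≡ : ∀ n (n∈𝒞 : 𝒞 E n) → γ n ^ suc (suc j) ≡ f (suc (suc (suc j))) {{nt}} n n∈𝒞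
  g≡ n n∈𝒞 = sym (trans (f-≥3 {{nt}} n n∈𝒞) (γ^-exponent n))
  positive : ∀ n (n∈𝒞 : 𝒞 E n) → ¬ ⊥ → ¬ (f (suc (suc (suc j))) {{nt}} n n∈𝒞 ≤ 0ℝ)
  positive n n∈𝒞 _ = subst (λ g → ¬ (g ≤ 0ℝ)) (g≡ n n∈𝒞)
    (<-≤-absurd {0ℝ} {γ n ^ suc (suc j)} (^-pos {γ n} (suc (suc j)) (γ-pos (𝒞.≥1 n∈𝒞))))
  bounded : ∀ n (n∈𝒞 : 𝒞 E n) → ¬ ⊥ → ∀ y → ∣Q∣ n y →
    ∣ y - product n ÷ ζ (suc (suc (suc j))) {{nt}} [ 0<ζ (suc (suc (suc j))) {{nt}} ] ∣ ≤ fromℚ M₃ * f (suc (suc (suc j))) {{nt}} n n∈𝒞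
  bounded n n∈𝒞 _ y y∈ =
    subst (λ g → ∣ y - product n ÷ ζ (suc (suc (suc j))) {{nt}} [ 0<ζ (suc (suc (suc j))) {{nt}} ] ∣ ≤ fromℚ M₃ * g) (g≡ n n∈𝒞)
      (estimate {{nt}} n∈𝒞 (suc (suc j)) refl y y∈ (fromℚ M₃ * γ n ^ suc (suc j)) λ floors fails →
        fails (eventually-error≤₃ n∈𝒞 floors))

theorem5p2 : (k : ℕ) .{{_ : NonTrivial k}} (E : ℝ) → 1ℝ ≤ E →
    _≐_+𝒪_ {k} {E} ∣Q∣ (λ n _ → product n ÷ ζ k [ 0<ζ k ]) (f k)
theorem5p2 (suc (suc zero))    {{nt}} E 1≤E = theorem-2 {{nt}} E 1≤E
theorem5p2 (suc (suc (suc j))) {{nt}} E 1≤E = theorem-≥3 {j} {{nt}} E 1≤E
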